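{- For every integer $d\ge2$ and every $\varepsilon\in(0,1)$ there exist a positive integer $r=r(d,\varepsilon)$ and a constant $c=c(d,\varepsilon)>0$ such that for all positive integers $n$ and $m$ there is a set $P$ of $n$ points in $\mathbb{R}^d$ and an arrangement $\mathcal{H}$ of $m$ hyperplanes in $\mathbb{R}^d$ such that the incidence graph $G(P,\mathcal{H})$ does not contain $K_{r,r}$ as a subgraph and \[\mathrm{inc}(P,\mathcal{H})\ge\begin{cases} c\,(mn)^{1-(2d+3)/((d+2)(d+3))-\varepsilon} & \text{if } d \text{ is odd},\\ c\,(mn)^{1-(2d^2+d-2)/((d+2)(d^2+2d-2))-\varepsilon} & \text{if } d \text{ is even}.\end{cases}\]
   Context: For a set $P$ of points and a set $\mathcal{H}$ of hyperplanes in $\mathbb{R}^d$, an incidence is a pair $(p,H)$ with $p\in P$, $H\in\mathcal{H}$, $p\in H$; $\mathrm{inc}(P,\mathcal{H})$ is the number of incidences. The incidence graph $G(P,\mathcal{H})$ is the bipartite graph on vertex set $P\cup\mathcal{H}$ with an edge $\{p,H\}$ for each incidence $(p,H)$. $K_{r,r}$ is the complete bipartite graph with both parts of size $r$. -}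

module Defs where

open import Level using (0ℓ)
open import Data.Nat as ℕ using (ℕ; zero; suc; _%_)
open import Data.Integer as ℤ using (+_; -[1+_])
open import Data.Rational as ℚ using (ℚ; ↥_; ↧ₙ_; 0ℚ; 1ℚ)
open import Data.Fin using (Fin; zero; suc)
open import Data.List using (List; tabulate)
open import Data.Nat.ListAction using (sum)
open import Data.Product using (Σ; ∃; _×_; _,_)
open import Relation.Nullary using (¬_; Dec; yes; no)
open import Relation.Binary.Core using (Rel)
open import Relation.Binary.Definitions using (Decidable)
open import Relation.Binary.Structures using (IsTotalOrder)
open import Relation.Binary.PropositionalEquality using (_≡_; _≢_)
open import Function.Definitions using (Injective)
open import Algebra.Bundles using (CommutativeRing)

-- The real numbers, axiomatised as a complete ordered field
-- (unique up to isomorphism).  Equality of reals is decidable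
-- (classically true), which is needed to count incidences.

record CompleteOrderedField : Set₁ where
  field
    commutativeRing : CommutativeRing 0ℓ 0ℓ
  open CommutativeRing commutativeRing public
  field
    _≤_          : Rel Carrier 0ℓ
    isTotalOrder : IsTotalOrder _≈_ _≤_
    +-monoˡ-≤    : ∀ {x y} z → x ≤ y → (x + z) ≤ (y + z)
    *-nonneg     : ∀ {x y} → 0# ≤ x → 0# ≤ y → 0# ≤ (x * y)
    0≉1          : ¬ (0# ≈ 1#)
    inverse      : ∀ x → ¬ (x ≈ 0#) → Σ Carrier (λ y → (x * y) ≈ 1#)
    _≟_          : Decidable _≈_
    complete     : (S : Carrier → Set) → ∃ S →
                   ∃ (λ b → ∀ x → S x → x ≤ b) →
                   ∃ (λ s → (∀ x → S x → x ≤ s) ×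
                            (∀ b → (∀ x → S x → x ≤ b) → s ≤ b))

module Geometry (ℝ : CompleteOrderedField) (d : ℕ) where
  open CompleteOrderedField ℝ hiding (zero)

  Point : Set
  Point = Fin d → Carrier

  sumR : ∀ {k} → (Fin k → Carrier) → Carrier
  sumR {zero}  f = 0#
  sumR {suc k} f = f zero + sumR (λ i → f (suc i))

  record Hyperplane : Set where
    constructor hyperplane
    field
      normal  : Fin d → Carrier
      offset  : Carrier
      nonzero : ∃ (λ k → ¬ (normal k ≈ 0#))

  _∈H_ : Point → Hyperplane → Set
  p ∈H hyperplane a b _ = sumR (λ k → a k * p k) ≈ b

  _∈H?_ : (p : Point) (H : Hyperplane) → Dec (p ∈H H)
  p ∈H? hyperplane a b _ = sumR (λ k → a k * p k) ≟ b

  _≠P_ : Point → Point → Set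
  p ≠P q = ¬ (∀ k → p k ≈ q k)

  _≠H_ : Hyperplane → Hyperplane → Set
  H ≠H H' = ¬ (∀ x → (x ∈H H → x ∈H H') × (x ∈H H' → x ∈H H))

  PointSet : ℕ → Set
  PointSet n = Σ (Fin n → Point) (λ P → ∀ i j → i ≢ j → P i ≠P P j)

  Arrangement : ℕ → Set
  Arrangement m = Σ (Fin m → Hyperplane) (λ H → ∀ i j → i ≢ j → H i ≠H H j)

  indicator : ∀ {A : Set} → Dec A → ℕ
  indicator (yes _) = 1
  indicator (no _)  = 0

  inc : ∀ {n m} → (Fin n → Point) → (Fin m → Hyperplane) → ℕ
  inc P H = sum (tabulate (λ i → sum (tabulate (λ j → indicator (P i ∈H? H j)))))

  ContainsK : ∀ {n m} → ℕ → (Fin n → Point) → (Fin m → Hyperplane) → Set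
  ContainsK {n} {m} r P H =
    Σ (Fin r → Fin n) λ f → Σ (Fin r → Fin m) λ g →
      Injective _≡_ _≡_ f × Injective _≡_ _≡_ g ×
      (∀ a b → P (f a) ∈H H (g b))

_^ℚ_ : ℚ → ℕ → ℚ
q ^ℚ zero  = 1ℚ
q ^ℚ suc k = q ℚ.* (q ^ℚ k)

-- a / b as a rational (only used with b > 0)
_÷ℕ_ : ℕ → ℕ → ℚ
a ÷ℕ zero  = 0ℚ
a ÷ℕ suc b = + a ℚ./ suc b

-- PowGe x c e y  expresses  x ≥ c · y^e  for a rational exponent
-- e = num/den (den > 0), when x ≥ 0, c > 0, y ≥ 1:
-- equivalently x^den ≥ c^den · y^num (num ≥ 0), resp.
-- x^den · y^(-num) ≥ c^den (num < 0).
PowGe : ℕ → ℚ → ℚ → ℕ → Set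
PowGe x c e y with ↥ e
... | + k      = ((c ^ℚ (↧ₙ e)) ℚ.* ((+ y ℚ./ 1) ^ℚ k)) ℚ.≤ ((+ x ℚ./ 1) ^ℚ (↧ₙ e))
... | -[1+ k ] = (c ^ℚ (↧ₙ e)) ℚ.≤ (((+ x ℚ./ 1) ^ℚ (↧ₙ e)) ℚ.* ((+ y ℚ./ 1) ^ℚ suc k))

baseExponent : ℕ → ℚ
baseExponent d with d % 2
... | zero  = 1ℚ ℚ.- ((2 ℕ.* d ℕ.* d ℕ.+ d ℕ.∸ 2) ÷ℕ ((d ℕ.+ 2) ℕ.* (d ℕ.* d ℕ.+ 2 ℕ.* d ℕ.∸ 2)))
... | suc _ = 1ℚ ℚ.- ((2 ℕ.* d ℕ.+ 3) ÷ℕ ((d ℕ.+ 2) ℕ.* (d ℕ.+ 3)))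

{-# OPTIONS --safe #-}

-- Write d = s₁ + s₂ with s₁ and s₂ as equal as possible and let p be a large prime. Choose points x in the grid
-- {0, …, N − 1}^d so that no R of them lie modulo N in the affine span of s₁ of them; a greedy choice by conditional
-- expectations gives about N^(s₂ + 1) points. Likewise choose w in (ℤ/Q)^(d − 1), avoiding R vectors in an affine span
-- of s₂ of them. By Thue's pigeonhole argument (1, w) has modulo Q a multiple a with entries of size at most
-- Q^((d − 1)/d), and for most w the multiplier is a unit. These a are the normals, and all offsets b with
-- |b| ≤ d N Q^((d − 1)/d) are used, so every point lies on one hyperplane of each direction.
-- If R points and R hyperplanes formed a K_{R,R}, then there would be s₁ + 1 vectors (1, x) and s₂ + 1 vectors (−b, a),
-- each family independent over the local ring modulo a power of p, and orthogonal to each other. These d + 2 vectors of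
-- ℤ^(d + 1) have an integer dependency with a coefficient prime to p; its two halves are orthogonal and opposite, hence
-- both zero, contradicting independence.
-- Optimising N and Q gives the bound for n ≥ m, and point-hyperplane duality the case n < m.
module Submission where

open import Defs
import Algebra.Properties.Semiring.Sum as SemiringSum
import Algebra.Properties.Semiring.Mult as SemiringMult
import Algebra.Properties.Ring as RingProperties
open import Data.Empty using (⊥; ⊥-elim)
open import Data.Fin as Fin using (Fin; zero; suc; toℕ; fromℕ<; punchIn; punchOut; _↑ˡ_; _↑ʳ_)
import Data.Fin.Properties as Finₚ
open import Data.Integer as ℤ using (ℤ; +_; -[1+_]; 0ℤ; 1ℤ; ∣_∣)
import Data.Integer.DivMod as ℤ
import Data.Integer.Divisibility.Signed as ℤ∣
import Data.Integer.Properties as ℤₚ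
open import Data.Integer.Tactic.RingSolver using () renaming (solve-∀ to ℤ-solve-∀)
open import Data.List as List using (List; []; _∷_; length)
open import Data.List.Membership.Propositional using (_∈_; _∉_)
import Data.List.Membership.Propositional.Properties as ∈ₚ
import Data.List.Properties as Listₚ
open import Data.List.Relation.Unary.All using (_∷_)
open import Data.List.Relation.Unary.Any using (here; there)
import Data.List.Relation.Unary.Any as Any
import Data.List.Relation.Unary.Any.Properties as AnyP
open import Data.Nat as ℕ using (ℕ; zero; suc; _+_; _*_; _∸_; _^_; _≤_; _<_; _≥_; z≤n; s≤s; NonZero)
import Data.Nat.Coprimality as Coprime
import Data.Nat.DivMod as ℕ
import Data.Nat.Divisibility as ℕ∣
import Data.Nat.GCD as GCD
open import Data.Nat.Base using (_!)
open import Data.Nat.ListAction using (sum)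
open import Data.Nat.Primality as Prime using (Prime)
open import Data.Nat.Primality.Factorisation using (factorise)
import Data.Nat.Properties as ℕₚ
open import Data.Nat.Tactic.RingSolver using () renaming (solve-∀ to ℕ-solve-∀)
open import Data.Product using (Σ; ∃; _×_; _,_; proj₁; proj₂)
open import Data.Product.Properties using (≡-dec)
open import Data.Rational as ℚ using (ℚ; 0ℚ; 1ℚ; ↥_; ↧ₙ_)
import Data.Rational.Properties as ℚₚ
open import Data.Rational.Solver using (module +-*-Solver)
import Data.Rational.Unnormalised as ℚᵘ
import Data.Rational.Unnormalised.Properties as ℚᵘₚ
open import Data.Sum using (_⊎_; inj₁; inj₂; [_,_]′)
open import Function using (_∘_; id)
open import Function.Definitions using (Injective)
open import Relation.Nullary using (¬_; ¬?; Dec; yes; no; contradiction)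
open import Relation.Binary.Structures using (IsTotalOrder)
import Relation.Binary.Reasoning.Setoid as SetoidReasoning
open import Relation.Binary.PropositionalEquality using (_≡_; _≢_; refl; sym; trans; cong; cong₂; subst; subst₂; module ≡-Reasoning)

-- Linear algebra over ℤ

-- One prime p, depending only on d, serves all n and m. N and Q are powers of it, so fitting them
-- to n and m loses only a bounded power of p, which the constant c absorbs. The price is zero
-- divisors modulo N and Q: a relation can be solved for a vector only if its coefficient is prime
-- to p, so independence means that no relation has such a coefficient. For the same reason the
-- multiplier in Thue's argument must be a unit; p > 8^(d - 1) leaves at least the share 1/p of all
-- directions with one. K_{R,R} is excluded for arbitrary offsets, so surplus translates bring the
-- number of hyperplanes to exactly m. In terms of G = Q^(1/d) there are N^A points, about G^β
-- normals and, with D = d - 1, about N G^D offsets for each. Eliminating N and G from n = N^A and m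
-- = N G^(D + β) turns the incidence count n G^β into n^(1 - β/(A F)) m^(β/F) with F = D + β. The
-- exponent of n is at least that of m when β ≤ A D, so n ≥ m is the favourable case; n = m gives
-- the exponent of the theorem. The ε pays for R being bounded: the greedy choice loses a factor
-- N^O(1/R).

module ΣN = SemiringSum ℕₚ.+-*-semiring
module ΣZ = SemiringSum ℤₚ.+-*-semiring
open ΣZ using () renaming (sum to Σℤ)
open ΣN using () renaming (sum to Σℕ)

Σℤ-zero : ∀ {n} {f : Fin n → ℤ} → (∀ i → f i ≡ 0ℤ) → Σℤ f ≡ 0ℤ
Σℤ-zero {n} f≡0 = trans (ΣZ.sum-cong-≗ f≡0) (ΣZ.sum-replicate-zero n)

Σℤ-∣ : ∀ {n} {f : Fin n → ℤ} {q} → (∀ i → q ℤ∣.∣ f i) → q ℤ∣.∣ Σℤ f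
Σℤ-∣ {zero}  q∣f = ℤ∣.divides 0ℤ refl
Σℤ-∣ {suc n} q∣f = ℤ∣.∣m∣n⇒∣m+n (q∣f zero) (Σℤ-∣ (q∣f ∘ suc))

Σℤ-↑ : ∀ m {n} (f : Fin (m + n) → ℤ) → Σℤ f ≡ Σℤ (f ∘ (_↑ˡ n)) ℤ.+ Σℤ (f ∘ (m ↑ʳ_))
Σℤ-↑ zero    f = sym (ℤₚ.+-identityˡ _)
Σℤ-↑ (suc m) f = trans (cong (ℤ._+_ (f zero)) (Σℤ-↑ m (f ∘ suc))) (sym (ℤₚ.+-assoc (f zero) _ _))

lincomb : ∀ {l k} → (Fin l → ℤ) → (Fin l → Fin k → ℤ) → Fin k → ℤ
lincomb c V k = Σℤ (λ i → c i ℤ.* V i k)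

infix 8 _·_
_·_ : ∀ {k} → (Fin k → ℤ) → (Fin k → ℤ) → ℤ
v · w = Σℤ (λ k → v k ℤ.* w k)

·-comm : ∀ {k} (v w : Fin k → ℤ) → v · w ≡ w · v
·-comm v w = ΣZ.sum-cong-≗ (λ k → ℤₚ.*-comm (v k) (w k))

lincomb-· : ∀ {l k} c (V : Fin l → Fin k → ℤ) w → lincomb c V · w ≡ Σℤ (λ i → c i ℤ.* V i · w)
lincomb-· {l} {k} c V w = begin
  Σℤ (λ k → Σℤ (λ i → c i ℤ.* V i k) ℤ.* w k)
    ≡⟨ ΣZ.sum-cong-≗ (λ k → ΣZ.*-distribʳ-sum {n = l} (w k) _) ⟩
  Σℤ (λ k → Σℤ (λ i → c i ℤ.* V i k ℤ.* w k))
    ≡⟨ ΣZ.∑-comm (λ k i → c i ℤ.* V i k ℤ.* w k) ⟩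
  Σℤ (λ i → Σℤ (λ k → c i ℤ.* V i k ℤ.* w k))
    ≡⟨ ΣZ.sum-cong-≗ (λ i → trans (ΣZ.sum-cong-≗ {n = k} (λ k → ℤₚ.*-assoc (c i) (V i k) (w k)))
                                   (sym (ΣZ.*-distribˡ-sum {n = k} (c i) _))) ⟩
  Σℤ (λ i → c i ℤ.* V i · w) ∎
  where open ≡-Reasoning

square-nonneg : ∀ i → 0ℤ ℤ.≤ i ℤ.* i
square-nonneg (+ n)    = subst (0ℤ ℤ.≤_) (ℤₚ.pos-* n n) (ℤ.+≤+ z≤n)
square-nonneg -[1+ n ] = ℤ.+≤+ z≤n

v·v-nonneg : ∀ {k} (v : Fin k → ℤ) → 0ℤ ℤ.≤ v · v
v·v-nonneg {zero}  v = ℤₚ.≤-refl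
v·v-nonneg {suc k} v = ℤₚ.+-mono-≤ (square-nonneg (v zero)) (v·v-nonneg (v ∘ suc))

nonneg-sum-zero : ∀ {i j} → 0ℤ ℤ.≤ i → 0ℤ ℤ.≤ j → i ℤ.+ j ≡ 0ℤ → i ≡ 0ℤ × j ≡ 0ℤ
nonneg-sum-zero {+ zero} {+ zero} _ _ _ = refl , refl
nonneg-sum-zero {+ zero} {+ suc n} _ _ ()
nonneg-sum-zero {+ suc m} {+ n} _ _ ()

v·v≡0⇒v≡0 : ∀ {k} (v : Fin k → ℤ) → v · v ≡ 0ℤ → ∀ i → v i ≡ 0ℤ
v·v≡0⇒v≡0 {suc k} v eq i with nonneg-sum-zero (square-nonneg (v zero)) (v·v-nonneg (v ∘ suc)) eq
v·v≡0⇒v≡0 {suc k} v eq zero    | e₀ , _ with ℤₚ.i*j≡0⇒i≡0∨j≡0 (v zero) e₀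
... | inj₁ e = e
... | inj₂ e = e
v·v≡0⇒v≡0 {suc k} v eq (suc i) | _ , e₁ = v·v≡0⇒v≡0 (v ∘ suc) e₁ i

insert : ∀ {A : Set} {n} → Fin (suc n) → A → (Fin n → A) → Fin (suc n) → A
insert i x f j with i Finₚ.≟ j
... | yes _  = x
... | no i≢j = f (punchOut i≢j)

insert-at : ∀ {A : Set} {n} (i : Fin (suc n)) (x : A) f → insert i x f i ≡ x
insert-at i x f with i Finₚ.≟ i
... | yes _  = refl
... | no i≢i = contradiction refl i≢i

insert-punchIn : ∀ {A : Set} {n} (i : Fin (suc n)) (x : A) f j → insert i x f (punchIn i j) ≡ f j
insert-punchIn i x f j with i Finₚ.≟ punchIn i j
... | yes e  = contradiction (sym e) (Finₚ.punchInᵢ≢i i j)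
... | no i≢j = cong f (trans (Finₚ.punchOut-cong i refl) (Finₚ.punchOut-punchIn i))

-- Fraction-free Gaussian elimination: the rows `W` have coordinate `zero` cleared without division,
-- and the coefficient `x` of the pivot row `V i` collects the multiples of it that were subtracted.
dependency : ∀ {l k} → k < l → (V : Fin l → Fin k → ℤ) →
  ∃ λ (c : Fin l → ℤ) → (∃ λ i → c i ≢ 0ℤ) × (∀ j → lincomb c V j ≡ 0ℤ)
dependency {suc l} {zero} _ V = (λ _ → 1ℤ) , (zero , λ ()) , λ ()
dependency {suc l} {suc k} (s≤s k<l) V with Finₚ.any? (λ i → ¬? (V i zero ℤ.≟ 0ℤ))
... | no none = c , nz , λ { zero → Σℤ-zero (λ i → trans (cong (c i ℤ.*_) (allzero i)) (ℤₚ.*-zeroʳ (c i)))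
                           ; (suc j) → dep j }
  where
  allzero : ∀ i → V i zero ≡ 0ℤ
  allzero i with V i zero ℤ.≟ 0ℤ
  ... | yes e = e
  ... | no ne = contradiction (i , ne) none
  rec = dependency (ℕₚ.m<n⇒m<1+n k<l) (λ i j → V i (suc j))
  c = proj₁ rec
  nz = proj₁ (proj₂ rec)
  dep = proj₂ (proj₂ rec)
... | yes (i , v≢0) = c , (punchIn i (proj₁ nz) , c≢0) , dep′
  where
  v = V i zero
  W : Fin l → Fin (suc k) → ℤ
  W j h = v ℤ.* V (punchIn i j) h ℤ.- V (punchIn i j) zero ℤ.* V i h
  rec = dependency k<l (λ j h → W j (suc h))
  e = proj₁ rec
  nz = proj₁ (proj₂ rec)
  x = ℤ.- Σℤ (λ j → e j ℤ.* V (punchIn i j) zero)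
  c = insert i x (λ j → v ℤ.* e j)
  c≢0 : c (punchIn i (proj₁ nz)) ≢ 0ℤ
  c≢0 eq with ℤₚ.i*j≡0⇒i≡0∨j≡0 v (trans (sym (insert-punchIn i x _ (proj₁ nz))) eq)
  ... | inj₁ z = v≢0 z
  ... | inj₂ z = proj₂ nz z
  expand : ∀ h → lincomb c V h ≡ Σℤ (λ j → e j ℤ.* W j h)
  expand h = begin
    lincomb c V h
      ≡⟨ ΣZ.sum-remove {i = i} (λ a → c a ℤ.* V a h) ⟩
    c i ℤ.* V i h ℤ.+ Σℤ (λ j → c (punchIn i j) ℤ.* V (punchIn i j) h)
      ≡⟨ cong₂ ℤ._+_ (cong (ℤ._* V i h) (insert-at i x _))
           (ΣZ.sum-cong-≗ (λ j → cong (ℤ._* V (punchIn i j) h) (insert-punchIn i x _ j))) ⟩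
    x ℤ.* V i h ℤ.+ Σℤ (λ j → v ℤ.* e j ℤ.* V (punchIn i j) h)
      ≡⟨ cong (ℤ._+ S) x-eq ⟩
    Σℤ (λ j → e j ℤ.* V (punchIn i j) zero ℤ.* ℤ.- V i h) ℤ.+ S
      ≡⟨ ΣZ.∑-distrib-+ {n = l} _ _ ⟨
    Σℤ (λ j → e j ℤ.* V (punchIn i j) zero ℤ.* ℤ.- V i h ℤ.+ v ℤ.* e j ℤ.* V (punchIn i j) h)
      ≡⟨ ΣZ.sum-cong-≗ (λ j → rearrange (e j) (V (punchIn i j) zero) (V i h) v (V (punchIn i j) h)) ⟩
    Σℤ (λ j → e j ℤ.* W j h) ∎
    where
    open ≡-Reasoning
    S = Σℤ (λ j → v ℤ.* e j ℤ.* V (punchIn i j) h)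
    rearrange : ∀ a b c d f → a ℤ.* b ℤ.* ℤ.- c ℤ.+ d ℤ.* a ℤ.* f ≡ a ℤ.* (d ℤ.* f ℤ.- b ℤ.* c)
    rearrange = ℤ-solve-∀
    neg-swap : ∀ a b → ℤ.- a ℤ.* b ≡ a ℤ.* ℤ.- b
    neg-swap = ℤ-solve-∀
    x-eq : x ℤ.* V i h ≡ Σℤ (λ j → e j ℤ.* V (punchIn i j) zero ℤ.* ℤ.- V i h)
    x-eq = trans (neg-swap (Σℤ (λ j → e j ℤ.* V (punchIn i j) zero)) (V i h))
                 (ΣZ.*-distribʳ-sum {n = l} (ℤ.- V i h) _)
  dep′ : ∀ h → lincomb c V h ≡ 0ℤ
  dep′ zero = trans (expand zero) (Σℤ-zero (λ j →
    trans (cong (e j ℤ.*_) (cancel v (V (punchIn i j) zero))) (ℤₚ.*-zeroʳ (e j))))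
    where
    cancel : ∀ a b → a ℤ.* b ℤ.- b ℤ.* a ≡ 0ℤ
    cancel = ℤ-solve-∀
  dep′ (suc h) = trans (expand (suc h)) (proj₂ (proj₂ rec) h)

module _ (p : ℕ) (1<p : 1 < p) where

  -- Dividing all coefficients by p keeps a relation over ℤ and shrinks the nonzero coefficient
  -- `c i`, so the bound `N` for its size runs out unless some coefficient is prime to p.
  reduce : ∀ {l k} (V : Fin l → Fin k → ℤ) N (c : Fin l → ℤ) i → ∣ c i ∣ ≤ N → c i ≢ 0ℤ →
    (∀ j → lincomb c V j ≡ 0ℤ) →
    ∃ λ (c : Fin l → ℤ) → (∃ λ i → ¬ (+ p ℤ∣.∣ c i)) × (∀ j → lincomb c V j ≡ 0ℤ)
  reduce V zero c i le nz dep = contradiction (ℤₚ.∣i∣≡0⇒i≡0 (ℕₚ.n≤0⇒n≡0 le)) nz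
  reduce {l} V (suc N) c i le nz dep with Finₚ.all? (λ i → + p ℤ∣.∣? c i)
  ... | no ¬all = c , Finₚ.¬∀⟶∃¬ l _ (λ i → + p ℤ∣.∣? c i) ¬all , dep
  ... | yes all = reduce V N c′ i smaller nz′ dep′
    where
    c′ : Fin l → ℤ
    c′ a = ℤ∣.quotient (all a)
    eq : ∀ a → c a ≡ c′ a ℤ.* + p
    eq a = ℤ∣._∣_.equality (all a)
    nz′ : c′ i ≢ 0ℤ
    nz′ z = nz (trans (eq i) (cong (ℤ._* + p) z))
    smaller : ∣ c′ i ∣ ≤ N
    smaller = ℕₚ.≤-pred (ℕₚ.<-≤-trans (subst (∣ c′ i ∣ <_) (sym (trans (cong ∣_∣ (eq i)) (ℤₚ.∣i*j∣≡∣i∣*∣j∣ (c′ i) (+ p))))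
      (ℕₚ.m<m*n ∣ c′ i ∣ p {{ℕ.≢-nonZero (nz′ ∘ ℤₚ.∣i∣≡0⇒i≡0)}} 1<p)) le)
    dep′ : ∀ j → lincomb c′ V j ≡ 0ℤ
    dep′ j with ℤₚ.i*j≡0⇒i≡0∨j≡0 (+ p) (trans (trans (ΣZ.*-distribˡ-sum {n = l} (+ p) _)
      (ΣZ.sum-cong-≗ (λ a → trans (swap (+ p) (c′ a) (V a j)) (cong (ℤ._* V a j) (sym (eq a)))))) (dep j))
      where
      swap : ∀ a b c → a ℤ.* (b ℤ.* c) ≡ b ℤ.* a ℤ.* c
      swap = ℤ-solve-∀
    ... | inj₁ z = contradiction (cong ∣_∣ z) (ℕₚ.<⇒≢ (ℕₚ.<-trans (s≤s z≤n) 1<p) ∘ sym)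
    ... | inj₂ z = z

  primitive-dependency : ∀ {l k} → k < l → (V : Fin l → Fin k → ℤ) →
    ∃ λ (c : Fin l → ℤ) → (∃ λ i → ¬ (+ p ℤ∣.∣ c i)) × (∀ j → lincomb c V j ≡ 0ℤ)
  primitive-dependency k<l V with dependency k<l V
  ... | c , (i , nz) , dep = reduce V ∣ c i ∣ c i ℕₚ.≤-refl nz dep

  -- For q a power of p this is a weak independence over the local ring ℤ/q: coefficients of a
  -- relation may be nonzero but not units. It is just what a dependency with a coefficient prime to
  -- p contradicts.
  Independent : ∀ {l k} → ℕ → (Fin l → Fin k → ℤ) → Set
  Independent {l} {k} q V = (c : Fin l → ℤ) → (∀ j → + q ℤ∣.∣ lincomb c V j) → ∀ i → + p ℤ∣.∣ c i

  -- A dependency among all l₁ + l₂ vectors gives v = Σ c u = − Σ e a, and v · v = 0 by orthogonality.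
  orthogonal-independent : ∀ {l₁ l₂ k q₁ q₂} (U : Fin l₁ → Fin k → ℤ) (A : Fin l₂ → Fin k → ℤ) →
    Independent q₁ U → Independent q₂ A → (∀ i j → U i · A j ≡ 0ℤ) → ¬ (k < l₁ + l₂)
  orthogonal-independent {l₁} {l₂} {k} U A indU indA orth k<l = proj₂ nz (allp (proj₁ nz))
    where
    V : Fin (l₁ + l₂) → Fin k → ℤ
    V i with Fin.splitAt l₁ i
    ... | inj₁ a = U a
    ... | inj₂ b = A b
    V-ˡ : ∀ a → V (a ↑ˡ l₂) ≡ U a
    V-ˡ a rewrite Finₚ.splitAt-↑ˡ l₁ a l₂ = refl
    V-ʳ : ∀ b → V (l₁ ↑ʳ b) ≡ A b
    V-ʳ b rewrite Finₚ.splitAt-↑ʳ l₁ l₂ b = refl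
    pd = primitive-dependency k<l V
    c = proj₁ pd
    nz = proj₁ (proj₂ pd)
    cU = c ∘ (_↑ˡ l₂)
    cA = c ∘ (l₁ ↑ʳ_)
    split : ∀ j → lincomb cU U j ℤ.+ lincomb cA A j ≡ 0ℤ
    split j = trans (sym (trans (Σℤ-↑ l₁ (λ i → c i ℤ.* V i j)) (cong₂ ℤ._+_
      (ΣZ.sum-cong-≗ (λ a → cong (λ f → cU a ℤ.* f j) (V-ˡ a)))
      (ΣZ.sum-cong-≗ (λ b → cong (λ f → cA b ℤ.* f j) (V-ʳ b)))))) (proj₂ (proj₂ pd) j)
    v = lincomb cU U
    w = lincomb cA A
    v·w≡0 : v · w ≡ 0ℤ
    v·w≡0 = trans (lincomb-· cU U w) (Σℤ-zero (λ i → trans (cong (cU i ℤ.*_)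
      (trans (·-comm (U i) w) (trans (lincomb-· cA A (U i)) (Σℤ-zero (λ j →
        trans (cong (cA j ℤ.*_) (trans (·-comm (A j) (U i)) (orth i j))) (ℤₚ.*-zeroʳ (cA j)))))))
      (ℤₚ.*-zeroʳ (cU i))))
    w≡-v : ∀ j → w j ≡ ℤ.- v j
    w≡-v j = trans (solve′ (v j) (w j)) (trans (cong (ℤ._- v j) (split j)) (ℤₚ.+-identityˡ _))
      where
      solve′ : ∀ a b → b ≡ a ℤ.+ b ℤ.- a
      solve′ = ℤ-solve-∀
    v·v≡0 : v · v ≡ 0ℤ
    v·v≡0 = trans (ΣZ.sum-cong-≗ (λ j → trans (neg² (v j)) (cong (λ z → ℤ.- 1ℤ ℤ.* (v j ℤ.* z)) (sym (w≡-v j)))))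
      (trans (sym (ΣZ.*-distribˡ-sum {n = k} (ℤ.- 1ℤ) _)) (cong (ℤ.- 1ℤ ℤ.*_) v·w≡0))
      where
      neg² : ∀ a → a ℤ.* a ≡ ℤ.- 1ℤ ℤ.* (a ℤ.* ℤ.- a)
      neg² = ℤ-solve-∀
    v≡0 = v·v≡0⇒v≡0 v v·v≡0
    0∣ : ∀ {q i} → i ≡ 0ℤ → + q ℤ∣.∣ i
    0∣ refl = ℤ∣.divides 0ℤ refl
    allp : ∀ i → + p ℤ∣.∣ c i
    allp i with Fin.splitAt l₁ i in eq
    ... | inj₁ a = subst (λ i → + p ℤ∣.∣ c i) (Finₚ.splitAt⁻¹-↑ˡ eq) (indU cU (λ j → 0∣ (v≡0 j)) a)
    ... | inj₂ b = subst (λ i → + p ℤ∣.∣ c i) (Finₚ.splitAt⁻¹-↑ʳ eq)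
                     (indA cA (λ j → 0∣ (trans (w≡-v j) (cong ℤ.-_ (v≡0 j)))) b)

-- Greedy selection

ind : {A : Set} → Dec A → ℕ
ind (yes _) = 1
ind (no _)  = 0

ind≡1 : {A : Set} (d : Dec A) → A → ind d ≡ 1
ind≡1 (yes _) a = refl
ind≡1 (no ¬a) a = contradiction a ¬a

ind≡0 : {A : Set} (d : Dec A) → ¬ A → ind d ≡ 0
ind≡0 (yes a) ¬a = contradiction a ¬a
ind≡0 (no _)  ¬a = refl

ind-mono : {A B : Set} (d : Dec A) (e : Dec B) → (A → B) → ind d ≤ ind e
ind-mono (no _)  e f = z≤n
ind-mono (yes a) e f = ℕₚ.≤-reflexive (sym (ind≡1 e (f a)))

Σℕ-mono : ∀ {n} {f g : Fin n → ℕ} → (∀ i → f i ≤ g i) → Σℕ f ≤ Σℕ g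
Σℕ-mono {zero}  f≤g = z≤n
Σℕ-mono {suc n} f≤g = ℕₚ.+-mono-≤ (f≤g zero) (Σℕ-mono (f≤g ∘ suc))

Σℕ-const : ∀ n c → Σℕ {n} (λ _ → c) ≡ n * c
Σℕ-const zero    c = refl
Σℕ-const (suc n) c = cong (ℕ._+_ c) (Σℕ-const n c)

term≤Σℕ : ∀ {n} (f : Fin n → ℕ) i → f i ≤ Σℕ f
term≤Σℕ f zero    = ℕₚ.m≤m+n _ _
term≤Σℕ f (suc i) = ℕₚ.m≤n⇒m≤o+n (f zero) (term≤Σℕ (f ∘ suc) i)

below-average : ∀ {b} (f : Fin b → ℕ) c → Σℕ f ≤ b * c → 0 < b → ∃ λ e → f e ≤ c
below-average {b} f c le 0<b with Finₚ.any? (λ e → f e ℕ.≤? c)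
... | yes found = found
... | no none = contradiction (ℕₚ.≤-trans big le)
    (ℕₚ.<⇒≱ (ℕₚ.*-monoʳ-< b {{ℕ.>-nonZero 0<b}} (ℕₚ.n<1+n c)))
  where
  big : b * suc c ≤ Σℕ f
  big = subst (_≤ Σℕ f) (Σℕ-const b (suc c)) (Σℕ-mono (λ e → ℕₚ.≰⇒> (λ le → none (e , le))))

injection-count : ∀ {k m} (f : Fin m → ℕ) (φ : Fin k → Fin m) → Injective _≡_ _≡_ φ →
  (∀ a → 1 ≤ f (φ a)) → k ≤ Σℕ f
injection-count {zero} f φ inj pos = z≤n
injection-count {suc k} {zero} f φ inj pos with φ zero
... | ()
injection-count {suc k} {suc m} f φ inj pos = subst (suc k ≤_) (sym (ΣN.sum-remove {i = φ zero} f))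
  (ℕₚ.+-mono-≤ (pos zero) (injection-count (f ∘ punchIn (φ zero)) φ′ inj′ pos′))
  where
  ≢0 : ∀ a → φ zero ≢ φ (suc a)
  ≢0 a eq with inj eq
  ... | ()
  φ′ : Fin k → Fin m
  φ′ a = punchOut (≢0 a)
  inj′ : Injective _≡_ _≡_ φ′
  inj′ {a} {b} eq = Finₚ.suc-injective (inj (Finₚ.punchOut-injective (≢0 a) (≢0 b) eq))
  pos′ : ∀ a → 1 ≤ f (punchIn (φ zero) (φ′ a))
  pos′ a = subst (λ z → 1 ≤ f z) (sym (Finₚ.punchIn-punchOut (≢0 a))) (pos (suc a))

module _ {X : Set} (_≟_ : (x y : X) → Dec (x ≡ y)) where

  mem? : ∀ x (xs : List X) → Dec (x ∈ xs)
  mem? x = Any.any? (x ≟_)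

  -- An element outside a short list exists by the pigeonhole principle; iterate, adding the elements found.
  avoid : ∀ {n} (e : Fin n → X) → Injective _≡_ _≡_ e → ∀ k (xs : List X) → k + length xs ≤ n →
    ∃ λ (f : Fin k → Fin n) → Injective _≡_ _≡_ f × (∀ i → e (f i) ∉ xs)
  avoid e inj zero xs le = (λ ()) , (λ { {()} }) , λ ()
  avoid {n} e inj (suc k) xs le with Finₚ.any? (λ i → ¬? (mem? (e i) xs))
  ... | no none = contradiction (Finₚ.injective⇒≤ {f = λ i → Any.index (all∈ i)} inj′)
                                (ℕₚ.<⇒≱ (ℕₚ.≤-trans (s≤s (ℕₚ.m≤n+m _ k)) le))
    where
    all∈ : ∀ i → e i ∈ xs
    all∈ i with mem? (e i) xs
    ... | yes p = p
    ... | no ¬p = contradiction (i , ¬p) none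
    inj′ : Injective _≡_ _≡_ (λ i → Any.index (all∈ i))
    inj′ {i} {j} eq = inj (trans (AnyP.lookup-index (all∈ i)) (trans (cong (List.lookup xs) eq) (sym (AnyP.lookup-index (all∈ j)))))
  ... | yes (i , i∉) = f , f-inj , f∉
    where
    rec = avoid e inj k (e i ∷ xs) (subst (_≤ n) (sym (ℕₚ.+-suc k _)) le)
    f : Fin (suc k) → Fin n
    f zero    = i
    f (suc j) = proj₁ rec j
    f∉ : ∀ j → e (f j) ∉ xs
    f∉ zero    = i∉
    f∉ (suc j) = proj₂ (proj₂ rec) j ∘ there
    f-inj : Injective _≡_ _≡_ f
    f-inj {zero}  {zero}  eq = refl
    f-inj {zero}  {suc j} eq = contradiction (here (cong e (sym eq))) (proj₂ (proj₂ rec) j)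
    f-inj {suc i} {zero}  eq = contradiction (here (cong e eq)) (proj₂ (proj₂ rec) i)
    f-inj {suc i} {suc j} eq = cong suc (proj₁ (proj₂ rec) eq)

  preimages : ∀ {n} → (Fin n → X) → List X → List (Fin n)
  preimages e [] = []
  preimages e (x ∷ xs) with Finₚ.any? (λ i → e i ≟ x)
  ... | yes (i , _) = i ∷ preimages e xs
  ... | no _        = preimages e xs

  length-preimages : ∀ {n} (e : Fin n → X) xs → length (preimages e xs) ≤ length xs
  length-preimages e [] = z≤n
  length-preimages e (x ∷ xs) with Finₚ.any? (λ i → e i ≟ x)
  ... | yes _ = s≤s (length-preimages e xs)
  ... | no _  = ℕₚ.m≤n⇒m≤1+n (length-preimages e xs)

  ∈-preimages : ∀ {n} (e : Fin n → X) → Injective _≡_ _≡_ e → ∀ xs {i} → e i ∈ xs → i ∈ preimages e xs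
  ∈-preimages e inj (x ∷ xs) {i} i∈ with Finₚ.any? (λ i → e i ≟ x) | i∈
  ... | yes (j , ej≡x) | here eq  = here (inj (trans eq (sym ej≡x)))
  ... | yes _          | there i∈ = there (∈-preimages e inj xs i∈)
  ... | no none        | here eq  = contradiction (i , eq) none
  ... | no _           | there i∈ = ∈-preimages e inj xs i∈

count-≟ : ∀ {b} (x : Fin b) → Σℕ (λ e → ind (e Finₚ.≟ x)) ≤ 1
count-≟ {suc b} x = ℕₚ.≤-reflexive (trans (ΣN.sum-remove {i = x} (λ e → ind (e Finₚ.≟ x)))
  (cong₂ _+_ (ind≡1 (x Finₚ.≟ x) refl)
    (trans (ΣN.sum-cong-≗ {n = b} (λ j → ind≡0 (punchIn x j Finₚ.≟ x) (Finₚ.punchInᵢ≢i x j)))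
           (ΣN.sum-replicate-zero b))))

count-∈ : ∀ {b} (xs : List (Fin b)) → Σℕ (λ e → ind (mem? Finₚ._≟_ e xs)) ≤ length xs
count-∈ {b} [] = ℕₚ.≤-reflexive (ΣN.sum-replicate-zero b)
count-∈ {b} (x ∷ xs) = ℕₚ.≤-trans (Σℕ-mono split) (ℕₚ.≤-trans
  (ℕₚ.≤-reflexive (ΣN.∑-distrib-+ {n = b} _ _)) (ℕₚ.+-mono-≤ (count-≟ x) (count-∈ xs)))
  where
  split : ∀ e → ind (mem? Finₚ._≟_ e (x ∷ xs)) ≤ ind (e Finₚ.≟ x) + ind (mem? Finₚ._≟_ e xs)
  split e with mem? Finₚ._≟_ e (x ∷ xs)
  ... | no _ = z≤n
  ... | yes (here eq)  = ℕₚ.≤-trans (ℕₚ.≤-reflexive (sym (ind≡1 (e Finₚ.≟ x) eq))) (ℕₚ.m≤m+n _ _)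
  ... | yes (there e∈) = ℕₚ.≤-trans (ℕₚ.≤-reflexive (sym (ind≡1 (mem? Finₚ._≟_ e xs) e∈))) (ℕₚ.m≤n+m _ _)

heads : ∀ {t b} → List (Fin (suc t) × Fin b) → List (Fin b)
heads [] = []
heads ((zero , e) ∷ xs)  = e ∷ heads xs
heads ((suc i , e) ∷ xs) = heads xs

tails : ∀ {t b} → List (Fin (suc t) × Fin b) → List (Fin t × Fin b)
tails [] = []
tails ((zero , e) ∷ xs)  = tails xs
tails ((suc i , e) ∷ xs) = (i , e) ∷ tails xs

length-heads-tails : ∀ {t b} (xs : List (Fin (suc t) × Fin b)) → length (heads xs) + length (tails xs) ≡ length xs
length-heads-tails [] = refl
length-heads-tails ((zero , e) ∷ xs)  = cong suc (length-heads-tails xs)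
length-heads-tails ((suc i , e) ∷ xs) = trans (ℕₚ.+-suc _ _) (cong suc (length-heads-tails xs))

∈-heads : ∀ {t b} {xs : List (Fin (suc t) × Fin b)} {e} → (zero , e) ∈ xs → e ∈ heads xs
∈-heads {xs = (zero , _) ∷ xs}  (here refl) = here refl
∈-heads {xs = (zero , _) ∷ xs}  (there e∈)  = there (∈-heads e∈)
∈-heads {xs = (suc _ , _) ∷ xs} (there e∈)  = ∈-heads e∈

∈-tails : ∀ {t b} {xs : List (Fin (suc t) × Fin b)} {i e} → (suc i , e) ∈ xs → (i , e) ∈ tails xs
∈-tails {xs = (suc _ , _) ∷ xs} (here refl) = here refl
∈-tails {xs = (suc _ , _) ∷ xs} (there e∈)  = there (∈-tails e∈)
∈-tails {xs = (zero , _) ∷ xs}  (there e∈)  = ∈-tails e∈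

_≟²_ : ∀ {t b} (x y : Fin t × Fin b) → Dec (x ≡ y)
_≟²_ = ≡-dec Finₚ._≟_ Finₚ._≟_

hits : ∀ {t b} → List (Fin t × Fin b) → (Fin t → Fin b) → ℕ
hits xs f = Σℕ (λ i → ind (mem? _≟²_ (i , f i) xs))

-- A hit lowers the number `r` of hits still missing and multiplies the weight `w` by b, which
-- leaves `w * b ^ r` fixed as long as `r` is positive.
step-r : {A : Set} → Dec A → ℕ → ℕ
step-r (yes _) r = ℕ.pred r
step-r (no _)  r = r

step-w : {A : Set} → Dec A → ℕ → ℕ → ℕ
step-w (yes _) b w = w * b
step-w (no _)  b w = w

-- Conditional expectations: length (L j) ^ r j * w j bounds (up to scaling) the number of ways to
-- complete the choice with at least r j further hits in L j, and some value at the first place does not increase the sum.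
select : ∀ {k} t b (L : Fin k → List (Fin t × Fin b)) (r w : Fin k → ℕ) B → 0 < b →
  Σℕ (λ j → length (L j) ^ r j * w j) < B → (∀ j → B ≤ w j * b ^ r j) →
  ∃ λ (f : Fin t → Fin b) → ∀ j → hits (L j) f < r j
select {k} t b L r w B 0<b pot<B inv = go t L r w pot<B inv
  where
  -- A list with `r j` equal to 0 would contribute its full weight `w j` ≥ B to the potential, even
  -- if empty, since 0 ^ 0 = 1.
  r>0 : ∀ {t} (L : Fin k → List (Fin t × Fin b)) (r w : Fin k → ℕ) →
    Σℕ (λ j → length (L j) ^ r j * w j) < B → (∀ j → B ≤ w j * b ^ r j) → ∀ j → 0 < r j
  r>0 L r w pot inv j with r j | ℕₚ.≤-<-trans (term≤Σℕ (λ j → length (L j) ^ r j * w j) j) pot | inv j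
  ... | suc _ | _ | _ = s≤s z≤n
  ... | zero | lt | le = contradiction (ℕₚ.<-≤-trans lt le)
        (ℕₚ.<⇒≱ (s≤s (ℕₚ.≤-reflexive (ℕₚ.*-comm (w j) 1))))
  go : ∀ t (L : Fin k → List (Fin t × Fin b)) (r w : Fin k → ℕ) →
    Σℕ (λ j → length (L j) ^ r j * w j) < B → (∀ j → B ≤ w j * b ^ r j) →
    ∃ λ (f : Fin t → Fin b) → ∀ j → hits (L j) f < r j
  go zero L r w pot inv = (λ ()) , r>0 L r w pot inv
  go (suc t) L r w pot inv = f , hit<
    where
    hit? : ∀ e j → Dec (e ∈ heads (L j))
    hit? e j = mem? Finₚ._≟_ e (heads (L j))
    new : Fin b → Fin k → ℕ
    new e j = length (tails (L j)) ^ step-r (hit? e j) (r j) * step-w (hit? e j) b (w j)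
    pointwise : ∀ l e j ρ → l ^ step-r (hit? e j) (suc ρ) * step-w (hit? e j) b (w j) ≤
      ind (hit? e j) * (l ^ ρ * (w j * b)) + l ^ suc ρ * w j
    pointwise l e j ρ with hit? e j
    ... | yes _ = ℕₚ.≤-trans (ℕₚ.≤-reflexive (sym (ℕₚ.*-identityˡ _))) (ℕₚ.m≤m+n _ _)
    ... | no _  = ℕₚ.≤-refl
    -- At most h of the b values hit list j, and h l^ρ + l^(ρ + 1) ≤ (h + l)^(ρ + 1), so on average
    -- over the values its term does not grow.
    average : ∀ j → Σℕ (λ e → new e j) ≤ b * (length (L j) ^ r j * w j)
    average j with r j | r>0 L r w pot inv j
    ... | suc ρ | _ = begin
      Σℕ (λ e → l ^ step-r (hit? e j) (suc ρ) * step-w (hit? e j) b (w j))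
        ≤⟨ Σℕ-mono (λ e → pointwise l e j ρ) ⟩
      Σℕ (λ e → ind (hit? e j) * (l ^ ρ * (w j * b)) + l ^ suc ρ * w j)
        ≡⟨ ΣN.∑-distrib-+ {n = b} _ _ ⟩
      Σℕ (λ e → ind (hit? e j) * (l ^ ρ * (w j * b))) + Σℕ {b} (λ _ → l ^ suc ρ * w j)
        ≡⟨ cong₂ _+_ (sym (ΣN.*-distribʳ-sum {n = b} (l ^ ρ * (w j * b)) _)) (Σℕ-const b _) ⟩
      Σℕ (λ e → ind (hit? e j)) * (l ^ ρ * (w j * b)) + b * (l ^ suc ρ * w j)
        ≤⟨ ℕₚ.+-monoˡ-≤ _ (ℕₚ.*-monoˡ-≤ _ (count-∈ (heads (L j)))) ⟩
      h * (l ^ ρ * (w j * b)) + b * (l ^ suc ρ * w j)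
        ≡⟨ rearrange h (l ^ ρ) (w j) b l ⟩
      (b * w j * (h + l)) * l ^ ρ
        ≤⟨ ℕₚ.*-monoʳ-≤ (b * w j * (h + l)) (ℕₚ.^-monoˡ-≤ ρ (ℕₚ.m≤n+m l h)) ⟩
      (b * w j * (h + l)) * (h + l) ^ ρ
        ≡⟨ rearrange′ b (w j) (h + l) ((h + l) ^ ρ) ⟩
      b * ((h + l) ^ suc ρ * w j)
        ≡⟨ cong (λ z → b * (z ^ suc ρ * w j)) (length-heads-tails (L j)) ⟩
      b * (length (L j) ^ suc ρ * w j) ∎
      where
      open ℕₚ.≤-Reasoning
      l = length (tails (L j))
      h = length (heads (L j))
      rearrange : ∀ h x w b l → h * (x * (w * b)) + b * (l * x * w) ≡ (b * w * (h + l)) * x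
      rearrange = ℕ-solve-∀
      rearrange′ : ∀ b w s y → (b * w * s) * y ≡ b * (s * y * w)
      rearrange′ = ℕ-solve-∀
    total : Σℕ (λ e → Σℕ (new e)) ≤ b * Σℕ (λ j → length (L j) ^ r j * w j)
    total = begin
      Σℕ (λ e → Σℕ (new e))             ≡⟨ ΣN.∑-comm {b} {k} new ⟩
      Σℕ (λ j → Σℕ (λ e → new e j))     ≤⟨ Σℕ-mono average ⟩
      Σℕ (λ j → b * (length (L j) ^ r j * w j)) ≡⟨ ΣN.*-distribˡ-sum {n = k} b _ ⟨
      b * Σℕ (λ j → length (L j) ^ r j * w j) ∎
      where open ℕₚ.≤-Reasoning
    best = below-average (λ e → Σℕ (new e)) _ total 0<b
    e = proj₁ best
    inv′ : ∀ j → B ≤ step-w (hit? e j) b (w j) * b ^ step-r (hit? e j) (r j)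
    inv′ j with hit? e j | r j | inv j | r>0 L r w pot inv j
    ... | no _  | _     | le | _ = le
    ... | yes _ | suc ρ | le | _ = ℕₚ.≤-trans le (ℕₚ.≤-reflexive (sym (ℕₚ.*-assoc (w j) b (b ^ ρ))))
    rec = go t (tails ∘ L) (λ j → step-r (hit? e j) (r j)) (λ j → step-w (hit? e j) b (w j))
            (ℕₚ.≤-<-trans (proj₂ best) pot) inv′
    f : Fin (suc t) → Fin b
    f zero    = e
    f (suc i) = proj₁ rec i
    hit< : ∀ j → hits (L j) f < r j
    hit< j = ℕₚ.≤-<-trans (ℕₚ.+-mono-≤
        (ind-mono (mem? _≟²_ (zero , e) (L j)) (hit? e j) ∈-heads)
        (Σℕ-mono (λ i → ind-mono (mem? _≟²_ (suc i , f (suc i)) (L j)) (mem? _≟²_ (i , f (suc i)) (tails (L j))) ∈-tails)))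
      (final (proj₂ rec j))
      where
      final : hits (tails (L j)) (proj₁ rec) < step-r (hit? e j) (r j) →
              ind (hit? e j) + hits (tails (L j)) (proj₁ rec) < r j
      final lt with hit? e j | r j | r>0 L r w pot inv j
      ... | no _  | _     | _ = lt
      ... | yes _ | suc ρ | _ = s≤s lt

module _ {X : Set} (_≟_ : (x y : X) → Dec (x ≡ y)) where

  -- The pool is cut into t blocks of b elements and one element is taken from each, which makes the
  -- choices independent and distinct. The initial potential is at most `k * K ^ R`, to be compared
  -- with `b ^ R`.
  select-avoiding : ∀ {k} t b R K (pool : Fin (t * b) → X) → Injective _≡_ _≡_ pool →
    (L : Fin k → List X) → (∀ j → length (L j) ≤ K) → k * K ^ R < b ^ R → 0 < b →
    ∃ λ (f : Fin t → Fin (t * b)) → Injective _≡_ _≡_ f ×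
      (∀ j (φ : Fin R → Fin t) → Injective _≡_ _≡_ φ → ¬ (∀ a → pool (f (φ a)) ∈ L j))
  select-avoiding {k} t b R K pool inj L short small 0<b =
    f , (λ {i} {i′} eq → proj₁ (Finₚ.combine-injective i (g i) i′ (g i′) eq)) , avoids
    where
    codes : Fin k → List (Fin t × Fin b)
    codes j = List.map (Fin.remQuot b) (preimages _≟_ pool (L j))
    codes-short : ∀ j → length (codes j) ≤ K
    codes-short j = ℕₚ.≤-trans (ℕₚ.≤-reflexive (Listₚ.length-map (Fin.remQuot b) (preimages _≟_ pool (L j))))
      (ℕₚ.≤-trans (length-preimages _≟_ pool (L j)) (short j))
    selected = select t b codes (λ _ → R) (λ _ → 1) (b ^ R) 0<b
      (ℕₚ.≤-<-trans (ℕₚ.≤-trans (Σℕ-mono {g = λ _ → K ^ R} (λ j → ℕₚ.≤-trans (ℕₚ.≤-reflexive (ℕₚ.*-identityʳ _))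
                      (ℕₚ.^-monoˡ-≤ R (codes-short j))))
        (ℕₚ.≤-reflexive (Σℕ-const k (K ^ R)))) small)
      (λ _ → ℕₚ.≤-reflexive (sym (ℕₚ.*-identityˡ _)))
    g = proj₁ selected
    f : Fin t → Fin (t * b)
    f i = Fin.combine i (g i)
    avoids : ∀ j (φ : Fin R → Fin t) → Injective _≡_ _≡_ φ → ¬ (∀ a → pool (f (φ a)) ∈ L j)
    avoids j φ φ-inj all = ℕₚ.<⇒≱ (proj₂ selected j) (injection-count _ φ φ-inj (λ a →
      ℕₚ.≤-reflexive (sym (ind≡1 (mem? _≟²_ (φ a , g (φ a)) (codes j)) (subst (_∈ codes j)
        (Finₚ.remQuot-combine (φ a) (g (φ a)))
        (∈ₚ.∈-map⁺ (Fin.remQuot b) (∈-preimages _≟_ pool inj (L j) (all a))))))))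

-- Spans modulo a prime power

InSpan : ∀ {l k} → ℕ → (Fin l → Fin k → ℤ) → (Fin k → ℤ) → Set
InSpan {l} q V v = ∃ λ (c : Fin l → ℤ) → ∀ j → + q ℤ∣.∣ v j ℤ.- lincomb c V j

∣∣-sign : ∀ c → ∃ λ s → + ∣ c ∣ ≡ s ℤ.* c
∣∣-sign (+ n)    = 1ℤ , sym (ℤₚ.*-identityˡ (+ n))
∣∣-sign -[1+ n ] = ℤ.- 1ℤ , sym (ℤₚ.-1*i≡-i -[1+ n ])

module _ (p : ℕ) (p-prime : Prime p) where

  inverse-mod-p : ∀ c → ¬ (+ p ℤ∣.∣ c) → ∃ λ a → + p ℤ∣.∣ a ℤ.* c ℤ.- 1ℤ
  inverse-mod-p c p∤c with Coprime.coprime-Bézout coprime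
    where
    coprime : Coprime.Coprime p ∣ c ∣
    coprime (d∣p , d∣c) with Prime.prime⇒irreducible p-prime d∣p
    ... | inj₁ d≡1 = d≡1
    ... | inj₂ refl = contradiction (ℤ∣.∣ᵤ⇒∣ d∣c) p∤c
  ... | GCD.Bézout.+- x y eq = ℤ.- (+ y ℤ.* s) , ℤ∣.divides (ℤ.- + x)
        (trans (cong (ℤ._- 1ℤ) (trans (neg (+ y) s c) (cong (λ z → ℤ.- (+ y ℤ.* z)) (sym abs))))
        (trans (regroup (+ y ℤ.* + ∣ c ∣)) (trans (cong ℤ.-_ (trans (cong (λ z → 1ℤ ℤ.+ z) (sym (ℤₚ.pos-* y ∣ c ∣)))
          (trans (cong +_ eq) (ℤₚ.pos-* x p)))) (ℤₚ.neg-distribˡ-* (+ x) (+ p)))))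
    where
    s = proj₁ (∣∣-sign c)
    abs = proj₂ (∣∣-sign c)
    neg : ∀ a b d → ℤ.- (a ℤ.* b) ℤ.* d ≡ ℤ.- (a ℤ.* (b ℤ.* d))
    neg = ℤ-solve-∀
    regroup : ∀ a → ℤ.- a ℤ.- 1ℤ ≡ ℤ.- (1ℤ ℤ.+ a)
    regroup = ℤ-solve-∀
  ... | GCD.Bézout.-+ x y eq = + y ℤ.* s , ℤ∣.divides (+ x)
        (trans (cong (ℤ._- 1ℤ) (trans (ℤₚ.*-assoc (+ y) s c) (trans (cong (+ y ℤ.*_) (sym abs))
          (trans (sym (ℤₚ.pos-* y ∣ c ∣)) (trans (cong +_ (sym eq)) (cong (λ z → 1ℤ ℤ.+ z) (ℤₚ.pos-* x p)))))))
        (cancel (+ x ℤ.* + p)))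
    where
    s = proj₁ (∣∣-sign c)
    abs = proj₂ (∣∣-sign c)
    cancel : ∀ a → 1ℤ ℤ.+ a ℤ.- 1ℤ ≡ a
    cancel = ℤ-solve-∀

  -- 1 − a′ c = (1 − a c)(1 − b c) for a′ = a + b − a b c.
  inverse : ∀ h c → ¬ (+ p ℤ∣.∣ c) → ∃ λ a → + (p ^ h) ℤ∣.∣ a ℤ.* c ℤ.- 1ℤ
  inverse zero    c p∤c = 0ℤ , ℤ∣.divides (0ℤ ℤ.* c ℤ.- 1ℤ) (sym (ℤₚ.*-identityʳ _))
  inverse (suc h) c p∤c with inverse-mod-p c p∤c | inverse h c p∤c
  ... | a , ℤ∣.divides z ez | b , ℤ∣.divides y ey =
    a ℤ.+ b ℤ.- a ℤ.* b ℤ.* c , ℤ∣.divides (ℤ.- (z ℤ.* y))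
      (trans (expand a b c) (trans (cong₂ (λ u v → ℤ.- (u ℤ.* v)) ez ey)
        (trans (regroup z (+ p) y (+ (p ^ h))) (cong (ℤ.- (z ℤ.* y) ℤ.*_) (sym (ℤₚ.pos-* p (p ^ h)))))))
    where
    expand : ∀ a b c → (a ℤ.+ b ℤ.- a ℤ.* b ℤ.* c) ℤ.* c ℤ.- 1ℤ ≡ ℤ.- ((a ℤ.* c ℤ.- 1ℤ) ℤ.* (b ℤ.* c ℤ.- 1ℤ))
    expand = ℤ-solve-∀
    regroup : ∀ z p y q → ℤ.- (z ℤ.* p ℤ.* (y ℤ.* q)) ≡ ℤ.- (z ℤ.* y) ℤ.* (p ℤ.* q)
    regroup = ℤ-solve-∀

  module _ (h : ℕ) (1<p : 1 < p) {R k s : ℕ} (V : Fin R → Fin k → ℤ) where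

    private
      q = p ^ h

    -- A member of a dependent family that has a coefficient prime to p lies in the span of the others: drop it.
    shrink : ∀ m (g : Fin (m + s) → Fin R) → (∀ a → InSpan q (V ∘ g) (V a)) →
      ¬ (∃ λ (g : Fin s → Fin R) → ∀ a → InSpan q (V ∘ g) (V a)) →
      ¬ (∃ λ l → ∃ λ (g : Fin l → Fin R) → s < l × Independent p 1<p q (V ∘ g)) → ⊥
    shrink zero g span ¬span ¬ind = ¬span (g , span)
    -- Whether some relation has a unit coefficient is not decided. Instead the current family is
    -- claimed to be independent, and any relation refuting this feeds the recursion.
    shrink (suc m) g span ¬span ¬ind = ¬ind (suc m + s , g , s≤s (ℕₚ.m≤n+m s m) , indep)
      where
      indep : Independent p 1<p q (V ∘ g)
      indep c dep i with + p ℤ∣.∣? c i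
      ... | yes p∣ci = p∣ci
      ... | no p∤ci = ⊥-elim (shrink m (g ∘ punchIn i) span′ ¬span ¬ind)
        where
        α = proj₁ (inverse h (c i) p∤ci)
        span′ : ∀ a → InSpan q (V ∘ g ∘ punchIn i) (V a)
        span′ a = e′ , λ j → subst (+ q ℤ∣.∣_) (sym (identity j))
          (ℤ∣.∣m∣n⇒∣m+n (proj₂ (span a) j) (ℤ∣.∣n⇒∣m*n (e i) (ℤ∣.∣m∣n⇒∣m-n (ℤ∣.∣n⇒∣m*n α (dep j))
            (ℤ∣.∣n⇒∣m*n (V (g i) j) (proj₂ (inverse h (c i) p∤ci))))))
          where
          e = proj₁ (span a)
          -- The relation `c` times the inverse `α` of `c i` expresses `V (g i)` by the other
          -- members; this is substituted into the combination `e`.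
          e′ : Fin (m + s) → ℤ
          e′ j = e (punchIn i j) ℤ.- e i ℤ.* α ℤ.* c (punchIn i j)
          identity : ∀ j → V a j ℤ.- lincomb e′ (V ∘ g ∘ punchIn i) j ≡
            (V a j ℤ.- lincomb e (V ∘ g) j) ℤ.+
              e i ℤ.* (α ℤ.* lincomb c (V ∘ g) j ℤ.- V (g i) j ℤ.* (α ℤ.* c i ℤ.- 1ℤ))
          identity j = begin
            V a j ℤ.- lincomb e′ W j ≡⟨ cong (λ z → V a j ℤ.- z) e′-eq ⟩
            V a j ℤ.- (E ℤ.+ ℤ.- (e i ℤ.* α) ℤ.* C)
              ≡⟨ regroup (V a j) (e i) α (V (g i) j) (c i) E C ⟩
            (V a j ℤ.- (e i ℤ.* V (g i) j ℤ.+ E)) ℤ.+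
              e i ℤ.* (α ℤ.* (c i ℤ.* V (g i) j ℤ.+ C) ℤ.- V (g i) j ℤ.* (α ℤ.* c i ℤ.- 1ℤ))
              ≡⟨ cong₂ (λ x y → (V a j ℤ.- x) ℤ.+ e i ℤ.* (α ℤ.* y ℤ.- V (g i) j ℤ.* (α ℤ.* c i ℤ.- 1ℤ)))
                   (ΣZ.sum-remove {i = i} (λ b → e b ℤ.* V (g b) j))
                   (ΣZ.sum-remove {i = i} (λ b → c b ℤ.* V (g b) j)) ⟨
            _ ∎
            where
            open ≡-Reasoning
            W = V ∘ g ∘ punchIn i
            E = lincomb (e ∘ punchIn i) W j
            C = lincomb (c ∘ punchIn i) W j
            e′-eq : lincomb e′ W j ≡ E ℤ.+ ℤ.- (e i ℤ.* α) ℤ.* C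
            e′-eq = trans (ΣZ.sum-cong-≗ {n = m + s} (λ b → dist (e (punchIn i b)) (e i) α (c (punchIn i b)) (W b j)))
              (trans (ΣZ.∑-distrib-+ {n = m + s} _ _)
                (cong (λ z → E ℤ.+ z) (sym (ΣZ.*-distribˡ-sum {n = m + s} (ℤ.- (e i ℤ.* α)) _))))
              where
              dist : ∀ x y a c v → (x ℤ.- y ℤ.* a ℤ.* c) ℤ.* v ≡ x ℤ.* v ℤ.+ ℤ.- (y ℤ.* a) ℤ.* (c ℤ.* v)
              dist = ℤ-solve-∀
            regroup : ∀ v e a w c E C → v ℤ.- (E ℤ.+ ℤ.- (e ℤ.* a) ℤ.* C) ≡
              (v ℤ.- (e ℤ.* w ℤ.+ E)) ℤ.+ e ℤ.* (a ℤ.* (c ℤ.* w ℤ.+ C) ℤ.- w ℤ.* (a ℤ.* c ℤ.- 1ℤ))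
            regroup = ℤ-solve-∀

-- Homogenisation: affine spans become linear ones, and the equation a · x = β becomes orthogonality
-- of (1, x) and (-β, a).
hom : ∀ {e} → (Fin e → ℤ) → Fin (suc e) → ℤ
hom x zero    = 1ℤ
hom x (suc k) = x k

self-InSpan : ∀ {R k q} (V : Fin R → Fin k → ℤ) a → InSpan q V (V a)
self-InSpan {suc R} {q = q} V a = δ , λ j → subst (+ q ℤ∣.∣_)
    (sym (trans (cong (λ z → V a j ℤ.- z) (eq j)) (ℤₚ.+-inverseʳ (V a j)))) (ℤ∣.divides 0ℤ refl)
  where
  δ : Fin (suc R) → ℤ
  δ = insert a 1ℤ (λ _ → 0ℤ)
  eq : ∀ j → lincomb δ V j ≡ V a j
  eq j = trans (ΣZ.sum-remove {i = a} (λ b → δ b ℤ.* V b j)) (trans (cong₂ ℤ._+_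
    (trans (cong (ℤ._* V a j) (insert-at a 1ℤ _)) (ℤₚ.*-identityˡ _))
    (Σℤ-zero (λ b → cong (ℤ._* V (punchIn a b) j) (insert-punchIn a 1ℤ (λ _ → 0ℤ) b)))) (ℤₚ.+-identityʳ _))

residue-unique : ∀ {q} (a b : Fin q) → + q ℤ∣.∣ + toℕ a ℤ.- + toℕ b → a ≡ b
residue-unique {q} a b q∣ = Finₚ.toℕ-injective (ℤₚ.+-injective (ℤₚ.i-j≡0⇒i≡j _ _ (ℤₚ.∣i∣≡0⇒i≡0 (lemma _ small (ℤ∣.∣⇒∣ᵤ q∣)))))
  where
  small : ∣ + toℕ a ℤ.- + toℕ b ∣ < q
  small = ℕₚ.≤-<-trans (subst (λ z → ∣ z ∣ ≤ toℕ a ℕ.⊔ toℕ b) (sym (ℤₚ.m-n≡m⊖n (toℕ a) (toℕ b)))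
      (ℤₚ.∣m⊝n∣≤m⊔n (toℕ a) (toℕ b)))
    (ℕₚ.⊔-pres-<m (Finₚ.toℕ<n a) (Finₚ.toℕ<n b))
  lemma : ∀ n → n < q → q ℕ∣.∣ n → n ≡ 0
  lemma zero    _  _  = refl
  lemma (suc n) lt q∣ = contradiction q∣ (ℕ∣.>⇒∤ lt)

module _ (q : ℕ) .{{_ : NonZero q}} where

  residue : ℤ → Fin q
  residue z = fromℕ< (ℤ.n%ℕd<d z q)

  residue-∣ : ∀ z → + q ℤ∣.∣ z ℤ.- + toℕ (residue z)
  residue-∣ z = ℤ∣.divides (z ℤ./ℕ q) (trans (cong₂ (λ x y → x ℤ.- + y) (ℤ.a≡a%ℕn+[a/ℕn]*n z q) (Finₚ.toℕ-fromℕ< _))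
    (cancel (+ (z ℤ.%ℕ q)) (z ℤ./ℕ q ℤ.* + q)))
    where
    cancel : ∀ a b → a ℤ.+ b ℤ.- a ≡ b
    cancel = ℤ-solve-∀

  residue-unique′ : ∀ z a → + q ℤ∣.∣ + toℕ a ℤ.- z → a ≡ residue z
  residue-unique′ z a q∣ = residue-unique a (residue z) (subst (+ q ℤ∣.∣_) (telescope (+ toℕ a) z _)
    (ℤ∣.∣m∣n⇒∣m+n q∣ (residue-∣ z)))
    where
    telescope : ∀ a z r → (a ℤ.- z) ℤ.+ (z ℤ.- r) ≡ a ℤ.- r
    telescope = ℤ-solve-∀

-- Evasive sets of residue vectors

coords : ∀ {q e} → Fin (q ^ e) → Fin e → ℤ
coords c k = + toℕ (Fin.finToFun c k)

finToFun-injective : ∀ {q e} (a b : Fin (q ^ e)) → (∀ k → Fin.finToFun {q} {e} a k ≡ Fin.finToFun b k) → a ≡ b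
finToFun-injective {q} {e} a b eq = trans (sym (Finₚ.funToFin-finToFin {e} {q} a))
  (trans (funToFin-cong eq) (Finₚ.funToFin-finToFin {e} {q} b))
  where
  funToFin-cong : ∀ {e q} {f g : Fin e → Fin q} → (∀ k → f k ≡ g k) → Fin.funToFin f ≡ Fin.funToFin g
  funToFin-cong {zero}  eq = refl
  funToFin-cong {suc e} eq = cong₂ Fin.combine (eq zero) (funToFin-cong (eq ∘ suc))

module _ (q e s t b R : ℕ) .{{_ : NonZero q}} where

  private
    V : ∀ {l} → (Fin l → Fin (q ^ e)) → Fin l → Fin (suc e) → ℤ
    V g i = hom (coords {q} {e} (g i))

  -- Differences to the base point leave s free coefficients for s + 1 points, so a span has at most
  -- `q ^ s` members rather than one for each of `q ^ suc s` linear combinations.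
  affine-combination : (Fin (suc s) → Fin (q ^ e)) → (Fin s → Fin q) → Fin e → ℤ
  affine-combination g c k = x₀ ℤ.+ Σℤ (λ i → + toℕ (c i) ℤ.* (coords {q} {e} (g (suc i)) k ℤ.- x₀))
    where
    x₀ = coords {q} {e} (g zero) k

  affine-point : (Fin (suc s) → Fin (q ^ e)) → (Fin s → Fin q) → Fin (q ^ e)
  affine-point g c = Fin.funToFin (λ k → residue q (affine-combination g c k))

  finToFun-affine-point : ∀ g c k → Fin.finToFun {q} {e} (affine-point g c) k ≡ residue q (affine-combination g c k)
  finToFun-affine-point g c k = Finₚ.finToFun-funToFin (λ k → residue q (affine-combination g c k)) k

  -- The coefficient sum is 1 modulo q because of the homogenising coordinate, so the coefficient of g zero is determined.
  InSpan⇒affine-point : ∀ g x → InSpan q (V g) (hom (coords {q} {e} x)) → ∃ λ c → x ≡ affine-point g c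
  InSpan⇒affine-point g x (c , span) = c′ , finToFun-injective {q} {e} x _ (λ k →
      trans (residue-unique′ q (affine-combination g c′ k) _ (subst (+ q ℤ∣.∣_) (sym (identity k)) (divisible k)))
            (sym (finToFun-affine-point g c′ k)))
    where
    c′ : Fin s → Fin q
    c′ i = residue q (c (suc i))
    x₀ = coords {q} {e} (g zero)
    y : Fin s → Fin e → ℤ
    y i = coords {q} {e} (g (suc i))
    S = Σℤ (λ i → c (suc i))
    d : Fin s → ℤ
    d i = c (suc i) ℤ.- + toℕ (c′ i)
    rest : Fin e → ℤ
    rest k = Σℤ (λ i → d i ℤ.* (y i k ℤ.- x₀ k))
    identity : ∀ k → coords {q} {e} x k ℤ.- (x₀ k ℤ.+ Σℤ (λ i → + toℕ (c′ i) ℤ.* (y i k ℤ.- x₀ k))) ≡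
      (coords {q} {e} x k ℤ.- lincomb c (V g) (suc k)) ℤ.+ (ℤ.- x₀ k ℤ.* (1ℤ ℤ.- (c zero ℤ.* 1ℤ ℤ.+ S)) ℤ.+ rest k)
    identity k = trans (regroup (coords {q} {e} x k) (x₀ k) P (c zero) S (rest k))
      (cong (λ z → (coords {q} {e} x k ℤ.- (c zero ℤ.* x₀ k ℤ.+ z)) ℤ.+ (ℤ.- x₀ k ℤ.* (1ℤ ℤ.- (c zero ℤ.* 1ℤ ℤ.+ S)) ℤ.+ rest k)) (sym split))
      where
      P = Σℤ (λ i → + toℕ (c′ i) ℤ.* (y i k ℤ.- x₀ k))
      pointwise : ∀ a y r x → a ℤ.* y ≡ a ℤ.* x ℤ.+ (r ℤ.* (y ℤ.- x) ℤ.+ (a ℤ.- r) ℤ.* (y ℤ.- x))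
      pointwise = ℤ-solve-∀
      split : Σℤ (λ i → c (suc i) ℤ.* y i k) ≡ S ℤ.* x₀ k ℤ.+ (P ℤ.+ rest k)
      split = trans (ΣZ.sum-cong-≗ {n = s} (λ i → pointwise (c (suc i)) (y i k) (+ toℕ (c′ i)) (x₀ k)))
        (trans (ΣZ.∑-distrib-+ {n = s} _ _) (cong₂ ℤ._+_ (sym (ΣZ.*-distribʳ-sum {n = s} (x₀ k) _))
          (ΣZ.∑-distrib-+ {n = s} _ _)))
      regroup : ∀ x x₀ P c S r → x ℤ.- (x₀ ℤ.+ P) ≡
        (x ℤ.- (c ℤ.* x₀ ℤ.+ (S ℤ.* x₀ ℤ.+ (P ℤ.+ r)))) ℤ.+ (ℤ.- x₀ ℤ.* (1ℤ ℤ.- (c ℤ.* 1ℤ ℤ.+ S)) ℤ.+ r)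
      regroup = ℤ-solve-∀
    divisible : ∀ k → + q ℤ∣.∣
      (coords {q} {e} x k ℤ.- lincomb c (V g) (suc k)) ℤ.+ (ℤ.- x₀ k ℤ.* (1ℤ ℤ.- (c zero ℤ.* 1ℤ ℤ.+ S)) ℤ.+ rest k)
    divisible k = ℤ∣.∣m∣n⇒∣m+n (span (suc k)) (ℤ∣.∣m∣n⇒∣m+n
      (ℤ∣.∣n⇒∣m*n (ℤ.- x₀ k) (subst (λ z → + q ℤ∣.∣ 1ℤ ℤ.- (c zero ℤ.* 1ℤ ℤ.+ z))
        (ΣZ.sum-cong-≗ {n = s} (λ i → ℤₚ.*-identityʳ (c (suc i)))) (span zero)))
      (Σℤ-∣ (λ i → ℤ∣.∣m⇒∣m*n (y i k ℤ.- x₀ k) (residue-∣ q (c (suc i))))))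

  -- The lists to be avoided must be fixed before the choice, so they are the affine spans of all (s
  -- + 1)-tuples of grid points, chosen or not: `(q ^ e) ^ suc s` lists with `q ^ s` entries each.
  evasive : (pool : Fin (t * b) → Fin (q ^ e)) → Injective _≡_ _≡_ pool → 0 < b →
    (q ^ e) ^ suc s * (q ^ s) ^ R < b ^ R →
    ∃ λ (f : Fin t → Fin (t * b)) → Injective _≡_ _≡_ f × (∀ (φ : Fin R → Fin t) → Injective _≡_ _≡_ φ →
      ¬ (∃ λ (g : Fin (suc s) → Fin R) →
          ∀ a → InSpan q (V (pool ∘ f ∘ φ ∘ g)) (hom (coords {q} {e} (pool (f (φ a)))))))
  evasive pool inj 0<b small = proj₁ sel , proj₁ (proj₂ sel) , λ φ φ-inj (g , span) →
    proj₂ (proj₂ sel) (Fin.funToFin (pool ∘ proj₁ sel ∘ φ ∘ g)) φ φ-inj (λ a → in-list (pool ∘ proj₁ sel ∘ φ ∘ g) _ (span a))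
    where
    L : Fin ((q ^ e) ^ suc s) → List (Fin (q ^ e))
    L j = List.map (λ c → affine-point (Fin.finToFun j) (Fin.finToFun {q} {s} c)) (List.allFin (q ^ s))
    in-list : ∀ g x → InSpan q (V g) (hom (coords {q} {e} x)) → x ∈ L (Fin.funToFin g)
    in-list g x span = subst (_∈ L (Fin.funToFin g)) (sym (trans (proj₂ c) (affine-point-cong
        (λ i → sym (Finₚ.finToFun-funToFin g i)) (λ i → sym (Finₚ.finToFun-funToFin (proj₁ c) i)))))
        (∈ₚ.∈-map⁺ _ (∈ₚ.∈-allFin (Fin.funToFin (proj₁ c))))
      where
      c = InSpan⇒affine-point g x span
      affine-point-cong : ∀ {g g′ c c′} → (∀ i → g i ≡ g′ i) → (∀ i → c i ≡ c′ i) → affine-point g c ≡ affine-point g′ c′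
      affine-point-cong {g} {g′} {c} {c′} g≗ c≗ = finToFun-injective {q} {e} _ _ (λ k →
        trans (finToFun-affine-point g c k) (trans (cong (residue q) (cong₂ ℤ._+_ (cong (λ z → coords {q} {e} z k) (g≗ zero))
          (ΣZ.sum-cong-≗ {n = s} (λ i → cong₂ ℤ._*_ (cong (+_ ∘ toℕ) (c≗ i))
            (cong₂ (λ u v → coords {q} {e} u k ℤ.- coords {q} {e} v k) (g≗ (suc i)) (g≗ zero))))))
          (sym (finToFun-affine-point g′ c′ k))))
    sel = select-avoiding Finₚ._≟_ t b R (q ^ s) pool inj L
      (λ j → ℕₚ.≤-reflexive (trans (Listₚ.length-map _ (List.allFin (q ^ s))) (Listₚ.length-tabulate id))) small 0<b

-- Small normals by Thue's lemma

<⇒quotient-unique : ∀ z j J .{{_ : NonZero J}} → j < J → (j + z * J) ℕ./ J ≡ z × (j + z * J) ℕ.% J ≡ j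
<⇒quotient-unique z j J j<J =
  trans (ℕ.+-distrib-/-∣ʳ j (ℕ∣.divides z refl)) (cong₂ _+_ (ℕ.m<n⇒m/n≡0 j<J) (ℕ.m*n/n≡m z J)) ,
  trans (ℕ.[m+kn]%n≡m%n j z J) (ℕ.m<n⇒m%n≡m j<J)

m<n+[m/n]*n : ∀ m n .{{_ : NonZero n}} → m < n + m ℕ./ n * n
m<n+[m/n]*n m n = subst (_< n + m ℕ./ n * n) (sym (ℕ.m≡m%n+[m/n]*n m n)) (ℕₚ.+-monoˡ-< _ (ℕ.m%n<n m n))

module _ (Q M : ℕ) .{{_ : NonZero Q}} where

  slots : (l : ℕ) .{{_ : NonZero l}} → ℕ
  slots l = 2 + (2 * M) ℕ./ l

  -- Candidates for the w with |l w − z Q| < M: the slots l integers from ⌊(z Q − M) / l⌋ on, for each z ≤ l.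
  -- The argument encodes the pair of z and the position.
  candidate : (l : ℕ) .{{_ : NonZero l}} → ℕ → Fin Q
  candidate l u = fromℕ< (ℕ.m%n<n (((u ℕ./ slots l) * Q ∸ M) ℕ./ l + u ℕ.% slots l) Q)

  -- For each z the two inequalities put w into an interval covered by `slots l` integers, and z ≤ l
  -- because M ≤ Q. As l ≤ M, the total (l + 1) (2 + 2 M / l) is at most 8 M, whatever the
  -- multiplier.
  candidate-complete : ∀ l .{{_ : NonZero l}} z (w : Fin Q) → l ≤ M → M ≤ Q →
    l * toℕ w < z * Q + M → z * Q < l * toℕ w + M → ∃ λ u → u < 8 * M × candidate l u ≡ w
  candidate-complete l z w l≤M M≤Q lw< zQ< = u , u< , eq
    where
    open ℕₚ.≤-Reasoning
    J = slots l
    K = (2 * M) ℕ./ l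
    B = (z * Q ∸ M) ℕ./ l
    j = toℕ w ∸ B
    u = j + z * J
    B≤w : B ≤ toℕ w
    B≤w = subst (B ≤_) (ℕ.m*n/n≡m (toℕ w) l) (ℕ./-monoˡ-≤ l (begin
      z * Q ∸ M              ≤⟨ ℕₚ.∸-monoˡ-≤ M (ℕₚ.<⇒≤ zQ<) ⟩
      l * toℕ w + M ∸ M      ≡⟨ ℕₚ.m+n∸n≡m (l * toℕ w) M ⟩
      l * toℕ w              ≡⟨ ℕₚ.*-comm l (toℕ w) ⟩
      toℕ w * l              ∎))
    z≤l : z ≤ l
    z≤l = ℕₚ.≤-pred (ℕₚ.*-cancelʳ-< Q z (suc l) (begin-strict
      z * Q              <⟨ zQ< ⟩
      l * toℕ w + M      ≤⟨ ℕₚ.+-mono-≤ (ℕₚ.*-monoʳ-≤ l (ℕₚ.<⇒≤ (Finₚ.toℕ<n w))) M≤Q ⟩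
      l * Q + Q          ≡⟨ ℕₚ.+-comm (l * Q) Q ⟩
      suc l * Q          ∎))
    lj< : l * j < 2 * M + l
    lj< = ℕₚ.+-cancelʳ-< (l * B) (l * j) (2 * M + l) (begin-strict
      l * j + l * B                      ≡⟨ ℕₚ.*-distribˡ-+ l j B ⟨
      l * (j + B)                        ≡⟨ cong (l *_) (ℕₚ.m∸n+n≡m B≤w) ⟩
      l * toℕ w                          <⟨ lw< ⟩
      z * Q + M                          ≤⟨ ℕₚ.+-monoˡ-≤ M (ℕₚ.m≤n+m∸n (z * Q) M) ⟩
      M + (z * Q ∸ M) + M                ≤⟨ ℕₚ.+-monoˡ-≤ M (ℕₚ.+-monoʳ-≤ M (ℕₚ.<⇒≤ (m<n+[m/n]*n (z * Q ∸ M) l))) ⟩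
      M + (l + B * l) + M                ≡⟨ regroup M l B ⟩
      2 * M + l + l * B                  ∎)
      where
      regroup : ∀ M l B → M + (l + B * l) + M ≡ 2 * M + l + l * B
      regroup = ℕ-solve-∀
    bound : ∀ i → l * i < 2 * M + l → i < J
    bound zero    _  = s≤s z≤n
    bound (suc i) lt = s≤s (s≤s (subst (_≤ K) (ℕ.m*n/n≡m i l) (ℕ./-monoˡ-≤ l (ℕₚ.<⇒≤
      (ℕₚ.+-cancelʳ-< l (i * l) (2 * M) (subst (_< 2 * M + l) (trans (ℕₚ.*-suc l i)
        (trans (ℕₚ.+-comm l (l * i)) (cong (_+ l) (ℕₚ.*-comm l i)))) lt))))))
    j<J : j < J
    j<J = bound j lj<
    u< : u < 8 * M
    u< = begin-strict
      j + z * J                          <⟨ ℕₚ.+-mono-<-≤ j<J (ℕₚ.*-monoˡ-≤ J z≤l) ⟩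
      J + l * J                          ≡⟨ regroup l K ⟩
      2 * 1 + (K + (2 * l + K * l))      ≤⟨ ℕₚ.+-mono-≤ (ℕₚ.*-monoʳ-≤ 2 (ℕₚ.≤-trans (ℕ.>-nonZero⁻¹ l) l≤M))
                                             (ℕₚ.+-mono-≤ (ℕ.m/n≤m (2 * M) l) (ℕₚ.+-mono-≤ (ℕₚ.*-monoʳ-≤ 2 l≤M) (ℕ.m/n*n≤m (2 * M) l))) ⟩
      2 * M + (2 * M + (2 * M + 2 * M))  ≡⟨ regroup′ M ⟩
      8 * M                              ∎
      where
      regroup : ∀ l K → 2 + K + l * (2 + K) ≡ 2 * 1 + (K + (2 * l + K * l))
      regroup = ℕ-solve-∀
      regroup′ : ∀ M → 2 * M + (2 * M + (2 * M + 2 * M)) ≡ 8 * M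
      regroup′ = ℕ-solve-∀
    eq : candidate l u ≡ w
    eq = Finₚ.toℕ-injective (trans (Finₚ.toℕ-fromℕ< _) (trans (cong (ℕ._% Q) (begin-equality
        ((u ℕ./ J) * Q ∸ M) ℕ./ l + u ℕ.% J
          ≡⟨ cong₂ (λ x y → (x * Q ∸ M) ℕ./ l + y) (proj₁ (<⇒quotient-unique z j J j<J)) (proj₂ (<⇒quotient-unique z j J j<J)) ⟩
        B + j    ≡⟨ ℕₚ.m+[n∸m]≡n B≤w ⟩
        toℕ w    ∎)) (ℕ.m<n⇒m%n≡m (Finₚ.toℕ<n w))))

same-quotient⇒close : ∀ a b M .{{_ : NonZero M}} → a ℕ./ M ≡ b ℕ./ M → a < b + M
same-quotient⇒close a b M eq = begin-strict
  a                  <⟨ m<n+[m/n]*n a M ⟩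
  M + a ℕ./ M * M    ≡⟨ cong (λ z → M + z * M) eq ⟩
  M + b ℕ./ M * M    ≤⟨ ℕₚ.+-monoʳ-≤ M (ℕ.m/n*n≤m b M) ⟩
  M + b              ≡⟨ ℕₚ.+-comm M b ⟩
  b + M              ∎
  where open ℕₚ.≤-Reasoning

m<n+o⇒∣m-n∣≤o : ∀ {m n o} → m < n + o → n < m + o → ∣ + m ℤ.- + n ∣ ≤ o
m<n+o⇒∣m-n∣≤o {m} {n} {o} m< n< = subst (λ z → ∣ z ∣ ≤ o) (sym (ℤₚ.m-n≡m⊖n m n)) (lemma (ℕₚ.≤-total m n))
  where
  lemma : m ≤ n ⊎ n ≤ m → ∣ m ℤ.⊖ n ∣ ≤ o
  lemma (inj₁ m≤n) = subst (_≤ o) (sym (ℤₚ.∣⊖∣-≤ m≤n)) (ℕₚ.m≤n+o⇒m∸n≤o n m (ℕₚ.<⇒≤ n<))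
  lemma (inj₂ n≤m) = subst (_≤ o) (sym (trans (ℤₚ.∣m⊖n∣≡∣n⊖m∣ m n) (ℤₚ.∣⊖∣-≤ n≤m))) (ℕₚ.m≤n+o⇒m∸n≤o m n (ℕₚ.<⇒≤ m<))

module _ (D G M p M′ : ℕ) (M≡G^D : M ≡ G ^ D) (M≡pM′ : M ≡ p * M′) (0<G : 0 < G) (0<p : 0 < p) where

  private
    Q = G * M
    0<M : 0 < M
    0<M = subst (0 <_) (sym M≡G^D) (ℕₚ.m^n>0 G {{ℕ.>-nonZero 0<G}} D)
    0<Q : 0 < Q
    0<Q = ℕₚ.*-mono-≤ 0<G 0<M
    instance
      M≢0 : NonZero M
      M≢0 = ℕ.>-nonZero 0<M
      Q≢0 : NonZero Q
      Q≢0 = ℕ.>-nonZero 0<Q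
      p≢0 : NonZero p
      p≢0 = ℕ.>-nonZero 0<p

  -- Modulo Q the multiple l w is r′ - r, of size below M; the signed residue is kept as a
  -- difference of naturals.
  Thue : (Fin D → Fin Q) → ℕ → Set
  Thue w l = ∀ k → ∃ λ z → ∃ λ r → ∃ λ r′ →
    l * toℕ (w k) + r ≡ z * Q + r′ × r < r′ + M × r′ < r + M

  -- As Q = G M, boxes of side M number G^D = M, one fewer than the multiples i w with 0 ≤ i ≤ M.
  -- Two multiples in one box differ by the wanted one.
  thue : ∀ w → ∃ λ l → 0 < l × l ≤ M × Thue w l
  thue w = l , ℕₚ.m<n⇒0<n∸m i<j , ℕₚ.≤-trans (ℕₚ.m∸n≤m (toℕ j) (toℕ i)) (ℕₚ.≤-pred (Finₚ.toℕ<n j)) , approx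
    where
    box : Fin (suc M) → Fin (G ^ D)
    box i = Fin.funToFin (λ k → fromℕ< (ℕ.m<n*o⇒m/o<n {n = G} {o = M} (ℕ.m%n<n (toℕ i * toℕ (w k)) Q)))
    collision = Finₚ.pigeonhole (s≤s (ℕₚ.≤-reflexive (sym M≡G^D))) box
    i = proj₁ collision
    j = proj₁ (proj₂ collision)
    i<j = proj₁ (proj₂ (proj₂ collision))
    l = toℕ j ∸ toℕ i
    same : ∀ k → (toℕ i * toℕ (w k) ℕ.% Q) ℕ./ M ≡ (toℕ j * toℕ (w k) ℕ.% Q) ℕ./ M
    same k = trans (sym (Finₚ.toℕ-fromℕ< _)) (trans (cong toℕ (trans (sym (Finₚ.finToFun-funToFin _ k))
      (trans (cong (λ c → Fin.finToFun {G} {D} c k) (proj₂ (proj₂ (proj₂ collision)))) (Finₚ.finToFun-funToFin _ k))))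
      (Finₚ.toℕ-fromℕ< _))
    approx : Thue w l
    approx k = qⱼ ∸ qᵢ , rᵢ , rⱼ , eq , same-quotient⇒close rᵢ rⱼ M (same k) , same-quotient⇒close rⱼ rᵢ M (sym (same k))
      where
      open ≡-Reasoning
      x = toℕ (w k)
      rᵢ = toℕ i * x ℕ.% Q
      rⱼ = toℕ j * x ℕ.% Q
      qᵢ = toℕ i * x ℕ./ Q
      qⱼ = toℕ j * x ℕ./ Q
      qᵢ≤qⱼ : qᵢ ≤ qⱼ
      qᵢ≤qⱼ = ℕ./-monoˡ-≤ Q (ℕₚ.*-monoˡ-≤ x (ℕₚ.<⇒≤ i<j))
      eq : l * x + rᵢ ≡ (qⱼ ∸ qᵢ) * Q + rⱼ
      eq = ℕₚ.+-cancelʳ-≡ (qᵢ * Q) _ _ (begin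
        l * x + rᵢ + qᵢ * Q               ≡⟨ ℕₚ.+-assoc (l * x) rᵢ _ ⟩
        l * x + (rᵢ + qᵢ * Q)             ≡⟨ cong (λ y → l * x + y) (ℕ.m≡m%n+[m/n]*n (toℕ i * x) Q) ⟨
        l * x + toℕ i * x                 ≡⟨ ℕₚ.*-distribʳ-+ x l (toℕ i) ⟨
        (l + toℕ i) * x                   ≡⟨ cong (_* x) (ℕₚ.m∸n+n≡m (ℕₚ.<⇒≤ i<j)) ⟩
        toℕ j * x                         ≡⟨ ℕ.m≡m%n+[m/n]*n (toℕ j * x) Q ⟩
        rⱼ + qⱼ * Q                       ≡⟨ cong (λ z → rⱼ + z * Q) (ℕₚ.m∸n+n≡m qᵢ≤qⱼ) ⟨
        rⱼ + (qⱼ ∸ qᵢ + qᵢ) * Q           ≡⟨ regroup rⱼ (qⱼ ∸ qᵢ) qᵢ Q ⟩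
        (qⱼ ∸ qᵢ) * Q + rⱼ + qᵢ * Q       ∎)
        where
        regroup : ∀ r a b Q → r + (a + b) * Q ≡ a * Q + r + b * Q
        regroup = ℕ-solve-∀

  -- Covers every w whose multiplier is some p (κ + 1) ≤ M = p M′: there are M′ such multipliers,
  -- and for each one 8 M candidates in every coordinate.
  bad : List (Fin (Q ^ D))
  bad = List.map bad-code (List.allFin (M′ * (8 * M) ^ D))
    module Bad where
    bad-code : Fin (M′ * (8 * M) ^ D) → Fin (Q ^ D)
    bad-code c = Fin.funToFin (λ k → candidate Q M (p * suc (toℕ (proj₁ (Fin.remQuot {M′} ((8 * M) ^ D) c))))
      {{ℕₚ.m*n≢0 p _}} (toℕ (Fin.finToFun {8 * M} {D} (proj₂ (Fin.remQuot {M′} ((8 * M) ^ D) c)) k)))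

  length-bad : length bad ≡ M′ * (8 * M) ^ D
  length-bad = trans (Listₚ.length-map Bad.bad-code (List.allFin (M′ * (8 * M) ^ D))) (Listₚ.length-tabulate id)

  multiple∈bad : ∀ c l → l ≤ M → Thue (Fin.finToFun c) l → 0 < l → p ℕ∣.∣ l → c ∈ bad
  multiple∈bad c l l≤M approx 0<l (ℕ∣.divides zero refl) = contradiction 0<l λ ()
  multiple∈bad c l l≤M approx 0<l (ℕ∣.divides (suc κ) refl) = subst (_∈ bad) (sym c≡) (∈ₚ.∈-map⁺ Bad.bad-code (∈ₚ.∈-allFin code))
    where
    instance
      l≢0 : NonZero (p * suc κ)
      l≢0 = ℕₚ.m*n≢0 p _
    w = Fin.finToFun {Q} {D} c
    l≡ : suc κ * p ≡ p * suc κ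
    l≡ = ℕₚ.*-comm (suc κ) p
    κ<M′ : κ < M′
    κ<M′ = ℕₚ.*-cancelˡ-≤ p (subst₂ _≤_ l≡ M≡pM′ l≤M)
    cand : ∀ k → ∃ λ u → u < 8 * M × candidate Q M (p * suc κ) u ≡ w k
    cand k with approx k
    ... | z , r , r′ , eq , r< , r′< = candidate-complete Q M (p * suc κ) z (w k) (subst (_≤ M) l≡ l≤M)
        (ℕₚ.m≤n*m M G {{ℕ.>-nonZero 0<G}})
        (ℕₚ.+-cancelʳ-< r _ _ (begin-strict
          p * suc κ * toℕ (w k) + r ≡⟨ cong (λ x → x * toℕ (w k) + r) l≡ ⟨
          suc κ * p * toℕ (w k) + r ≡⟨ eq ⟩
          z * Q + r′                <⟨ ℕₚ.+-monoʳ-< (z * Q) r′< ⟩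
          z * Q + (r + M)           ≡⟨ regroup (z * Q) r M ⟩
          z * Q + M + r             ∎))
        (ℕₚ.+-cancelʳ-< r′ _ _ (begin-strict
          z * Q + r′                    ≡⟨ eq ⟨
          suc κ * p * toℕ (w k) + r     ≡⟨ cong (λ x → x * toℕ (w k) + r) l≡ ⟩
          p * suc κ * toℕ (w k) + r     <⟨ ℕₚ.+-monoʳ-< (p * suc κ * toℕ (w k)) r< ⟩
          p * suc κ * toℕ (w k) + (r′ + M) ≡⟨ regroup (p * suc κ * toℕ (w k)) r′ M ⟩
          p * suc κ * toℕ (w k) + M + r′ ∎))
      where
      open ℕₚ.≤-Reasoning
      regroup : ∀ a r M → a + (r + M) ≡ a + M + r
      regroup = ℕ-solve-∀
    us : Fin ((8 * M) ^ D)
    us = Fin.funToFin (λ k → fromℕ< (proj₁ (proj₂ (cand k))))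
    code : Fin (M′ * (8 * M) ^ D)
    code = Fin.combine (fromℕ< κ<M′) us
    value : Fin M′ × Fin ((8 * M) ^ D) → Fin D → Fin Q
    value (m , u) k = candidate Q M (p * suc (toℕ m)) {{ℕₚ.m*n≢0 p _}} (toℕ (Fin.finToFun {8 * M} {D} u k))
    candidate-cong : ∀ {a b u v} → a ≡ b → u ≡ v →
      candidate Q M (p * suc a) {{ℕₚ.m*n≢0 p _}} u ≡ candidate Q M (p * suc b) {{ℕₚ.m*n≢0 p _}} v
    candidate-cong refl refl = refl
    c≡ : c ≡ Bad.bad-code code
    c≡ = finToFun-injective {Q} {D} c _ (λ k → sym (trans (Finₚ.finToFun-funToFin _ k)
      (trans (cong (λ x → value x k) (Finₚ.remQuot-combine {M′} (fromℕ< κ<M′) us))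
        (trans (candidate-cong (Finₚ.toℕ-fromℕ< κ<M′) (trans (cong toℕ (Finₚ.finToFun-funToFin _ k)) (Finₚ.toℕ-fromℕ< _)))
          (proj₂ (proj₂ (cand k)))))))

  thue-normal : ∀ c → c ∉ bad → ∃ λ (a : Fin (suc D) → ℤ) →
    ¬ (+ p ℤ∣.∣ a zero) × (∀ k → ∣ a k ∣ ≤ M) ×
    (∀ k → + Q ℤ∣.∣ a k ℤ.- a zero ℤ.* hom (coords {Q} {D} c) k)
  thue-normal c c∉bad with thue (Fin.finToFun c)
  ... | l , 0<l , l≤M , approx = a , (λ p∣ → c∉bad (multiple∈bad c l l≤M approx 0<l (ℤ∣.∣⇒∣ᵤ p∣))) , small , congruent
    where
    a : Fin (suc D) → ℤ
    a zero    = + l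
    a (suc k) with approx k
    ... | z , r , r′ , _ = + r′ ℤ.- + r
    small : ∀ k → ∣ a k ∣ ≤ M
    small zero    = l≤M
    small (suc k) with approx k
    ... | z , r , r′ , eq , r< , r′< = m<n+o⇒∣m-n∣≤o r′< r<
    congruent : ∀ k → + Q ℤ∣.∣ a k ℤ.- a zero ℤ.* hom (coords {Q} {D} c) k
    congruent zero = ℤ∣.divides 0ℤ (cancel (+ l))
      where
      cancel : ∀ a → a ℤ.- a ℤ.* 1ℤ ≡ 0ℤ
      cancel = ℤ-solve-∀
    congruent (suc k) with approx k
    ... | z , r , r′ , eq , r< , r′< = ℤ∣.divides (ℤ.- + z) (begin
        + r′ ℤ.- + r ℤ.- + l ℤ.* + x
          ≡⟨ regroup (+ r′) (+ r) (+ l ℤ.* + x) (+ z ℤ.* + Q) ⟩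
        (+ z ℤ.* + Q ℤ.+ + r′) ℤ.- (+ l ℤ.* + x ℤ.+ + r) ℤ.- + z ℤ.* + Q
          ≡⟨ cong₂ (λ u v → u ℤ.- v ℤ.- + z ℤ.* + Q) (cong (ℤ._+ + r′) (sym (ℤₚ.pos-* z Q))) (cong (ℤ._+ + r) (sym (ℤₚ.pos-* l x))) ⟩
        + (z * Q + r′) ℤ.- + (l * x + r) ℤ.- + z ℤ.* + Q
          ≡⟨ cong (λ u → + (z * Q + r′) ℤ.- + u ℤ.- + z ℤ.* + Q) eq ⟩
        + (z * Q + r′) ℤ.- + (z * Q + r′) ℤ.- + z ℤ.* + Q
          ≡⟨ cancel (+ (z * Q + r′)) (+ z) (+ Q) ⟩
        ℤ.- + z ℤ.* + Q ∎)
      where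
      open ≡-Reasoning
      x = toℕ (Fin.finToFun {Q} {D} c k)
      regroup : ∀ a b c d → a ℤ.- b ℤ.- c ≡ (d ℤ.+ a) ℤ.- (c ℤ.+ b) ℤ.- d
      regroup = ℤ-solve-∀
      cancel : ∀ a b c → a ℤ.- a ℤ.- b ℤ.* c ≡ ℤ.- b ℤ.* c
      cancel = ℤ-solve-∀

-- Integer configurations without K_{R,R}

^-distrib-* : ∀ k m n → (m * n) ^ k ≡ m ^ k * n ^ k
^-distrib-* zero    m n = refl
^-distrib-* (suc k) m n = trans (cong (m * n *_) (^-distrib-* k m n)) (swap m n (m ^ k) (n ^ k))
  where
  swap : ∀ m n x y → m * n * (x * y) ≡ m * x * (n * y)
  swap = ℕ-solve-∀

-- `normal-distinct` means that no two normals are proportional. `K-free` admits arbitrary offsets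
-- `β`, so that any translates may be used afterwards.
record Configuration (D t₁ t₂ N M R : ℕ) : Set where
  field
    point          : Fin t₁ → Fin (suc D) → ℤ
    point-small    : ∀ i k → ∣ point i k ∣ ≤ N
    point-distinct : ∀ i j → (∀ k → point i k ≡ point j k) → i ≡ j
    normal          : Fin t₂ → Fin (suc D) → ℤ
    normal-small    : ∀ i k → ∣ normal i k ∣ ≤ M
    normal-nonzero  : ∀ i → normal i zero ≢ 0ℤ
    normal-distinct : ∀ i j → (∀ k → normal i k ℤ.* normal j zero ≡ normal j k ℤ.* normal i zero) → i ≡ j
    K-free : ∀ (φ : Fin R → Fin t₁) (ψ : Fin R → Fin t₂) (β : Fin R → ℤ) →
      Injective _≡_ _≡_ φ → Injective _≡_ _≡_ ψ → ¬ (∀ i j → normal (ψ j) · point (φ i) ≡ β j)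

module _ (p : ℕ) (p-prime : Prime p) where

  1<p : 1 < p
  1<p = ℕ.nonTrivial⇒n>1 p {{Prime.prime⇒nonTrivial p-prime}}

  euclid-ℤ : ∀ i j → + p ℤ∣.∣ i ℤ.* j → (+ p ℤ∣.∣ i) ⊎ (+ p ℤ∣.∣ j)
  euclid-ℤ i j p∣ij with Prime.euclidsLemma ∣ i ∣ ∣ j ∣ p-prime (subst (p ℕ∣.∣_) (ℤₚ.∣i*j∣≡∣i∣*∣j∣ i j) (ℤ∣.∣⇒∣ᵤ p∣ij))
  ... | inj₁ p∣i = inj₁ (ℤ∣.∣ᵤ⇒∣ p∣i)
  ... | inj₂ p∣j = inj₂ (ℤ∣.∣ᵤ⇒∣ p∣j)

  unit-cancel : ∀ h c v → ¬ (+ p ℤ∣.∣ c) → + (p ^ h) ℤ∣.∣ c ℤ.* v → + (p ^ h) ℤ∣.∣ v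
  unit-cancel h c v p∤c q∣cv with inverse p p-prime h c p∤c
  ... | a , q∣ = subst (+ (p ^ h) ℤ∣.∣_) (identity a c v) (ℤ∣.∣m∣n⇒∣m-n (ℤ∣.∣n⇒∣m*n a q∣cv) (ℤ∣.∣n⇒∣m*n v q∣))
    where
    identity : ∀ a c v → a ℤ.* (c ℤ.* v) ℤ.- v ℤ.* (a ℤ.* c ℤ.- 1ℤ) ≡ v
    identity = ℤ-solve-∀

  -- The exchange starts with the whole family of R = (R - s) + s vectors, which spans itself.
  not-evasive : ∀ h {R k} s (V : Fin R → Fin k → ℤ) → s ≤ R →
    ¬ (∃ λ (g : Fin s → Fin R) → ∀ a → InSpan (p ^ h) (V ∘ g) (V a)) →
    ¬ (∃ λ l → ∃ λ (g : Fin l → Fin R) → s < l × Independent p 1<p (p ^ h) (V ∘ g)) → ⊥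
  not-evasive h {R} s V s≤R = shrink p p-prime h 1<p V (R ∸ s) (Fin.cast eq) (λ a →
      subst (InSpan (p ^ h) (V ∘ Fin.cast eq) ∘ V) (Finₚ.cast-involutive eq (sym eq) a)
        (self-InSpan (V ∘ Fin.cast eq) (Fin.cast (sym eq) a)))
    where
    eq : R ∸ s + s ≡ R
    eq = ℕₚ.m∸n+n≡m s≤R

  module _ (D N hN : ℕ) (N≡ : N ≡ p ^ hN) (Q hQ : ℕ) (Q≡ : Q ≡ p ^ hQ) {t₁ t₂ : ℕ} (x : Fin t₁ → Fin (suc D) → ℤ)
           (w : Fin t₂ → Fin D → ℤ) (a : Fin t₂ → Fin (suc D) → ℤ) (p∤a₀ : ∀ i → ¬ (+ p ℤ∣.∣ a i zero))
           (a≡a₀w : ∀ i k → + Q ℤ∣.∣ a i k ℤ.- a i zero ℤ.* hom (w i) k) where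

    -- Modulo Q the normals are `a i zero` times (1, w i) and `a j zero` times (1, w j).
    -- Cross-multiplication leaves the product of these two units times w i - w j.
    proportional⇒congruent : ∀ i j → (∀ k → a i k ℤ.* a j zero ≡ a j k ℤ.* a i zero) → ∀ k → + Q ℤ∣.∣ w i k ℤ.- w j k
    proportional⇒congruent i j proportional k = subst (λ q → + q ℤ∣.∣ w i k ℤ.- w j k) (sym Q≡)
      (unit-cancel hQ (a i zero ℤ.* a j zero) _ p∤ (subst (λ q → + q ℤ∣.∣ a i zero ℤ.* a j zero ℤ.* (w i k ℤ.- w j k)) Q≡
        (subst (+ Q ℤ∣.∣_) identity (ℤ∣.∣m∣n⇒∣m-n (ℤ∣.∣n⇒∣m*n (a i zero) (a≡a₀w j (suc k)))
                                                  (ℤ∣.∣n⇒∣m*n (a j zero) (a≡a₀w i (suc k)))))))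
      where
      p∤ : ¬ (+ p ℤ∣.∣ a i zero ℤ.* a j zero)
      p∤ p∣ with euclid-ℤ (a i zero) (a j zero) p∣
      ... | inj₁ p∣ᵢ = p∤a₀ i p∣ᵢ
      ... | inj₂ p∣ⱼ = p∤a₀ j p∣ⱼ
      identity : a i zero ℤ.* (a j (suc k) ℤ.- a j zero ℤ.* w j k) ℤ.- a j zero ℤ.* (a i (suc k) ℤ.- a i zero ℤ.* w i k)
        ≡ a i zero ℤ.* a j zero ℤ.* (w i k ℤ.- w j k)
      identity = trans (regroup (a i zero) (a j (suc k)) (a j zero) (w j k) (a i (suc k)) (w i k))
        (trans (cong (λ z → z ℤ.- a i (suc k) ℤ.* a j zero ℤ.+ a i zero ℤ.* a j zero ℤ.* (w i k ℤ.- w j k)) (sym (proportional (suc k))))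
          (cancel (a i (suc k) ℤ.* a j zero) _))
        where
        regroup : ∀ aᵢ bⱼ aⱼ wⱼ bᵢ wᵢ → aᵢ ℤ.* (bⱼ ℤ.- aⱼ ℤ.* wⱼ) ℤ.- aⱼ ℤ.* (bᵢ ℤ.- aᵢ ℤ.* wᵢ) ≡
          bⱼ ℤ.* aᵢ ℤ.- bᵢ ℤ.* aⱼ ℤ.+ aᵢ ℤ.* aⱼ ℤ.* (wᵢ ℤ.- wⱼ)
        regroup = ℤ-solve-∀
        cancel : ∀ x y → x ℤ.- x ℤ.+ y ≡ y
        cancel = ℤ-solve-∀

    -- Scaling by the units a i zero turns independence of the (1 , w i) into independence of the normals.
    hyperplane-independent : ∀ {l} (ρ : Fin l → Fin t₂) (β : Fin l → ℤ) → Independent p 1<p Q (hom ∘ w ∘ ρ) →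
      Independent p 1<p Q (λ j → λ { zero → ℤ.- β j ; (suc k) → a (ρ j) k })
    hyperplane-independent {l} ρ β indep c dep j =
      [ id , ⊥-elim ∘ p∤a₀ (ρ j) ]′ (euclid-ℤ (c j) (a (ρ j) zero) (indep (λ j → c j ℤ.* a (ρ j) zero) dep′ j))
      where
      dep′ : ∀ k → + Q ℤ∣.∣ lincomb (λ j → c j ℤ.* a (ρ j) zero) (hom ∘ w ∘ ρ) k
      dep′ k = ℤ∣.∣m+n∣m⇒∣n (subst (+ Q ℤ∣.∣_) split (dep (suc k)))
                             (Σℤ-∣ (λ j → ℤ∣.∣n⇒∣m*n (c j) (a≡a₀w (ρ j) k)))
        where
        pointwise : ∀ c a a₀ w → c ℤ.* a ≡ c ℤ.* (a ℤ.- a₀ ℤ.* w) ℤ.+ c ℤ.* a₀ ℤ.* w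
        pointwise = ℤ-solve-∀
        split : Σℤ (λ j → c j ℤ.* a (ρ j) k) ≡ Σℤ (λ j → c j ℤ.* (a (ρ j) k ℤ.- a (ρ j) zero ℤ.* hom (w (ρ j)) k))
                  ℤ.+ lincomb (λ j → c j ℤ.* a (ρ j) zero) (hom ∘ w ∘ ρ) k
        split = trans (ΣZ.sum-cong-≗ {n = l} (λ j → pointwise (c j) (a (ρ j) k) (a (ρ j) zero) (hom (w (ρ j)) k)))
                      (ΣZ.∑-distrib-+ {n = l} _ _)

    evasive⇒K-free : ∀ s₁ s₂ R → s₁ + s₂ ≡ suc D → s₁ ≤ R → s₂ ≤ R →
      (∀ (φ : Fin R → Fin t₁) → Injective _≡_ _≡_ φ →
        ¬ (∃ λ (g : Fin s₁ → Fin R) → ∀ a → InSpan N (hom ∘ x ∘ φ ∘ g) (hom (x (φ a))))) →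
      (∀ (φ : Fin R → Fin t₂) → Injective _≡_ _≡_ φ →
        ¬ (∃ λ (g : Fin s₂ → Fin R) → ∀ a → InSpan Q (hom ∘ w ∘ φ ∘ g) (hom (w (φ a))))) →
      ∀ (φ : Fin R → Fin t₁) (ψ : Fin R → Fin t₂) (β : Fin R → ℤ) →
      Injective _≡_ _≡_ φ → Injective _≡_ _≡_ ψ → ¬ (∀ i j → a (ψ j) · x (φ i) ≡ β j)
    evasive⇒K-free s₁ s₂ R s₁+s₂ s₁≤R s₂≤R x-evasive w-evasive φ ψ β φ-inj ψ-inj incident =
      not-evasive hN s₁ (hom ∘ x ∘ φ) s₁≤R
        (subst (λ q → ¬ (∃ λ (g : Fin s₁ → Fin R) → ∀ a → InSpan q (hom ∘ x ∘ φ ∘ g) (hom (x (φ a))))) N≡ (x-evasive φ φ-inj))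
      λ { (l₁ , g₁ , s₁<l₁ , indep₁) →
      not-evasive hQ s₂ (hom ∘ w ∘ ψ) s₂≤R
        (subst (λ q → ¬ (∃ λ (g : Fin s₂ → Fin R) → ∀ a → InSpan q (hom ∘ w ∘ ψ ∘ g) (hom (w (ψ a))))) Q≡ (w-evasive ψ ψ-inj))
      λ { (l₂ , g₂ , s₂<l₂ , indep₂) →
      orthogonal-independent p 1<p (hom ∘ x ∘ φ ∘ g₁) _ indep₁
        (hyperplane-independent (ψ ∘ g₂) (β ∘ g₂) (subst (λ q → Independent p 1<p q (hom ∘ w ∘ ψ ∘ g₂)) (sym Q≡) indep₂))
        (λ i j → trans (cong₂ ℤ._+_ (ℤₚ.*-identityˡ (ℤ.- β (g₂ j)))
                   (trans (·-comm (x (φ (g₁ i))) (a (ψ (g₂ j)))) (incident (g₁ i) (g₂ j)))) (ℤₚ.+-inverseˡ (β (g₂ j))))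
        -- There are at least (s₁ + 1) + (s₂ + 1) = D + 3 vectors, in dimension D + 2.
        (ℕₚ.≤-trans (ℕₚ.≤-reflexive (cong suc (trans (cong suc (sym s₁+s₂)) (sym (ℕₚ.+-suc s₁ s₂)))))
                     (ℕₚ.+-mono-≤ s₁<l₁ s₂<l₂)) } }

  module _ (D s₁ s₂ R : ℕ) (s₁+s₂ : suc s₁ + suc s₂ ≡ suc D) (s₁<R : s₁ < R) (s₂<R : s₂ < R)
           (N hN : ℕ) (N≡ : N ≡ p ^ hN) (t₁ b₁ : ℕ) (fits₁ : t₁ * b₁ ≤ N ^ suc D) (0<b₁ : 0 < b₁)
           (small₁ : (N ^ suc D) ^ suc s₁ * (N ^ s₁) ^ R < b₁ ^ R)
           (G M M′ hQ : ℕ) (M≡G^D : M ≡ G ^ D) (M≡pM′ : M ≡ p * M′) (0<G : 0 < G) (Q≡ : G * M ≡ p ^ hQ)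
           (8^D<p : 8 ^ D < p) (t₂ b₂ : ℕ) (fits₂ : t₂ * b₂ ≤ M′ * M ^ D) (0<b₂ : 0 < b₂)
           (small₂ : ((G * M) ^ D) ^ suc s₂ * ((G * M) ^ s₂) ^ R < b₂ ^ R) where

    private
      Q = G * M
      0<p = ℕₚ.<-trans (s≤s z≤n) 1<p
      instance
        p≢0 : NonZero p
        p≢0 = ℕ.>-nonZero 0<p
        N≢0 : NonZero N
        N≢0 = subst NonZero (sym N≡) (ℕₚ.m^n≢0 p hN)
        Q≢0 : NonZero (G * M)
        Q≢0 = subst NonZero (sym Q≡) (ℕₚ.m^n≢0 p hQ)

      pool₁ : Fin (t₁ * b₁) → Fin (N ^ suc D)
      pool₁ i = Fin.inject≤ i fits₁

      selected₁ = evasive N (suc D) s₁ t₁ b₁ R pool₁ (λ eq → Finₚ.inject≤-injective fits₁ fits₁ _ _ eq) 0<b₁ small₁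
      x-code : Fin t₁ → Fin (N ^ suc D)
      x-code = pool₁ ∘ proj₁ selected₁
      x : Fin t₁ → Fin (suc D) → ℤ
      x i = coords {N} {suc D} (x-code i)

      bads = bad D G M p M′ M≡G^D M≡pM′ 0<G 0<p

      -- The pool of normals and the bad directions need (1 + 8^D) M′ M^D places, while Q^D = G^D
      -- M^D = p M′ M^D.
      room : t₂ * b₂ + length bads ≤ Q ^ D
      room = begin
        t₂ * b₂ + length bads              ≡⟨ cong (λ z → t₂ * b₂ + z) (length-bad D G M p M′ M≡G^D M≡pM′ 0<G 0<p) ⟩
        t₂ * b₂ + M′ * (8 * M) ^ D         ≤⟨ ℕₚ.+-monoˡ-≤ _ fits₂ ⟩
        M′ * M ^ D + M′ * (8 * M) ^ D      ≡⟨ cong (λ z → M′ * M ^ D + M′ * z) (^-distrib-* D 8 M) ⟩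
        M′ * M ^ D + M′ * (8 ^ D * M ^ D)  ≡⟨ regroup M′ (M ^ D) (8 ^ D) ⟩
        suc (8 ^ D) * M′ * M ^ D           ≤⟨ ℕₚ.*-monoˡ-≤ (M ^ D) (ℕₚ.*-monoˡ-≤ M′ 8^D<p) ⟩
        p * M′ * M ^ D                     ≡⟨ cong (_* M ^ D) (trans (sym M≡pM′) M≡G^D) ⟩
        G ^ D * M ^ D                      ≡⟨ ^-distrib-* D G M ⟨
        Q ^ D                              ∎
        where
        open ℕₚ.≤-Reasoning
        regroup : ∀ a b c → a * b + a * (c * b) ≡ suc c * a * b
        regroup = ℕ-solve-∀

      good = avoid Finₚ._≟_ {n = Q ^ D} id id (t₂ * b₂) bads room
      pool₂ : Fin (t₂ * b₂) → Fin (Q ^ D)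
      pool₂ = proj₁ good

      selected₂ = evasive Q D s₂ t₂ b₂ R pool₂ (proj₁ (proj₂ good)) 0<b₂ small₂
      w-code : Fin t₂ → Fin (Q ^ D)
      w-code = pool₂ ∘ proj₁ selected₂
      w : Fin t₂ → Fin D → ℤ
      w i = coords {Q} {D} (w-code i)

      lifted : ∀ i → ∃ λ (a : Fin (suc D) → ℤ) → ¬ (+ p ℤ∣.∣ a zero) × (∀ k → ∣ a k ∣ ≤ M) ×
        (∀ k → + Q ℤ∣.∣ a k ℤ.- a zero ℤ.* hom (w i) k)
      lifted i = thue-normal D G M p M′ M≡G^D M≡pM′ 0<G 0<p (w-code i) (proj₂ (proj₂ good) (proj₁ selected₂ i))

    configuration : Configuration D t₁ t₂ N M R
    configuration = record
      { point           = x
      ; point-small     = λ i k → ℕₚ.<⇒≤ (Finₚ.toℕ<n (Fin.finToFun {N} {suc D} (x-code i) k))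
      ; point-distinct  = λ i j eq → proj₁ (proj₂ selected₁) (Finₚ.inject≤-injective fits₁ fits₁ _ _
                            (finToFun-injective {N} {suc D} _ _ (λ k → Finₚ.toℕ-injective (ℤₚ.+-injective (eq k)))))
      ; normal          = a
      ; normal-small    = λ i → proj₁ (proj₂ (proj₂ (lifted i)))
      ; normal-nonzero  = λ i eq → p∤a₀ i (subst (+ p ℤ∣.∣_) (sym eq) (ℤ∣.divides 0ℤ refl))
      ; normal-distinct = λ i j eq → proj₁ (proj₂ selected₂) (proj₁ (proj₂ good) (finToFun-injective {Q} {D} _ _ (λ k →
                            residue-unique _ _ (proportional⇒congruent D N hN N≡ Q hQ Q≡ x w a p∤a₀ a≡a₀w i j eq k))))
      ; K-free          = evasive⇒K-free D N hN N≡ Q hQ Q≡ x w a p∤a₀ a≡a₀w (suc s₁) (suc s₂) R s₁+s₂ s₁<R s₂<R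
                            (proj₂ (proj₂ selected₁)) (proj₂ (proj₂ selected₂))
      }
      where
      a : Fin t₂ → Fin (suc D) → ℤ
      a i = proj₁ (lifted i)
      p∤a₀ : ∀ i → ¬ (+ p ℤ∣.∣ a i zero)
      p∤a₀ i = proj₁ (proj₂ (lifted i))
      a≡a₀w : ∀ i k → + Q ℤ∣.∣ a i k ℤ.- a i zero ℤ.* hom (w i) k
      a≡a₀w i = proj₂ (proj₂ (proj₂ (lifted i)))

-- Realisation over the reals

module Realisation (ℝ : CompleteOrderedField) where
  open CompleteOrderedField ℝ using (Carrier; _≈_; 0#; 1#; 0≉1; _≟_; commutativeRing)
    renaming (_+_ to _⊕_; _*_ to _⊗_; -_ to ⊖_; _≤_ to infix 4 _≼_)
  private
    module ℝ = CompleteOrderedField ℝ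
    module ≼ = IsTotalOrder ℝ.isTotalOrder
    module ΣR = SemiringSum ℝ.semiring
    module Mult = SemiringMult ℝ.semiring
    module RP = RingProperties ℝ.ring
  open ΣR using () renaming (sum to Σᴿ)
  open SetoidReasoning ℝ.setoid

  fromℕ : ℕ → Carrier
  fromℕ n = n Mult.× 1#

  fromℤ : ℤ → Carrier
  fromℤ (+ n)    = fromℕ n
  fromℤ -[1+ n ] = ⊖ fromℕ (suc n)

  ⊖-nonneg : ∀ {x} → x ≼ 0# → 0# ≼ ⊖ x
  ⊖-nonneg {x} x≼0 = ≼.≲-respʳ-≈ (ℝ.+-identityˡ _) (≼.≲-respˡ-≈ (ℝ.-‿inverseʳ x) (ℝ.+-monoˡ-≤ (⊖ x) x≼0))

  0≼1 : 0# ≼ 1#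
  0≼1 with ≼.total 0# 1#
  ... | inj₁ 0≼1 = 0≼1
  ... | inj₂ 1≼0 = ≼.≲-respʳ-≈ (ℝ.trans (ℝ.sym (RP.-‿distribʳ-* (⊖ 1#) 1#))
      (ℝ.trans (ℝ.-‿cong (ℝ.*-identityʳ (⊖ 1#))) (RP.-‿involutive 1#)))
    (ℝ.*-nonneg (⊖-nonneg 1≼0) (⊖-nonneg 1≼0))

  ⊕-mono : ∀ {x y} → 0# ≼ y → x ≼ x ⊕ y
  ⊕-mono {x} {y} 0≼y = ≼.≲-respˡ-≈ (ℝ.+-identityˡ x) (≼.≲-respʳ-≈ (ℝ.+-comm y x) (ℝ.+-monoˡ-≤ x 0≼y))

  fromℕ-nonneg : ∀ n → 0# ≼ fromℕ n
  fromℕ-nonneg zero    = ≼.refl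
  fromℕ-nonneg (suc n) = ≼.trans (fromℕ-nonneg n) (≼.≲-respʳ-≈ (ℝ.+-comm _ _) (⊕-mono 0≼1))

  fromℕ-suc≉0 : ∀ n → ¬ fromℕ (suc n) ≈ 0#
  fromℕ-suc≉0 n eq = 0≉1 (≼.antisym 0≼1 (≼.≲-respʳ-≈ eq (⊕-mono (fromℕ-nonneg n))))

  fromℤ≈0⇒≡0 : ∀ i → fromℤ i ≈ 0# → i ≡ 0ℤ
  fromℤ≈0⇒≡0 (+ zero)  eq = refl
  fromℤ≈0⇒≡0 (+ suc n) eq = contradiction eq (fromℕ-suc≉0 n)
  fromℤ≈0⇒≡0 -[1+ n ]  eq = contradiction (ℝ.trans (ℝ.sym (RP.-‿involutive _)) (ℝ.trans (ℝ.-‿cong eq) RP.-0#≈0#)) (fromℕ-suc≉0 n)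

  fromℤ-neg : ∀ i → fromℤ (ℤ.- i) ≈ ⊖ fromℤ i
  fromℤ-neg (+ zero)  = ℝ.sym RP.-0#≈0#
  fromℤ-neg (+ suc n) = ℝ.refl
  fromℤ-neg -[1+ n ]  = ℝ.sym (RP.-‿involutive _)

  fromℤ-⊖ : ∀ m n → fromℤ (m ℤ.⊖ n) ≈ fromℕ m ⊕ ⊖ fromℕ n
  fromℤ-⊖ m       zero    = ℝ.sym (ℝ.trans (ℝ.+-congˡ RP.-0#≈0#) (ℝ.+-identityʳ _))
  fromℤ-⊖ zero    (suc n) = ℝ.sym (ℝ.+-identityˡ _)
  fromℤ-⊖ (suc m) (suc n) = begin
    fromℤ (suc m ℤ.⊖ suc n)                  ≡⟨ cong fromℤ (ℤₚ.[1+m]⊖[1+n]≡m⊖n m n) ⟩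
    fromℤ (m ℤ.⊖ n)                          ≈⟨ fromℤ-⊖ m n ⟩
    fromℕ m ⊕ ⊖ fromℕ n                      ≈⟨ ℝ.+-congˡ (ℝ.+-identityˡ _) ⟨
    fromℕ m ⊕ (0# ⊕ ⊖ fromℕ n)               ≈⟨ ℝ.+-congˡ (ℝ.+-congʳ (ℝ.-‿inverseʳ 1#)) ⟨
    fromℕ m ⊕ (1# ⊕ ⊖ 1# ⊕ ⊖ fromℕ n)        ≈⟨ ℝ.+-congˡ (ℝ.+-assoc _ _ _) ⟩
    fromℕ m ⊕ (1# ⊕ (⊖ 1# ⊕ ⊖ fromℕ n))      ≈⟨ ℝ.+-assoc _ _ _ ⟨
    fromℕ m ⊕ 1# ⊕ (⊖ 1# ⊕ ⊖ fromℕ n)        ≈⟨ ℝ.+-cong (ℝ.+-comm _ _) (RP.-‿+-comm _ _) ⟩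
    1# ⊕ fromℕ m ⊕ ⊖ (1# ⊕ fromℕ n)          ∎

  fromℤ-+ : ∀ i j → fromℤ (i ℤ.+ j) ≈ fromℤ i ⊕ fromℤ j
  fromℤ-+ (+ m)    (+ n)    = Mult.×-homo-+ 1# m n
  fromℤ-+ (+ m)    -[1+ n ] = fromℤ-⊖ m (suc n)
  fromℤ-+ -[1+ m ] (+ n)    = ℝ.trans (fromℤ-⊖ n (suc m)) (ℝ.+-comm _ _)
  fromℤ-+ -[1+ m ] -[1+ n ] = begin
    ⊖ fromℕ (suc (suc (m + n)))            ≡⟨ cong (λ k → ⊖ fromℕ (suc k)) (sym (ℕₚ.+-suc m n)) ⟩
    ⊖ fromℕ (suc m + suc n)                ≈⟨ ℝ.-‿cong (Mult.×-homo-+ 1# (suc m) (suc n)) ⟩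
    ⊖ (fromℕ (suc m) ⊕ fromℕ (suc n))      ≈⟨ RP.-‿+-comm _ _ ⟨
    ⊖ fromℕ (suc m) ⊕ ⊖ fromℕ (suc n)      ∎

  fromℤ-*⁺ : ∀ m j → fromℤ (+ m ℤ.* j) ≈ fromℕ m ⊗ fromℤ j
  fromℤ-*⁺ zero    j = ℝ.trans (ℝ.reflexive (cong fromℤ (ℤₚ.*-zeroˡ j))) (ℝ.sym (ℝ.zeroˡ _))
  fromℤ-*⁺ (suc m) j = begin
    fromℤ (+ suc m ℤ.* j)             ≡⟨ cong fromℤ (ℤₚ.suc-* (+ m) j) ⟩
    fromℤ (j ℤ.+ + m ℤ.* j)           ≈⟨ fromℤ-+ j (+ m ℤ.* j) ⟩
    fromℤ j ⊕ fromℤ (+ m ℤ.* j)       ≈⟨ ℝ.+-cong (ℝ.sym (ℝ.*-identityˡ _)) (fromℤ-*⁺ m j) ⟩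
    1# ⊗ fromℤ j ⊕ fromℕ m ⊗ fromℤ j  ≈⟨ ℝ.distribʳ _ _ _ ⟨
    (1# ⊕ fromℕ m) ⊗ fromℤ j          ∎

  fromℤ-* : ∀ i j → fromℤ (i ℤ.* j) ≈ fromℤ i ⊗ fromℤ j
  fromℤ-* (+ m)    j = fromℤ-*⁺ m j
  fromℤ-* -[1+ m ] j = begin
    fromℤ (-[1+ m ] ℤ.* j)       ≡⟨ cong fromℤ (sym (ℤₚ.neg-distribˡ-* (+ suc m) j)) ⟩
    fromℤ (ℤ.- (+ suc m ℤ.* j))  ≈⟨ fromℤ-neg (+ suc m ℤ.* j) ⟩
    ⊖ fromℤ (+ suc m ℤ.* j)      ≈⟨ ℝ.-‿cong (fromℤ-*⁺ (suc m) j) ⟩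
    ⊖ (fromℕ (suc m) ⊗ fromℤ j)  ≈⟨ RP.-‿distribˡ-* _ _ ⟩
    ⊖ fromℕ (suc m) ⊗ fromℤ j    ∎

  fromℤ-injective : ∀ i j → fromℤ i ≈ fromℤ j → i ≡ j
  fromℤ-injective i j eq = ℤₚ.i-j≡0⇒i≡j i j (fromℤ≈0⇒≡0 (i ℤ.- j) (begin
    fromℤ (i ℤ.- j)              ≈⟨ fromℤ-+ i (ℤ.- j) ⟩
    fromℤ i ⊕ fromℤ (ℤ.- j)      ≈⟨ ℝ.+-cong eq (fromℤ-neg j) ⟩
    fromℤ j ⊕ ⊖ fromℤ j          ≈⟨ ℝ.-‿inverseʳ _ ⟩
    0#                           ∎))

  fromℤ-Σ : ∀ {n} (f : Fin n → ℤ) → fromℤ (Σℤ f) ≈ Σᴿ (fromℤ ∘ f)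
  fromℤ-Σ {zero}  f = ℝ.refl
  fromℤ-Σ {suc n} f = ℝ.trans (fromℤ-+ (f zero) _) (ℝ.+-congˡ (fromℤ-Σ (f ∘ suc)))

  Σᴿ-cong : ∀ {n} {f g : Fin n → Carrier} → (∀ i → f i ≈ g i) → Σᴿ f ≈ Σᴿ g
  Σᴿ-cong = ΣR.sum-cong-≋

  Σᴿ-zero : ∀ {n} {f : Fin n → Carrier} → (∀ i → f i ≈ 0#) → Σᴿ f ≈ 0#
  Σᴿ-zero {n} f≈0 = ℝ.trans (Σᴿ-cong f≈0) (ΣR.sum-replicate-zero n)

  Σᴿ-neg : ∀ {n} (f : Fin n → Carrier) → Σᴿ (λ i → ⊖ f i) ≈ ⊖ Σᴿ f
  Σᴿ-neg {zero}  f = ℝ.sym RP.-0#≈0#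
  Σᴿ-neg {suc n} f = ℝ.trans (ℝ.+-congˡ (Σᴿ-neg (f ∘ suc))) (RP.-‿+-comm _ _)

  δ : ∀ {n} → Fin n → Fin n → Carrier
  δ i j with i Finₚ.≟ j
  ... | yes _ = 1#
  ... | no _  = 0#

  Σᴿ-δ : ∀ {n} (f : Fin n → Carrier) i → Σᴿ (λ j → f j ⊗ δ i j) ≈ f i
  Σᴿ-δ {suc n} f i = begin
    Σᴿ (λ j → f j ⊗ δ i j)                                      ≈⟨ ΣR.sum-remove {i = i} (λ j → f j ⊗ δ i j) ⟩
    f i ⊗ δ i i ⊕ Σᴿ (λ j → f (punchIn i j) ⊗ δ i (punchIn i j)) ≈⟨ ℝ.+-cong (diagonal i) (Σᴿ-zero off-diagonal) ⟩
    f i ⊕ 0#                                                    ≈⟨ ℝ.+-identityʳ _ ⟩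
    f i                                                         ∎
    where
    diagonal : ∀ i → f i ⊗ δ i i ≈ f i
    diagonal i with i Finₚ.≟ i
    ... | yes _  = ℝ.*-identityʳ _
    ... | no i≢i = contradiction refl i≢i
    off-diagonal : ∀ j → f (punchIn i j) ⊗ δ i (punchIn i j) ≈ 0#
    off-diagonal j with i Finₚ.≟ punchIn i j
    ... | yes eq = contradiction (sym eq) (Finₚ.punchInᵢ≢i i j)
    ... | no _   = ℝ.zeroʳ _

  module _ (D : ℕ) where

    Vector : Set
    Vector = Fin (suc D) → Carrier

    -- A vector y also stands for the hyperplane x₀ + Σ yₖ xₖ = y₀.
    Incident : Vector → Vector → Set
    Incident x y = x zero ⊕ Σᴿ (λ k → y (suc k) ⊗ x (suc k)) ≈ y zero

    incident? : ∀ x y → Dec (Incident x y)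
    incident? x y = (x zero ⊕ Σᴿ (λ k → y (suc k) ⊗ x (suc k))) ≟ y zero

    open Geometry ℝ (suc D) using (Hyperplane; hyperplane; sumR; _∈H_; _∈H?_; _≠H_; inc; indicator; PointSet; Arrangement; ContainsK)

    toHyperplane : Vector → Hyperplane
    toHyperplane y = hyperplane (λ { zero → 1# ; (suc k) → y (suc k) }) (y zero) (zero , λ 1≈0 → 0≉1 (ℝ.sym 1≈0))

    sumR≡Σᴿ : ∀ {n} (f : Fin n → Carrier) → sumR f ≡ Σᴿ f
    sumR≡Σᴿ {zero}  f = refl
    sumR≡Σᴿ {suc n} f = cong (f zero ⊕_) (sumR≡Σᴿ (f ∘ suc))

    side : ∀ (x y : Vector) → sumR (λ k → Hyperplane.normal (toHyperplane y) k ⊗ x k) ≈ x zero ⊕ Σᴿ (λ k → y (suc k) ⊗ x (suc k))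
    side x y = ℝ.+-cong (ℝ.*-identityˡ _) (ℝ.reflexive (sumR≡Σᴿ (λ k → y (suc k) ⊗ x (suc k))))

    ∈H⇒Incident : ∀ {x y : Vector} → x ∈H toHyperplane y → Incident x y
    ∈H⇒Incident {x} {y} h = ℝ.trans (ℝ.sym (side x y)) h

    Incident⇒∈H : ∀ {x y : Vector} → Incident x y → x ∈H toHyperplane y
    Incident⇒∈H {x} {y} h = ℝ.trans (side x y) h

    on-axis : Carrier → Vector
    on-axis c zero    = c
    on-axis c (suc k) = 0#

    intercept : ∀ (y : Vector) → Incident (on-axis (y zero)) y
    intercept y = ℝ.trans (ℝ.+-congˡ (Σᴿ-zero {D} (λ k → ℝ.zeroʳ (y (suc k))))) (ℝ.+-identityʳ _)

    shifted : Vector → Fin D → Vector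
    shifted y k zero    = y zero ⊕ ⊖ y (suc k)
    shifted y k (suc j) = δ k j

    side-shifted : ∀ (y y′ : Vector) k → shifted y k zero ⊕ Σᴿ (λ j → y′ (suc j) ⊗ δ k j) ≈ y zero ⊕ ⊖ y (suc k) ⊕ y′ (suc k)
    side-shifted y y′ k = ℝ.+-congˡ (Σᴿ-δ (y′ ∘ suc) k)

    cancel : ∀ a b → a ⊕ ⊖ b ⊕ b ≈ a
    cancel a b = ℝ.trans (ℝ.+-assoc _ _ _) (ℝ.trans (ℝ.+-congˡ (ℝ.-‿inverseˡ b)) (ℝ.+-identityʳ a))

    -- Test points read off the coordinates: the intercept on the first axis gives `y zero`, and
    -- `shifted y k`, where one further coordinate is 1, then gives `y (suc k)`.
    toHyperplane-injective : ∀ y y′ → (∀ x → x ∈H toHyperplane y → x ∈H toHyperplane y′) → ∀ k → y k ≈ y′ k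
    toHyperplane-injective y y′ sub zero = ℝ.trans (ℝ.sym (ℝ.trans (ℝ.+-congˡ (Σᴿ-zero {D} (λ k → ℝ.zeroʳ (y′ (suc k))))) (ℝ.+-identityʳ _)))
      (∈H⇒Incident {on-axis (y zero)} {y′} (sub (on-axis (y zero)) (Incident⇒∈H {on-axis (y zero)} {y} (intercept y))))
    toHyperplane-injective y y′ sub (suc k) = RP.+-cancelˡ (y zero ⊕ ⊖ y (suc k)) _ _ (begin
      y zero ⊕ ⊖ y (suc k) ⊕ y (suc k)   ≈⟨ cancel _ _ ⟩
      y zero                             ≈⟨ toHyperplane-injective y y′ sub zero ⟩
      y′ zero                            ≈⟨ ∈H⇒Incident {shifted y k} {y′} (sub (shifted y k) (Incident⇒∈H {shifted y k} {y} (ℝ.trans (side-shifted y y k) (cancel (y zero) (y (suc k)))))) ⟨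
      shifted y k zero ⊕ Σᴿ (λ j → y′ (suc j) ⊗ δ k j) ≈⟨ side-shifted y y′ k ⟩
      y zero ⊕ ⊖ y (suc k) ⊕ y′ (suc k)  ∎)

    -- Points and hyperplanes are both coordinate vectors here, so that duality can exchange them.
    record Arranged (n m R count : ℕ) : Set where
      field
        X : Fin n → Vector
        Y : Fin m → Vector
        X-distinct : ∀ i j → (∀ k → X i k ≈ X j k) → i ≡ j
        Y-distinct : ∀ i j → (∀ k → Y i k ≈ Y j k) → i ≡ j
        free : ∀ (f : Fin R → Fin n) (g : Fin R → Fin m) → Injective _≡_ _≡_ f → Injective _≡_ _≡_ g →
          ¬ (∀ a b → Incident (X (f a)) (Y (g b)))
        counted : count ≤ Σℕ (λ i → Σℕ (λ j → ind (incident? (X i) (Y j))))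

    -- Solving x₀ + Σ yₖ xₖ = y₀ for x₀ gives y₀ + Σ (-xₖ) yₖ = x₀, the same equation with the roles
    -- exchanged and these signs changed.
    conjugate : Vector → Vector
    conjugate x zero    = x zero
    conjugate x (suc k) = ⊖ x (suc k)

    conjugate-injective : ∀ {x y : Vector} → (∀ k → conjugate x k ≈ conjugate y k) → ∀ k → x k ≈ y k
    conjugate-injective eq zero    = eq zero
    conjugate-injective eq (suc k) = RP.-‿injective (eq (suc k))

    pairing : ∀ (x y : Vector) → Σᴿ (λ k → conjugate x (suc k) ⊗ y (suc k)) ≈ ⊖ Σᴿ (λ k → y (suc k) ⊗ x (suc k))
    pairing x y = ℝ.trans (Σᴿ-cong {D} (λ k → ℝ.trans (ℝ.sym (RP.-‿distribˡ-* _ _)) (ℝ.-‿cong (ℝ.*-comm _ _)))) (Σᴿ-neg {D} _)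

    dual⇒ : ∀ (x y : Vector) → Incident x y → Incident y (conjugate x)
    dual⇒ x y h = begin
      y zero ⊕ Σᴿ (λ k → conjugate x (suc k) ⊗ y (suc k)) ≈⟨ ℝ.+-cong (ℝ.sym h) (pairing x y) ⟩
      x zero ⊕ S ⊕ ⊖ S                                  ≈⟨ ℝ.+-assoc _ _ _ ⟩
      x zero ⊕ (S ⊕ ⊖ S)                                ≈⟨ ℝ.+-congˡ (ℝ.-‿inverseʳ S) ⟩
      x zero ⊕ 0#                                       ≈⟨ ℝ.+-identityʳ _ ⟩
      x zero                                            ∎
      where
      S = Σᴿ (λ k → y (suc k) ⊗ x (suc k))

    dual⇐ : ∀ (x y : Vector) → Incident y (conjugate x) → Incident x y
    dual⇐ x y h = begin
      x zero ⊕ S                                                  ≈⟨ ℝ.+-congʳ (ℝ.sym h) ⟩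
      y zero ⊕ Σᴿ (λ k → conjugate x (suc k) ⊗ y (suc k)) ⊕ S     ≈⟨ ℝ.+-congʳ (ℝ.+-congˡ (pairing x y)) ⟩
      y zero ⊕ ⊖ S ⊕ S                                            ≈⟨ cancel _ _ ⟩
      y zero                                                      ∎
      where
      S = Σᴿ (λ k → y (suc k) ⊗ x (suc k))

    dual : ∀ {n m R count} → Arranged n m R count → Arranged m n R count
    dual {n} {m} A = record
      { X = Y
      ; Y = conjugate ∘ X
      ; X-distinct = Y-distinct
      ; Y-distinct = λ i j eq → X-distinct i j (conjugate-injective eq)
      ; free       = λ f g f-inj g-inj inc → free g f g-inj f-inj (λ a b → dual⇐ (X (g a)) (Y (f b)) (inc b a))
      ; counted    = ℕₚ.≤-trans counted (ℕₚ.≤-trans (Σℕ-mono {n} (λ i → Σℕ-mono {m} (λ j →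
                       ind-mono (incident? (X i) (Y j)) (incident? (Y j) (conjugate (X i))) (dual⇒ (X i) (Y j)))))
                       (ℕₚ.≤-reflexive (ΣN.∑-comm {n} {m} _)))
      }
      where open Arranged A

    toGeometry : ∀ {n m R count} → Arranged n m R count → Σ (PointSet n) λ P → Σ (Arrangement m) λ H →
      ¬ ContainsK R (proj₁ P) (proj₁ H) × count ≤ inc (proj₁ P) (proj₁ H)
    toGeometry {n} {m} A = (X , λ i j i≢j eq → i≢j (X-distinct i j eq)) ,
      (toHyperplane ∘ Y , λ i j i≢j same → i≢j (Y-distinct i j (toHyperplane-injective (Y i) (Y j) (λ x → proj₁ (same x))))) ,
      (λ (f , g , f-inj , g-inj , inc) → free f g f-inj g-inj (λ a b → ∈H⇒Incident {X (f a)} {Y (g b)} (inc a b))) ,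
      ℕₚ.≤-trans counted (ℕₚ.≤-trans (Σℕ-mono {n} (λ i → ℕₚ.≤-trans (Σℕ-mono {m} (λ j →
          ℕₚ.≤-trans (ind-mono (incident? (X i) (Y j)) (X i ∈H? toHyperplane (Y j)) (Incident⇒∈H {X i} {Y j}))
            (ℕₚ.≤-reflexive (ind≡indicator (X i ∈H? toHyperplane (Y j))))))
          (ℕₚ.≤-reflexive (Σℕ≡sum (λ j → indicator (X i ∈H? toHyperplane (Y j)))))))
        (ℕₚ.≤-reflexive (Σℕ≡sum (λ i → sum (List.tabulate (λ j → indicator (X i ∈H? toHyperplane (Y j))))))))
      where
      open Arranged A
      ind≡indicator : {A : Set} (d : Dec A) → ind d ≡ indicator d
      ind≡indicator (yes _) = refl
      ind≡indicator (no _)  = refl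
      Σℕ≡sum : ∀ {n} (f : Fin n → ℕ) → Σℕ f ≡ sum (List.tabulate f)
      Σℕ≡sum {zero}  f = refl
      Σℕ≡sum {suc n} f = cong (ℕ._+_ (f zero)) (Σℕ≡sum (f ∘ suc))

-- From integer configurations to real arrangements

∣Σℤ∣≤ : ∀ {n} (f : Fin n → ℤ) c → (∀ i → ∣ f i ∣ ≤ c) → ∣ Σℤ f ∣ ≤ n * c
∣Σℤ∣≤ {zero}  f c small = z≤n
∣Σℤ∣≤ {suc n} f c small = ℕₚ.≤-trans (ℤₚ.∣i+j∣≤∣i∣+∣j∣ (f zero) _) (ℕₚ.+-mono-≤ (small zero) (∣Σℤ∣≤ (f ∘ suc) c (small ∘ suc)))

∣·∣≤ : ∀ {n} (v w : Fin n → ℤ) {a b} → (∀ i → ∣ v i ∣ ≤ a) → (∀ i → ∣ w i ∣ ≤ b) → ∣ v · w ∣ ≤ n * (a * b)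
∣·∣≤ v w {a} {b} v≤ w≤ = ∣Σℤ∣≤ (λ i → v i ℤ.* w i) (a * b) (λ i →
  subst (_≤ a * b) (sym (ℤₚ.∣i*j∣≡∣i∣*∣j∣ (v i) (w i))) (ℕₚ.*-mono-≤ (v≤ i) (w≤ i)))

shift-nonneg : ∀ z B → ∣ z ∣ ≤ B → 0ℤ ℤ.≤ z ℤ.+ + B
shift-nonneg (+ n)    B _  = ℤ.+≤+ z≤n
shift-nonneg -[1+ n ] B le = subst (0ℤ ℤ.≤_) (sym (ℤₚ.⊖-≥ le)) (ℤ.+≤+ z≤n)

module _ (ℝ : CompleteOrderedField) where
  open CompleteOrderedField ℝ using (Carrier; _≈_; 0#; 1#)
    renaming (_+_ to _⊕_; _*_ to _⊗_)
  open Realisation ℝ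
  private
    module ℝ = CompleteOrderedField ℝ
    module ΣR = SemiringSum ℝ.semiring
  open ΣR using () renaming (sum to Σᴿ)
  open SetoidReasoning ℝ.setoid

  -- The hyperplane with index j has normal number j % t₂ and offset j / t₂ − B, where B bounds all scalar products.
  fromConfiguration : ∀ {D t₁ t₂ N M R} n m → Configuration D t₁ t₂ N M R → 0 < R → 0 < t₂ → n ≤ t₁ →
    (2 * (suc D * (M * N)) + 1) * t₂ ≤ m → Arranged D n m R (n * t₂)
  fromConfiguration {D} {t₁} {t₂} {N} {M} {R} n m C 0<R 0<t₂ n≤t₁ m≥ = record
    { X = X ; Y = Y ; X-distinct = X-distinct ; Y-distinct = Y-distinct ; free = free ; counted = counted }
    where
    open Configuration C
    instance
      t₂≢0 : NonZero t₂
      t₂≢0 = ℕ.>-nonZero 0<t₂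
    B : ℕ
    B = suc D * (M * N)
    pt : Fin n → Fin (suc D) → ℤ
    pt i = point (Fin.inject≤ i n≤t₁)
    r : Fin m → Fin t₂
    r j = fromℕ< (ℕ.m%n<n (toℕ j) t₂)
    β : Fin m → ℤ
    β j = + (toℕ j ℕ./ t₂) ℤ.- + B
    index-unique : ∀ i j → r i ≡ r j → β i ≡ β j → i ≡ j
    index-unique i j r≡ β≡ = Finₚ.toℕ-injective (trans (ℕ.m≡m%n+[m/n]*n (toℕ i) t₂)
      (trans (cong₂ (λ x y → x + y * t₂)
        (trans (sym (Finₚ.toℕ-fromℕ< _)) (trans (cong toℕ r≡) (Finₚ.toℕ-fromℕ< _)))
        (ℤₚ.+-injective (trans (sym (undo _ (+ B))) (trans (cong (ℤ._+ + B) β≡) (undo _ (+ B)))))) (sym (ℕ.m≡m%n+[m/n]*n (toℕ j) t₂))))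
      where
      undo : ∀ a b → a ℤ.- b ℤ.+ b ≡ a
      undo = ℤ-solve-∀
    α : Fin t₂ → Fin (suc D) → Carrier
    α s k = fromℤ (normal s k)
    inv : ∀ s → Σ Carrier λ v → α s zero ⊗ v ≈ 1#
    inv s = ℝ.inverse (α s zero) (λ eq → normal-nonzero s (fromℤ≈0⇒≡0 (normal s zero) eq))
    v : Fin t₂ → Carrier
    v s = proj₁ (inv s)
    unscale : ∀ s x → x ⊗ v s ⊗ α s zero ≈ x
    unscale s x = ℝ.trans (ℝ.*-assoc _ _ _) (ℝ.trans (ℝ.*-congˡ (ℝ.trans (ℝ.*-comm _ _) (proj₂ (inv s)))) (ℝ.*-identityʳ x))
    scale-cancel : ∀ s x y → x ⊗ v s ≈ y ⊗ v s → x ≈ y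
    scale-cancel s x y eq = ℝ.trans (ℝ.sym (unscale s x)) (ℝ.trans (ℝ.*-congʳ eq) (unscale s y))
    X : Fin n → Vector D
    X i k = fromℤ (pt i k)
    -- Division by the first entry of the normal makes the leading coefficient 1, the form that can
    -- be dualised.
    Y : Fin m → Vector D
    Y j zero    = fromℤ (β j) ⊗ v (r j)
    Y j (suc k) = α (r j) (suc k) ⊗ v (r j)
    side-scaled : ∀ i j → X i zero ⊕ Σᴿ (λ k → Y j (suc k) ⊗ X i (suc k)) ≈ fromℤ (normal (r j) · pt i) ⊗ v (r j)
    side-scaled i j = ℝ.sym (begin
      fromℤ (normal (r j) · pt i) ⊗ v (r j)
        ≈⟨ ℝ.*-congʳ (ℝ.trans (fromℤ-Σ (λ k → normal (r j) k ℤ.* pt i k)) (Σᴿ-cong {suc D} (λ k → fromℤ-* (normal (r j) k) (pt i k)))) ⟩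
      (α (r j) zero ⊗ X i zero ⊕ Σᴿ (λ k → α (r j) (suc k) ⊗ X i (suc k))) ⊗ v (r j)
        ≈⟨ ℝ.distribʳ _ _ _ ⟩
      α (r j) zero ⊗ X i zero ⊗ v (r j) ⊕ Σᴿ (λ k → α (r j) (suc k) ⊗ X i (suc k)) ⊗ v (r j)
        ≈⟨ ℝ.+-cong (ℝ.trans (swap _ _ _) (ℝ.trans (ℝ.*-congʳ (proj₂ (inv (r j)))) (ℝ.*-identityˡ _)))
             (ℝ.trans (ΣR.*-distribʳ-sum {D} (v (r j)) _) (Σᴿ-cong {D} (λ k → swap _ _ _))) ⟩
      X i zero ⊕ Σᴿ (λ k → Y j (suc k) ⊗ X i (suc k)) ∎)
      where
      swap : ∀ a b c → a ⊗ b ⊗ c ≈ a ⊗ c ⊗ b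
      swap a b c = ℝ.trans (ℝ.*-assoc _ _ _) (ℝ.trans (ℝ.*-congˡ (ℝ.*-comm _ _)) (ℝ.sym (ℝ.*-assoc _ _ _)))
    ≡⇒Incident : ∀ i j → normal (r j) · pt i ≡ β j → Incident D (X i) (Y j)
    ≡⇒Incident i j eq = ℝ.trans (side-scaled i j) (ℝ.reflexive (cong (λ z → fromℤ z ⊗ v (r j)) eq))
    Incident⇒≡ : ∀ i j → Incident D (X i) (Y j) → normal (r j) · pt i ≡ β j
    Incident⇒≡ i j h = fromℤ-injective _ _ (scale-cancel (r j) _ _ (ℝ.trans (ℝ.sym (side-scaled i j)) h))
    X-distinct : ∀ i j → (∀ k → X i k ≈ X j k) → i ≡ j
    X-distinct i j eq = Finₚ.inject≤-injective n≤t₁ n≤t₁ i j (point-distinct _ _ (λ k → fromℤ-injective _ _ (eq k)))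
    Y-distinct : ∀ i j → (∀ k → Y i k ≈ Y j k) → i ≡ j
    Y-distinct i j eq = index-unique i j r≡ (fromℤ-injective _ _ (scale-cancel (r i) _ _
      (ℝ.trans (eq zero) (ℝ.reflexive (cong (λ s → fromℤ (β j) ⊗ v s) (sym r≡))))))
      where
      cross : ∀ x y → x ⊗ v (r i) ≈ y ⊗ v (r j) → x ⊗ α (r j) zero ≈ y ⊗ α (r i) zero
      cross x y eq = begin
        x ⊗ αⱼ                       ≈⟨ ℝ.*-congʳ (unscale (r i) x) ⟨
        x ⊗ v (r i) ⊗ αᵢ ⊗ αⱼ        ≈⟨ ℝ.*-congʳ (ℝ.*-congʳ eq) ⟩
        y ⊗ v (r j) ⊗ αᵢ ⊗ αⱼ        ≈⟨ ℝ.*-assoc _ _ _ ⟩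
        y ⊗ v (r j) ⊗ (αᵢ ⊗ αⱼ)      ≈⟨ ℝ.*-congˡ (ℝ.*-comm _ _) ⟩
        y ⊗ v (r j) ⊗ (αⱼ ⊗ αᵢ)      ≈⟨ ℝ.*-assoc _ _ _ ⟨
        y ⊗ v (r j) ⊗ αⱼ ⊗ αᵢ        ≈⟨ ℝ.*-congʳ (unscale (r j) y) ⟩
        y ⊗ αᵢ                       ∎
        where
        αᵢ = α (r i) zero
        αⱼ = α (r j) zero
      r≡ : r i ≡ r j
      r≡ = normal-distinct (r i) (r j) λ
        { zero    → ℤₚ.*-comm (normal (r i) zero) (normal (r j) zero)
        ; (suc k) → fromℤ-injective _ _ (ℝ.trans (fromℤ-* (normal (r i) (suc k)) (normal (r j) zero))
            (ℝ.trans (cross _ _ (eq (suc k))) (ℝ.sym (fromℤ-* (normal (r j) (suc k)) (normal (r i) zero))))) }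
    free : ∀ (f : Fin R → Fin n) (g : Fin R → Fin m) → Injective _≡_ _≡_ f → Injective _≡_ _≡_ g →
      ¬ (∀ a b → Incident D (X (f a)) (Y (g b)))
    free f g f-inj g-inj inc = K-free (λ a → Fin.inject≤ (f a) n≤t₁) (r ∘ g) (β ∘ g)
      (λ eq → f-inj (Finₚ.inject≤-injective n≤t₁ n≤t₁ _ _ eq))
      -- Hyperplanes with equal normals are parallel, but all those considered pass through the
      -- point of `f a₀`; so equal normals force equal offsets.
      (λ {b} {b′} eq → g-inj (index-unique _ _ eq (trans (sym (offset b))
        (trans (cong (λ s → normal s · pt (f a₀)) eq) (offset b′)))))
      (λ a b → Incident⇒≡ (f a) (g b) (inc a b))
      where
      a₀ : Fin R
      a₀ = fromℕ< 0<R
      offset : ∀ b → normal (r (g b)) · pt (f a₀) ≡ β (g b)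
      offset b = Incident⇒≡ (f a₀) (g b) (inc a₀ b)
    counted : n * t₂ ≤ Σℕ (λ i → Σℕ (λ j → ind (incident? D (X i) (Y j))))
    counted = subst (_≤ Σℕ (λ i → Σℕ (λ j → ind (incident? D (X i) (Y j))))) (Σℕ-const n t₂) (Σℕ-mono (λ i →
      injection-count (λ j → ind (incident? D (X i) (Y j))) (through i) (λ {s} {s′} eq →
        trans (sym (r-through i s)) (trans (cong r eq) (r-through i s′)))
        (λ s → ℕₚ.≤-reflexive (sym (ind≡1 (incident? D (X i) (Y (through i s))) (≡⇒Incident i (through i s)
          (trans (cong (λ s → normal s · pt i) (r-through i s)) (sym (β-through i s)))))))))
      where
      module _ (i : Fin n) (s : Fin t₂) where
        z : ℤ
        z = normal s · pt i
        z≤B : ∣ z ∣ ≤ B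
        z≤B = ∣·∣≤ (normal s) (pt i) (normal-small s) (point-small _)
        q : ℕ
        q = ∣ z ℤ.+ + B ∣
        q≤ : q ≤ 2 * B
        q≤ = ℕₚ.≤-trans (ℤₚ.∣i+j∣≤∣i∣+∣j∣ z (+ B)) (ℕₚ.≤-trans (ℕₚ.+-monoˡ-≤ B z≤B)
               (ℕₚ.≤-reflexive (cong (λ y → B + y) (sym (ℕₚ.+-identityʳ B)))))
        -- With q = z + B ≤ 2 B, the hyperplane with normal s through point i is among the first (2
        -- B + 1) t₂.
        index< : toℕ s + q * t₂ < m
        index< = ℕₚ.<-≤-trans (ℕₚ.+-mono-<-≤ (Finₚ.toℕ<n s) (ℕₚ.*-monoˡ-≤ t₂ q≤))
          (ℕₚ.≤-trans (ℕₚ.≤-reflexive (cong (_* t₂) (sym (ℕₚ.+-comm (2 * B) 1)))) m≥)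
        through : Fin m
        through = fromℕ< index<
        r-through : r through ≡ s
        r-through = Finₚ.toℕ-injective (trans (Finₚ.toℕ-fromℕ< _) (trans (cong (ℕ._% t₂) (Finₚ.toℕ-fromℕ< index<))
          (proj₂ (<⇒quotient-unique q (toℕ s) t₂ (Finₚ.toℕ<n s)))))
        β-through : β through ≡ z
        β-through = trans (cong (λ y → + y ℤ.- + B) (trans (cong (ℕ._/ t₂) (Finₚ.toℕ-fromℕ< index<))
            (proj₁ (<⇒quotient-unique q (toℕ s) t₂ (Finₚ.toℕ<n s)))))
          (trans (cong (ℤ._- + B) (ℤₚ.0≤i⇒+∣i∣≡i (shift-nonneg z B z≤B))) (cancel′ z (+ B)))
          where
          cancel′ : ∀ a b → a ℤ.+ b ℤ.- b ≡ a
          cancel′ = ℤ-solve-∀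

  -- All points lie on x₀ = 0 and none on its translates, so no point is on two of the hyperplanes.
  -- This is the fallback when m is too small compared with n for the main construction.
  parallel : ∀ {D R} n m → 1 < R → 0 < m → Arranged (suc D) n m R n
  parallel {D} {R} n (suc m) 1<R 0<m = record
    { X = X ; Y = Y
    ; X-distinct = λ i j eq → Finₚ.toℕ-injective (ℤₚ.+-injective (fromℤ-injective _ _ (eq (suc zero))))
    ; Y-distinct = λ i j eq → Finₚ.toℕ-injective (ℤₚ.+-injective (fromℤ-injective _ _ (eq zero)))
    ; free = λ f g f-inj g-inj inc → contradiction
        (g-inj (Finₚ.toℕ-injective (trans (only-zero (f b₀) (g b₀) (inc b₀ b₀)) (sym (only-zero (f b₀) (g b₁) (inc b₀ b₁))))))
        (λ eq → contradiction (trans (sym (Finₚ.toℕ-fromℕ< _)) (trans (cong toℕ eq) (Finₚ.toℕ-fromℕ< _))) λ ())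
    ; counted = subst (_≤ Σℕ (λ i → Σℕ (λ j → ind (incident? (suc D) (X i) (Y j))))) (trans (Σℕ-const n 1) (ℕₚ.*-identityʳ n))
        (Σℕ-mono {n} (λ i → ℕₚ.≤-trans (ℕₚ.≤-reflexive (sym (ind≡1 (incident? (suc D) (X i) (Y zero)) (side-zero i zero))))
          (term≤Σℕ (λ j → ind (incident? (suc D) (X i) (Y j))) zero)))
    }
    where
    X : Fin n → Vector (suc D)
    X i zero          = 0#
    X i (suc zero)    = fromℤ (+ toℕ i)
    X i (suc (suc k)) = 0#
    Y : Fin (suc m) → Vector (suc D)
    Y j = on-axis (suc D) (fromℤ (+ toℕ j))
    side-zero : ∀ i j → X i zero ⊕ Σᴿ (λ k → Y j (suc k) ⊗ X i (suc k)) ≈ 0#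
    side-zero i j = ℝ.trans (ℝ.+-identityˡ _) (Σᴿ-zero {suc D} (λ k → ℝ.zeroˡ (X i (suc k))))
    only-zero : ∀ i j → Incident (suc D) (X i) (Y j) → toℕ j ≡ 0
    only-zero i j h = ℤₚ.+-injective (fromℤ≈0⇒≡0 (+ toℕ j) (ℝ.trans (ℝ.sym h) (side-zero i j)))
    b₀ b₁ : Fin R
    b₀ = fromℕ< (ℕₚ.<-trans (s≤s z≤n) 1<R)
    b₁ = fromℕ< 1<R

-- Parameters and exponents

-- Here s₁ and s₂ are one less than the s₁ and s₂ explained at the top, so A is the exponent s₂ + 1 of the number of points.
-- There are p ^ (A S u) points in a grid of side p ^ (R u), and p ^ (β S v) normals with entries at most p ^ (R D v).
-- The ratio S / R = δ / (δ + 1) is below 1 to leave room for the greedy choice; this costs the ε in the exponent.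
module Construction (s₁ s₂ δ : ℕ) .{{δ≢0 : NonZero δ}} (p : ℕ) (p-prime : Prime p)
  (8^D<p : 8 ^ suc (s₁ + s₂) < p) (2d<p : 2 * suc (suc (s₁ + s₂)) < p) where

  D d A β σ S R E : ℕ
  D = suc (s₁ + s₂)
  d = suc D
  A = suc (suc s₂)
  -- In the numbering of the code about Q^(s₁ + 1) normals survive the greedy choice, and Q = G^d; β
  -- is their exponent in terms of G.
  β = d * suc s₁
  -- The gap R - S = σ has to absorb the number of lists: the points need β < A σ, the normals need
  -- d v D (s₂ + 1) + 1 < β σ v.
  σ = D * suc s₂ + 2 + β
  S = σ * δ
  R = S + σ
  -- m grows like p^(E v) N: the summand β S counts the normals, and R D bounds their entries.
  E = β * S + R * D

  private
    instance
      p≢0 : NonZero p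
      p≢0 = ℕ.>-nonZero (ℕₚ.<-trans (s≤s z≤n) (1<p p p-prime))
    σ≥2+β : 2 + β ≤ σ
    σ≥2+β = ℕₚ.+-monoˡ-≤ β (ℕₚ.m≤n+m 2 (D * suc s₂))
    σ≥2 : 2 ≤ σ
    σ≥2 = ℕₚ.≤-trans (ℕₚ.m≤m+n 2 β) σ≥2+β
    σ≤R : σ ≤ R
    σ≤R = ℕₚ.m≤n+m σ S
    instance
      R≢0 : NonZero R
      R≢0 = ℕ.>-nonZero (ℕₚ.≤-trans (ℕₚ.≤-trans (s≤s z≤n) σ≥2) σ≤R)
      βσ≢0 : NonZero (β * σ)
      βσ≢0 = ℕₚ.m*n≢0 β σ {{_}} {{ℕ.>-nonZero (ℕₚ.≤-trans (s≤s z≤n) σ≥2)}}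

  1<R : 1 < R
  1<R = ℕₚ.≤-trans σ≥2 σ≤R


  config : ∀ u′ v′ → Configuration D (p ^ (A * S * suc u′)) (p ^ (β * S * suc v′)) (p ^ (R * suc u′)) ((p ^ (R * suc v′)) ^ D) R
  config u′ v′ = configuration p p-prime D s₁ s₂ R (cong suc (ℕₚ.+-suc s₁ s₂)) s₁<R s₂<R
      (p ^ (R * u)) (R * u) refl (p ^ (A * S * u)) (p ^ b₁) fits₁ (ℕₚ.m^n>0 p b₁) small₁
      (p ^ (R * v)) ((p ^ (R * v)) ^ D) (p ^ e) (R * v + R * v * D) refl M≡ (ℕₚ.m^n>0 p (R * v)) Q≡ 8^D<p
      (p ^ (β * S * v)) (p ^ b₂) fits₂ (ℕₚ.m^n>0 p b₂) small₂
    where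
    u v b₁ b₂ e x : ℕ
    u = suc u′
    v = suc v′
    -- The block size is what p^(A S u) blocks leave of N^d, because R d - A S = s₁ R + A σ.
    b₁ = (s₁ * R + A * σ) * u
    e = ℕ.pred (R * v * D)
    -- One less, because only M′ = M / p is available: a factor p has gone into avoiding the bad
    -- directions.
    x = ℕ.pred (β * σ * v)
    b₂ = d * s₂ * R * v + x
    suc-e : suc e ≡ R * v * D
    suc-e = ℕₚ.suc-pred (R * v * D) {{ℕₚ.m*n≢0 (R * v) D {{ℕₚ.m*n≢0 R v}}}}
    suc-x : suc x ≡ β * σ * v
    suc-x = ℕₚ.suc-pred (β * σ * v) {{ℕₚ.m*n≢0 (β * σ) v}}
    s₁<R : s₁ < R
    s₁<R = ℕₚ.≤-trans (ℕₚ.m≤n*m (suc s₁) d) (ℕₚ.≤-trans (ℕₚ.m≤n+m β 2) (ℕₚ.≤-trans σ≥2+β σ≤R))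
    s₂<R : s₂ < R
    s₂<R = ℕₚ.≤-trans (ℕₚ.m≤n*m (suc s₂) D) (ℕₚ.≤-trans (ℕₚ.m≤m+n (D * suc s₂) 2) (ℕₚ.≤-trans (ℕₚ.m≤m+n _ β) σ≤R))
    fits₁ : p ^ (A * S * u) * p ^ b₁ ≤ (p ^ (R * u)) ^ d
    fits₁ = ℕₚ.≤-reflexive (trans (sym (ℕₚ.^-distribˡ-+-* p (A * S * u) b₁))
      (trans (cong (p ^_) (exponents s₁ s₂ S σ u)) (sym (ℕₚ.^-*-assoc p (R * u) d))))
      where
      exponents : ∀ s₁ s₂ S σ u → suc (suc s₂) * S * u + (s₁ * (S + σ) + suc (suc s₂) * σ) * u ≡ (S + σ) * u * suc (suc (s₁ + s₂))
      exponents = ℕ-solve-∀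
    power : ∀ a b c y → p ^ a ≡ y → (y ^ b) ^ c ≡ p ^ (a * b * c)
    power a b c y refl = trans (cong (_^ c) (ℕₚ.^-*-assoc p a b)) (ℕₚ.^-*-assoc p (a * b) c)
    powers : ∀ a b c b′ c′ y → p ^ a ≡ y → (y ^ b) ^ c * (y ^ b′) ^ c′ ≡ p ^ (a * b * c + a * b′ * c′)
    powers a b c b′ c′ y eq = trans (cong₂ _*_ (power a b c y eq) (power a b′ c′ y eq)) (sym (ℕₚ.^-distribˡ-+-* p (a * b * c) _))
    small₁ : ((p ^ (R * u)) ^ d) ^ suc s₁ * ((p ^ (R * u)) ^ s₁) ^ R < (p ^ b₁) ^ R
    small₁ = subst₂ _<_ (sym (powers (R * u) d (suc s₁) s₁ R _ refl)) (sym (ℕₚ.^-*-assoc p b₁ R))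
      (ℕₚ.^-monoʳ-< p (1<p p p-prime) (subst₂ _<_ (left R u d (suc s₁) s₁) (right R u s₁ A σ)
        (ℕₚ.+-monoˡ-< (R * u * s₁ * R) (ℕₚ.*-monoʳ-< (R * u) {{ℕₚ.m*n≢0 R u}} β<Aσ))))
      where
      β<Aσ : β < A * σ
      β<Aσ = ℕₚ.≤-trans (ℕₚ.n≤1+n (suc β)) (ℕₚ.≤-trans σ≥2+β (ℕₚ.m≤n*m σ A))
      left : ∀ R u d s s′ → R * u * (d * s) + R * u * s′ * R ≡ R * u * d * s + R * u * s′ * R
      left = ℕ-solve-∀
      right : ∀ R u s′ A σ → R * u * (A * σ) + R * u * s′ * R ≡ (s′ * R + A * σ) * u * R
      right = ℕ-solve-∀
    M≡ : (p ^ (R * v)) ^ D ≡ p * p ^ e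
    M≡ = trans (ℕₚ.^-*-assoc p (R * v) D) (cong (p ^_) (sym suc-e))
    Q≡ : p ^ (R * v) * (p ^ (R * v)) ^ D ≡ p ^ (R * v + R * v * D)
    Q≡ = trans (cong (p ^ (R * v) *_) (ℕₚ.^-*-assoc p (R * v) D)) (sym (ℕₚ.^-distribˡ-+-* p (R * v) (R * v * D)))
    fits₂ : p ^ (β * S * v) * p ^ b₂ ≤ p ^ e * ((p ^ (R * v)) ^ D) ^ D
    fits₂ = ℕₚ.≤-reflexive (trans (sym (ℕₚ.^-distribˡ-+-* p (β * S * v) b₂)) (trans (cong (p ^_) exponents)
      (trans (ℕₚ.^-distribˡ-+-* p e (R * v * D * D)) (cong (p ^ e *_) (sym (power (R * v) D D _ refl))))))
      where
      identity : ∀ s₁ s₂ S σ v →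
        suc (suc (s₁ + s₂)) * suc s₁ * S * v + suc (suc (s₁ + s₂)) * s₂ * (S + σ) * v + suc (suc (s₁ + s₂)) * suc s₁ * σ * v
        ≡ (S + σ) * v * suc (s₁ + s₂) + (S + σ) * v * suc (s₁ + s₂) * suc (s₁ + s₂)
      identity = ℕ-solve-∀
      exponents : β * S * v + b₂ ≡ e + R * v * D * D
      exponents = ℕₚ.suc-injective (begin
        suc (β * S * v + (d * s₂ * R * v + x))  ≡⟨ shift (β * S * v) (d * s₂ * R * v) x ⟩
        β * S * v + d * s₂ * R * v + suc x      ≡⟨ cong (λ z → β * S * v + d * s₂ * R * v + z) suc-x ⟩
        β * S * v + d * s₂ * R * v + β * σ * v  ≡⟨ identity s₁ s₂ S σ v ⟩
        R * v * D + R * v * D * D               ≡⟨ cong (_+ R * v * D * D) suc-e ⟨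
        suc e + R * v * D * D                   ∎)
        where
        open ≡-Reasoning
        shift : ∀ a b c → suc (a + (b + c)) ≡ a + b + suc c
        shift = ℕ-solve-∀
    small₂ : ((p ^ (R * v) * (p ^ (R * v)) ^ D) ^ D) ^ suc s₂ * ((p ^ (R * v) * (p ^ (R * v)) ^ D) ^ s₂) ^ R < (p ^ b₂) ^ R
    small₂ = subst₂ _<_ (sym (powers (R * v + R * v * D) D (suc s₂) s₂ R _ (sym Q≡))) (sym (ℕₚ.^-*-assoc p b₂ R))
      (ℕₚ.^-monoʳ-< p (1<p p p-prime) (subst₂ _<_ (left R v D (suc s₂) s₂) (right R (d * s₂ * R * v) x)
        (ℕₚ.*-monoʳ-< R (ℕₚ.+-monoʳ-< (d * s₂ * R * v) x-large))))
      where
      open ℕₚ.≤-Reasoning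
      left : ∀ R v D s s′ → R * (suc D * s′ * R * v + suc D * v * (D * s)) ≡
        (R * v + R * v * D) * D * s + (R * v + R * v * D) * s′ * R
      left = ℕ-solve-∀
      right : ∀ R a x → R * (a + x) ≡ (a + x) * R
      right = ℕ-solve-∀
      x-large : d * v * (D * suc s₂) < x
      x-large = ℕₚ.≤-pred (begin
        suc (suc (d * v * (D * suc s₂)))    ≡⟨ ℕₚ.+-comm 2 _ ⟩
        d * v * (D * suc s₂) + 2            ≤⟨ ℕₚ.+-monoʳ-≤ (d * v * (D * suc s₂)) (ℕₚ.m≤n*m 2 (d * v)) ⟩
        d * v * (D * suc s₂) + d * v * 2    ≡⟨ ℕₚ.*-distribˡ-+ (d * v) (D * suc s₂) 2 ⟨
        d * v * (D * suc s₂ + 2)            ≤⟨ ℕₚ.*-monoʳ-≤ (d * v) (ℕₚ.m≤m+n _ β) ⟩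
        d * v * σ                           ≤⟨ ℕₚ.*-monoˡ-≤ σ (ℕₚ.*-monoˡ-≤ v (ℕₚ.m≤m*n d (suc s₁))) ⟩
        β * v * σ                           ≡⟨ swap β v σ ⟩
        β * σ * v                           ≡⟨ suc-x ⟨
        suc x                               ∎)
        where
        swap : ∀ a b c → a * b * c ≡ a * c * b
        swap = ℕ-solve-∀

  n<p^n : ∀ n → n < p ^ n
  n<p^n zero    = s≤s z≤n
  n<p^n (suc n) = begin-strict
    suc n            ≤⟨ n<p^n n ⟩
    p ^ n            <⟨ ℕₚ.m<m*n (p ^ n) p {{ℕₚ.m^n≢0 p n}} (1<p p p-prime) ⟩
    p ^ n * p        ≡⟨ ℕₚ.*-comm (p ^ n) p ⟩
    p * p ^ n        ∎
    where open ℕₚ.≤-Reasoning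

  bracket : ∀ b c n .{{_ : NonZero b}} → p ^ c ≤ n → ∃ λ v → p ^ (b * v + c) ≤ n × n < p ^ (b * suc v + c)
  bracket b c n c≤n = search n (ℕₚ.<-≤-trans (n<p^n n) (ℕₚ.^-monoʳ-≤ p (ℕₚ.≤-trans (ℕₚ.m≤n*m n b) (ℕₚ.m≤m+n (b * n) c))))
    where
    search : ∀ k → n < p ^ (b * k + c) → ∃ λ v → p ^ (b * v + c) ≤ n × n < p ^ (b * suc v + c)
    search zero    lt = contradiction (subst (λ z → n < p ^ (z + c)) (ℕₚ.*-zeroʳ b) lt) (ℕₚ.≤⇒≯ c≤n)
    search (suc k) lt with n ℕ.<? p ^ (b * k + c)
    ... | yes lt′ = search k lt′
    ... | no ¬lt  = k , ℕₚ.≮⇒≥ ¬lt , lt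

  module _ (ℝ : CompleteOrderedField) where

    -- The case v = 0 is the trivial configuration of parallel hyperplanes.
    arranged : ∀ n m → 0 < n → 0 < m → ∃ λ u → ∃ λ v → p ^ (A * S * u) ≤ n × m < p ^ (E * suc v + (R * suc u + 1)) ×
      Realisation.Arranged ℝ D n m R (n * p ^ (β * S * v))
    arranged n m 0<n 0<m = u , goal (p ^ (R * suc u + 1) ℕ.≤? m)
      where
      instance
        S≢0 : NonZero S
        S≢0 = ℕₚ.m*n≢0 σ δ {{ℕ.>-nonZero (ℕₚ.≤-trans (s≤s z≤n) σ≥2)}}
        AS≢0 : NonZero (A * S)
        AS≢0 = ℕₚ.m*n≢0 A S
        E≢0 : NonZero E
        E≢0 = ℕ.>-nonZero (ℕₚ.≤-trans (ℕ.>-nonZero⁻¹ (R * D) {{ℕₚ.m*n≢0 R D}}) (ℕₚ.m≤n+m (R * D) (β * S)))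
      br = bracket (A * S) 0 n 0<n
      u : ℕ
      u = proj₁ br
      lower : p ^ (A * S * u) ≤ n
      lower = subst (λ z → p ^ z ≤ n) (ℕₚ.+-identityʳ (A * S * u)) (proj₁ (proj₂ br))
      upper : n < p ^ (A * S * suc u)
      upper = subst (λ z → n < p ^ z) (ℕₚ.+-identityʳ (A * S * suc u)) (proj₂ (proj₂ br))
      trivial : m < p ^ (E * 1 + (R * suc u + 1)) → ∃ λ v → p ^ (A * S * u) ≤ n × m < p ^ (E * suc v + (R * suc u + 1)) ×
        Realisation.Arranged ℝ D n m R (n * p ^ (β * S * v))
      trivial lt = 0 , lower , lt , subst (Realisation.Arranged ℝ D n m R)
        (sym (trans (cong (λ z → n * p ^ z) (ℕₚ.*-zeroʳ (β * S))) (ℕₚ.*-identityʳ n))) (parallel ℝ n m 1<R 0<m)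
      goal : Dec (p ^ (R * suc u + 1) ≤ m) → ∃ λ v → p ^ (A * S * u) ≤ n × m < p ^ (E * suc v + (R * suc u + 1)) ×
        Realisation.Arranged ℝ D n m R (n * p ^ (β * S * v))
      goal (no ¬le) = trivial (ℕₚ.<-≤-trans (ℕₚ.≰⇒> ¬le) (ℕₚ.^-monoʳ-≤ p (ℕₚ.m≤n+m (R * suc u + 1) (E * 1))))
      goal (yes le) with bracket E (R * suc u + 1) m le
      ... | zero   , _ , lt = trivial lt
      -- The grid belongs to u + 1, so more than n points are at hand, and n of them are kept.
      ... | suc v′ , ge , lt = suc v′ , lower , lt ,
        fromConfiguration ℝ n m (config u v′) (ℕₚ.<-trans (s≤s z≤n) 1<R) (ℕₚ.m^n>0 p (β * S * suc v′)) (ℕₚ.<⇒≤ upper)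
          (ℕₚ.≤-trans enough ge)
        where
        open ℕₚ.≤-Reasoning
        v = suc v′
        M N : ℕ
        M = (p ^ (R * v)) ^ D
        N = p ^ (R * suc u)
        -- The summand 1 in the exponent supplies a factor p, which pays for 2 d + 1 ≤ p.
        enough : (2 * (d * (M * N)) + 1) * p ^ (β * S * v) ≤ p ^ (E * v + (R * suc u + 1))
        enough = begin
          (2 * (d * (M * N)) + 1) * p ^ (β * S * v)
            ≤⟨ ℕₚ.*-monoˡ-≤ (p ^ (β * S * v)) (ℕₚ.+-monoʳ-≤ (2 * (d * (M * N))) (ℕ.>-nonZero⁻¹ (M * N) {{ℕₚ.m*n≢0 M N {{ℕₚ.m^n≢0 (p ^ (R * v)) D {{ℕₚ.m^n≢0 p (R * v)}}}} {{ℕₚ.m^n≢0 p (R * suc u)}}}})) ⟩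
          (2 * (d * (M * N)) + M * N) * p ^ (β * S * v)
            ≡⟨ cong (_* p ^ (β * S * v)) (collect d (M * N)) ⟩
          (suc (2 * d) * (M * N)) * p ^ (β * S * v)
            ≤⟨ ℕₚ.*-monoˡ-≤ (p ^ (β * S * v)) (ℕₚ.*-monoˡ-≤ (M * N) 2d<p) ⟩
          (p * (M * N)) * p ^ (β * S * v)
            ≡⟨ cong (λ z → (p * (z * N)) * p ^ (β * S * v)) (ℕₚ.^-*-assoc p (R * v) D) ⟩
          (p * (p ^ (R * v * D) * N)) * p ^ (β * S * v)
            ≡⟨ cong (λ z → p * z * p ^ (β * S * v)) (sym (ℕₚ.^-distribˡ-+-* p (R * v * D) (R * suc u))) ⟩
          p ^ suc (R * v * D + R * suc u) * p ^ (β * S * v)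
            ≡⟨ ℕₚ.^-distribˡ-+-* p (suc (R * v * D + R * suc u)) (β * S * v) ⟨
          p ^ (suc (R * v * D + R * suc u) + β * S * v)
            ≡⟨ cong (p ^_) (exponents (β * S) R D v (R * suc u)) ⟩
          p ^ (E * v + (R * suc u + 1)) ∎
          where
          collect : ∀ d x → 2 * (d * x) + x ≡ suc (2 * d) * x
          collect = ℕ-solve-∀
          exponents : ∀ b R D v r → suc (R * v * D + r) + b * v ≡ (b + R * D) * v + (r + 1)
          exponents = ℕ-solve-∀

  -- Eliminating u and v from n ≈ p^(A S u), m ≈ p^(E v + R u) and I = n p^(β S v) gives I ≈ n^(1 -
  -- h/G′) m^(q′/G′), and G′ clears the denominators. `K` collects the losses from rounding u and v
  -- and the additional factor p.
  G′ q′ h K : ℕ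
  G′ = A * S * E
  q′ = A * S * (β * S)
  h = R * (β * S)
  K = p ^ (E + (R + 1))

  count-bound : ∀ n m u v I → p ^ (A * S * u) ≤ n → m < p ^ (E * suc v + (R * suc u + 1)) → n * p ^ (β * S * v) ≤ I →
    n ^ G′ * m ^ q′ ≤ (K * I) ^ G′ * n ^ h
  count-bound n m u v I n≥ m< I≥ = begin
    n ^ G′ * m ^ q′
      ≤⟨ ℕₚ.*-monoʳ-≤ (n ^ G′) (ℕₚ.^-monoˡ-≤ q′ (ℕₚ.<⇒≤ m<)) ⟩
    n ^ G′ * (p ^ (E * suc v + (R * suc u + 1))) ^ q′
      ≡⟨ cong (n ^ G′ *_) (ℕₚ.^-*-assoc p (E * suc v + (R * suc u + 1)) q′) ⟩
    n ^ G′ * p ^ ((E * suc v + (R * suc u + 1)) * q′)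
      ≡⟨ cong (λ z → n ^ G′ * p ^ z) (exponents (A * S) (β * S) E R u v) ⟩
    n ^ G′ * p ^ ((E + (R + 1)) * q′ + (β * S * v * G′ + A * S * u * h))
      ≤⟨ ℕₚ.*-monoʳ-≤ (n ^ G′) (ℕₚ.^-monoʳ-≤ p (ℕₚ.+-monoˡ-≤ _ (ℕₚ.*-monoʳ-≤ (E + (R + 1)) q′≤G′))) ⟩
    n ^ G′ * p ^ ((E + (R + 1)) * G′ + (β * S * v * G′ + A * S * u * h))
      ≡⟨ cong (n ^ G′ *_) (trans (ℕₚ.^-distribˡ-+-* p ((E + (R + 1)) * G′) _) (cong₂ _*_ (sym (ℕₚ.^-*-assoc p (E + (R + 1)) G′))
          (trans (ℕₚ.^-distribˡ-+-* p (β * S * v * G′) _) (cong₂ _*_ (sym (ℕₚ.^-*-assoc p (β * S * v) G′)) (sym (ℕₚ.^-*-assoc p (A * S * u) h)))))) ⟩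
    n ^ G′ * (K ^ G′ * ((p ^ (β * S * v)) ^ G′ * (p ^ (A * S * u)) ^ h))
      ≡⟨ regroup (n ^ G′) (K ^ G′) ((p ^ (β * S * v)) ^ G′) _ ⟩
    K ^ G′ * (n ^ G′ * (p ^ (β * S * v)) ^ G′) * (p ^ (A * S * u)) ^ h
      ≡⟨ cong (λ z → K ^ G′ * z * (p ^ (A * S * u)) ^ h) (^-distrib-* G′ n (p ^ (β * S * v))) ⟨
    K ^ G′ * (n * p ^ (β * S * v)) ^ G′ * (p ^ (A * S * u)) ^ h
      ≤⟨ ℕₚ.*-mono-≤ (ℕₚ.*-monoʳ-≤ (K ^ G′) (ℕₚ.^-monoˡ-≤ G′ I≥)) (ℕₚ.^-monoˡ-≤ h n≥) ⟩
    K ^ G′ * I ^ G′ * n ^ h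
      ≡⟨ cong (_* n ^ h) (^-distrib-* G′ K I) ⟨
    (K * I) ^ G′ * n ^ h ∎
    where
    open ℕₚ.≤-Reasoning
    q′≤G′ : q′ ≤ G′
    q′≤G′ = ℕₚ.*-monoʳ-≤ (A * S) (ℕₚ.m≤m+n (β * S) (R * D))
    exponents : ∀ a b E R u v → (E * suc v + (R * suc u + 1)) * (a * b) ≡ (E + (R + 1)) * (a * b) + (b * v * (a * E) + a * u * (R * b))
    exponents = ℕ-solve-∀
    regroup : ∀ a b c d → a * (b * (c * d)) ≡ b * (a * c) * d
    regroup = ℕ-solve-∀

-- Since m ≤ n, powers of m beyond m^Q can be traded for powers of n. The two conditions on
-- exponents are the extreme cases m = 1 and m = n.
^-mixed : ∀ n m a b P Q .{{_ : NonZero n}} .{{_ : NonZero m}} → m ≤ n → a + b ≤ P → 2 * a + b ≤ P + Q →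
  (m * n) ^ a * n ^ b ≤ n ^ P * m ^ Q
^-mixed n m a b P Q m≤n a+b≤P 2a+b≤ = by (ℕₚ.≤-total a Q)
  where
  open ℕₚ.≤-Reasoning
  by : a ≤ Q ⊎ Q ≤ a → (m * n) ^ a * n ^ b ≤ n ^ P * m ^ Q
  by (inj₁ a≤Q) = begin
    (m * n) ^ a * n ^ b        ≡⟨ cong (_* n ^ b) (^-distrib-* a m n) ⟩
    m ^ a * n ^ a * n ^ b      ≡⟨ ℕₚ.*-assoc (m ^ a) _ _ ⟩
    m ^ a * (n ^ a * n ^ b)    ≡⟨ cong (m ^ a *_) (ℕₚ.^-distribˡ-+-* n a b) ⟨
    m ^ a * n ^ (a + b)        ≤⟨ ℕₚ.*-mono-≤ (ℕₚ.^-monoʳ-≤ m a≤Q) (ℕₚ.^-monoʳ-≤ n a+b≤P) ⟩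
    m ^ Q * n ^ P              ≡⟨ ℕₚ.*-comm (m ^ Q) _ ⟩
    n ^ P * m ^ Q              ∎
  by (inj₂ Q≤a) = begin
    (m * n) ^ a * n ^ b              ≡⟨ cong (_* n ^ b) (^-distrib-* a m n) ⟩
    m ^ a * n ^ a * n ^ b            ≡⟨ cong (λ z → m ^ z * n ^ a * n ^ b) (ℕₚ.m+[n∸m]≡n Q≤a) ⟨
    m ^ (Q + y) * n ^ a * n ^ b      ≡⟨ cong (λ z → z * n ^ a * n ^ b) (ℕₚ.^-distribˡ-+-* m Q y) ⟩
    m ^ Q * m ^ y * n ^ a * n ^ b    ≤⟨ ℕₚ.*-monoˡ-≤ (n ^ b) (ℕₚ.*-monoˡ-≤ (n ^ a) (ℕₚ.*-monoʳ-≤ (m ^ Q) (ℕₚ.^-monoˡ-≤ y m≤n))) ⟩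
    m ^ Q * n ^ y * n ^ a * n ^ b    ≡⟨ regroup (m ^ Q) (n ^ y) (n ^ a) (n ^ b) ⟩
    n ^ y * n ^ a * n ^ b * m ^ Q    ≡⟨ cong (_* m ^ Q) (trans (cong (_* n ^ b) (sym (ℕₚ.^-distribˡ-+-* n y a))) (sym (ℕₚ.^-distribˡ-+-* n (y + a) b))) ⟩
    n ^ (y + a + b) * m ^ Q          ≤⟨ ℕₚ.*-monoˡ-≤ (m ^ Q) (ℕₚ.^-monoʳ-≤ n small) ⟩
    n ^ P * m ^ Q                    ∎
    where
    y = a ∸ Q
    regroup : ∀ w x y z → w * x * y * z ≡ x * y * z * w
    regroup = ℕ-solve-∀
    small : y + a + b ≤ P
    small = ℕₚ.+-cancelʳ-≤ Q _ _ (subst (_≤ P + Q) (trans (cong (λ z → z + (a + 0) + b) (sym (ℕₚ.m∸n+n≡m Q≤a))) (shift y Q a b)) 2a+b≤)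
      where
      shift : ∀ y Q a b → y + Q + (a + 0) + b ≡ y + a + b + Q
      shift = ℕ-solve-∀

^-cancelˡ-≤ : ∀ g .{{_ : NonZero g}} {x y} → x ^ g ≤ y ^ g → x ≤ y
^-cancelˡ-≤ g {x} {y} le with x ℕ.≤? y
... | yes x≤y = x≤y
... | no x≰y = contradiction le (ℕₚ.<⇒≱ (ℕₚ.^-monoˡ-< g (ℕₚ.≰⇒> x≰y)))

-- Divided by 2 A F δ · den, the hypothesis is k / den ≤ 1 − (A D + β) / (2 A F) − 1 / δ, and the conclusion bounds k / den
-- by the exponent that the parameters S = σ δ and R = S + σ achieve for n = m.
exponent-loss : ∀ A′ D β δ k den .{{_ : NonZero D}} .{{_ : NonZero δ}} → let A = suc A′ ; F = D + β in
  k * (2 * A * F * δ) + den * ((A * D + β) * δ + 2 * A * F) ≤ den * (2 * A * F * δ) →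
  2 * (k * (A * (F * δ + D))) + den * (suc δ * β) ≤ den * (A * (F * δ + D) + A * β * δ)
exponent-loss A′ D β δ k den hyp = ℕₚ.*-cancelˡ-≤ (F * δ) {{ℕₚ.m*n≢0 F δ {{ℕ.>-nonZero (ℕₚ.≤-trans (ℕ.>-nonZero⁻¹ D) (ℕₚ.m≤m+n D β))}}}}
  (ℕₚ.+-cancelʳ-≤ (den * b * W) _ _ (begin
    F * δ * (2 * (k * (A * W)) + den * (suc δ * β)) + den * b * W
      ≡⟨ regroup F δ k A W den β b ⟩
    (k * (2 * A * F * δ) + den * b) * W + den * (F * δ * (suc δ * β))
      ≤⟨ ℕₚ.+-monoˡ-≤ _ (ℕₚ.*-monoˡ-≤ W hyp) ⟩
    den * (2 * A * F * δ) * W + den * (F * δ * (suc δ * β))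
      ≡⟨ factor den (2 * A * F * δ) W (F * δ * (suc δ * β)) ⟩
    den * (2 * A * F * δ * W + F * δ * (suc δ * β))
      ≤⟨ ℕₚ.*-monoʳ-≤ den (ℕₚ.m≤m+n _ slack) ⟩
    den * (2 * A * F * δ * W + F * δ * (suc δ * β) + slack)
      ≡⟨ cong (den *_) (identity A′ D β δ) ⟩
    den * (F * δ * (A * W + A * β * δ) + b * W)
      ≡⟨ distribute den (F * δ) (A * W + A * β * δ) b W ⟩
    F * δ * (den * (A * W + A * β * δ)) + den * b * W ∎))
  where
  open ℕₚ.≤-Reasoning
  A F W b slack : ℕ
  A = suc A′
  F = D + β
  W = F * δ + D
  b = (A * D + β) * δ + 2 * A * F
  -- The exact excess left after the hypothesis has been used with factor W. Writing A = A′ + 1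
  -- turns 2 A - 1 into 2 A′ + 1, so all terms are visibly nonnegative.
  slack = δ * (2 * A * D * D + 3 * A * D * β + (2 * A′ + 1) * β * β) + 2 * A * F * D
  regroup : ∀ F δ k A W den β b → F * δ * (2 * (k * (A * W)) + den * (suc δ * β)) + den * b * W ≡
    (k * (2 * A * F * δ) + den * b) * W + den * (F * δ * (suc δ * β))
  regroup = ℕ-solve-∀
  factor : ∀ d x W y → d * x * W + d * y ≡ d * (x * W + y)
  factor = ℕ-solve-∀
  identity : ∀ A′ D β δ →
    2 * suc A′ * (D + β) * δ * ((D + β) * δ + D) + (D + β) * δ * (suc δ * β)
      + (δ * (2 * suc A′ * D * D + 3 * suc A′ * D * β + (2 * A′ + 1) * β * β) + 2 * suc A′ * (D + β) * D)
    ≡ (D + β) * δ * (suc A′ * ((D + β) * δ + D) + suc A′ * β * δ) + ((suc A′ * D + β) * δ + 2 * suc A′ * (D + β)) * ((D + β) * δ + D)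
  identity = ℕ-solve-∀
  distribute : ∀ d x y b W → d * (x * y + b * W) ≡ x * (d * y) + d * b * W
  distribute = ℕ-solve-∀

module _ (s₁ s₂ δ : ℕ) .{{δ≢0 : NonZero δ}} (p : ℕ) (p-prime : Prime p)
  (8^D<p : 8 ^ suc (s₁ + s₂) < p) (2d<p : 2 * suc (suc (s₁ + s₂)) < p) where

  open Construction s₁ s₂ δ p p-prime 8^D<p 2d<p

  -- Raised to the power G′ and multiplied by n^(den h), the claim follows from `count-bound` and a
  -- comparison of exponents: `double` is the condition at m = n, `single` the one at m = 1.
  power-bound : β ≤ A * D → ∀ k den → let F = D + β in
    k * (2 * A * F * δ) + den * ((A * D + β) * δ + 2 * A * F) ≤ den * (2 * A * F * δ) →
    ∀ n m u v I → 0 < n → 0 < m → m ≤ n →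
    p ^ (A * S * u) ≤ n → m < p ^ (E * suc v + (R * suc u + 1)) → n * p ^ (β * S * v) ≤ I →
    (m * n) ^ k ≤ (K * I) ^ den
  power-bound β≤AD k den hyp n m u v I 0<n 0<m m≤n n≥ m< I≥ = ^-cancelˡ-≤ G′ {{ℕ.>-nonZero 0<G′}}
    (ℕₚ.*-cancelʳ-≤ _ _ (n ^ (den * h)) {{ℕₚ.m^n≢0 n (den * h)}} (begin
      ((m * n) ^ k) ^ G′ * n ^ (den * h)       ≡⟨ cong (_* n ^ (den * h)) (ℕₚ.^-*-assoc (m * n) k G′) ⟩
      (m * n) ^ (k * G′) * n ^ (den * h)       ≤⟨ ^-mixed n m (k * G′) (den * h) (den * G′) (den * q′) m≤n single double ⟩
      n ^ (den * G′) * m ^ (den * q′)          ≡⟨ collect n G′ m q′ ⟩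
      (n ^ G′ * m ^ q′) ^ den                  ≤⟨ ℕₚ.^-monoˡ-≤ den (count-bound n m u v I n≥ m< I≥) ⟩
      ((K * I) ^ G′ * n ^ h) ^ den             ≡⟨ collect (K * I) G′ n h ⟨
      (K * I) ^ (den * G′) * n ^ (den * h)     ≡⟨ cong (_* n ^ (den * h)) (ℕₚ.^-*-assoc (K * I) den G′) ⟨
      ((K * I) ^ den) ^ G′ * n ^ (den * h)     ∎))
    where
    open ℕₚ.≤-Reasoning
    instance
      n≢0 : NonZero n
      n≢0 = ℕ.>-nonZero 0<n
      m≢0 : NonZero m
      m≢0 = ℕ.>-nonZero 0<m
    0<σ : 0 < σ
    0<σ = ℕₚ.≤-trans (ℕₚ.≤-trans (s≤s z≤n) (ℕₚ.m≤n+m 2 (D * suc s₂))) (ℕₚ.m≤m+n (D * suc s₂ + 2) β)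
    0<S : 0 < S
    0<S = ℕₚ.*-mono-≤ 0<σ (ℕ.>-nonZero⁻¹ δ)
    0<E : 0 < E
    0<E = ℕₚ.≤-trans (ℕₚ.*-mono-≤ (ℕₚ.<-trans (s≤s z≤n) 1<R) (s≤s z≤n)) (ℕₚ.m≤n+m (R * D) (β * S))
    0<G′ : 0 < G′
    0<G′ = ℕₚ.*-mono-≤ (ℕₚ.*-mono-≤ {1} {A} (s≤s z≤n) 0<S) 0<E
    collect : ∀ x a y b → x ^ (den * a) * y ^ (den * b) ≡ (x ^ a * y ^ b) ^ den
    collect x a y b = trans (cong₂ _*_ (trans (cong (x ^_) (ℕₚ.*-comm den a)) (sym (ℕₚ.^-*-assoc x a den)))
      (trans (cong (y ^_) (ℕₚ.*-comm den b)) (sym (ℕₚ.^-*-assoc y b den)))) (sym (^-distrib-* den (x ^ a) (y ^ b)))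
    double : 2 * (k * G′) + den * h ≤ den * G′ + den * q′
    double = subst₂ _≤_ (left A D β σ δ k den) (right A D β σ δ den)
      (ℕₚ.*-monoʳ-≤ (σ * σ * δ) (exponent-loss (suc s₂) D β δ k den hyp))
      where
      left : ∀ A D β σ δ k den → σ * σ * δ * (2 * (k * (A * ((D + β) * δ + D))) + den * (suc δ * β)) ≡
        2 * (k * (A * (σ * δ) * (β * (σ * δ) + (σ * δ + σ) * D))) + den * ((σ * δ + σ) * (β * (σ * δ)))
      left = ℕ-solve-∀
      right : ∀ A D β σ δ den → σ * σ * δ * (den * (A * ((D + β) * δ + D) + A * β * δ)) ≡
        den * (A * (σ * δ) * (β * (σ * δ) + (σ * δ + σ) * D)) + den * (A * (σ * δ) * (β * (σ * δ)))
      right = ℕ-solve-∀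
    -- Equivalent to β ≤ A D: in n^(1 - h/G′) m^(q′/G′) the exponent of n is at least that of m, so
    -- n = m is the worst case.
    h+q′≤G′ : h + q′ ≤ G′
    h+q′≤G′ = subst₂ _≤_ (left R S β A) (right R S β A D) (ℕₚ.+-monoˡ-≤ (A * S * (β * S)) (ℕₚ.*-monoʳ-≤ (R * S) β≤AD))
      where
      left : ∀ R S β A → R * S * β + A * S * (β * S) ≡ R * (β * S) + A * S * (β * S)
      left = ℕ-solve-∀
      right : ∀ R S β A D → R * S * (A * D) + A * S * (β * S) ≡ A * S * (β * S + R * D)
      right = ℕ-solve-∀
    single : k * G′ + den * h ≤ den * G′
    single = ℕₚ.*-cancelˡ-≤ 2 (begin
      2 * (k * G′ + den * h)                ≡⟨ regroup (k * G′) (den * h) ⟩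
      2 * (k * G′) + den * h + den * h      ≤⟨ ℕₚ.+-monoˡ-≤ (den * h) double ⟩
      den * G′ + den * q′ + den * h         ≡⟨ regroup′ den G′ q′ h ⟩
      den * G′ + den * (h + q′)             ≤⟨ ℕₚ.+-monoʳ-≤ (den * G′) (ℕₚ.*-monoʳ-≤ den h+q′≤G′) ⟩
      den * G′ + den * G′                   ≡⟨ cong (λ z → den * G′ + z) (ℕₚ.+-identityʳ (den * G′)) ⟨
      2 * (den * G′)                        ∎)
      where
      regroup : ∀ a b → 2 * (a + b) ≡ 2 * a + b + b
      regroup = ℕ-solve-∀
      regroup′ : ∀ d a b c → d * a + d * b + d * c ≡ d * a + d * (c + b)
      regroup′ = ℕ-solve-∀

  incidence-bound : (ℝ : CompleteOrderedField) → β ≤ A * D → ∀ k den → let F = D + β in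
    k * (2 * A * F * δ) + den * ((A * D + β) * δ + 2 * A * F) ≤ den * (2 * A * F * δ) →
    ∀ n m → 0 < n → 0 < m → ∃ λ I → Realisation.Arranged ℝ D n m R I × 0 < I × (m * n) ^ k ≤ (K * I) ^ den
  incidence-bound ℝ β≤AD k den hyp n m 0<n 0<m = by (ℕₚ.≤-total m n)
    where
    0<pow : ∀ n v → 0 < n → 0 < n * p ^ (β * S * v)
    0<pow n v 0<n = ℕₚ.*-mono-≤ 0<n (ℕₚ.m^n>0 p {{ℕ.>-nonZero (ℕₚ.<-trans (s≤s z≤n) (1<p p p-prime))}} (β * S * v))
    by : m ≤ n ⊎ n ≤ m → ∃ λ I → Realisation.Arranged ℝ D n m R I × 0 < I × (m * n) ^ k ≤ (K * I) ^ den
    by (inj₁ m≤n) with arranged ℝ n m 0<n 0<m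
    ... | u , v , n≥ , m< , arr = n * p ^ (β * S * v) , arr , 0<pow n v 0<n ,
      power-bound β≤AD k den hyp n m u v _ 0<n 0<m m≤n n≥ m< ℕₚ.≤-refl
    by (inj₂ n≤m) with arranged ℝ m n 0<m 0<n
    ... | u , v , m≥ , n< , arr = m * p ^ (β * S * v) , Realisation.dual ℝ D arr , 0<pow m v 0<m ,
      subst (λ z → z ^ k ≤ (K * (m * p ^ (β * S * v))) ^ den) (ℕₚ.*-comm n m)
        (power-bound β≤AD k den hyp m n u v _ 0<m 0<n n≤m m≥ n< ℕₚ.≤-refl)

-- From natural numbers to the rational exponent

module ℚSolver = +-*-Solver

-- Euclid's argument with a prime factor of c! + 1.
prime-above : ∀ c → ∃ λ p → Prime p × c < p
prime-above c with factorise (suc (c !))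
... | record { factors = [] ; isFactorisation = eq } = contradiction (ℕₚ.suc-injective eq) (ℕₚ.<⇒≢ (ℕₚ.1≤n! c) ∘ sym)
... | record { factors = q ∷ qs ; isFactorisation = eq ; factorsPrime = q-prime ∷ _ } = q , q-prime , ℕₚ.≰⇒> q≰c
  where
  q∣1+c! : q ℕ∣.∣ suc (c !)
  q∣1+c! = subst (q ℕ∣.∣_) (sym eq) (ℕ∣.m∣m*n _)
  q∣q! : ∀ q → Prime q → q ℕ∣.∣ q !
  q∣q! zero    q-prime = contradiction q-prime Prime.¬prime[0]
  q∣q! (suc q) _       = ℕ∣.m∣m*n (q !)
  q≰c : ¬ q ≤ c
  q≰c q≤c with ℕ∣.∣1⇒≡1 (ℕ∣.∣m+n∣m⇒∣n (subst (q ℕ∣.∣_) (ℕₚ.+-comm 1 (c !)) q∣1+c!) (ℕ∣.∣-trans (q∣q! q q-prime) (ℕ∣.m≤n⇒m!∣n! q≤c)))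
  ... | refl = Prime.¬prime[1] q-prime

toℚ : ℕ → ℚ
toℚ n = + n ℚ./ 1

toℚᵘ-/ : ∀ n d → ℚ.toℚᵘ (+ n ℚ./ suc d) ℚᵘ.≃ ℚᵘ.mkℚᵘ (+ n) d
toℚᵘ-/ n d = ℚₚ.toℚᵘ-fromℚᵘ (ℚᵘ.mkℚᵘ (+ n) d)

toℚ-* : ∀ m n → toℚ (m * n) ≡ toℚ m ℚ.* toℚ n
toℚ-* m n = ℚₚ.toℚᵘ-injective (ℚᵘₚ.≃-trans (toℚᵘ-/ (m * n) 0) (ℚᵘₚ.≃-trans
  (ℚᵘ.*≡* (cong (ℤ._* 1ℤ) (ℤₚ.pos-* m n)))
  (ℚᵘₚ.≃-sym (ℚᵘₚ.≃-trans (ℚₚ.toℚᵘ-homo-* (toℚ m) (toℚ n)) (ℚᵘₚ.*-cong (toℚᵘ-/ m 0) (toℚᵘ-/ n 0))))))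

toℚ-^ : ∀ m k → toℚ (m ^ k) ≡ toℚ m ^ℚ k
toℚ-^ m zero    = refl
toℚ-^ m (suc k) = trans (toℚ-* m (m ^ k)) (cong (toℚ m ℚ.*_) (toℚ-^ m k))

toℚ-mono : ∀ {m n} → m ≤ n → toℚ m ℚ.≤ toℚ n
toℚ-mono {m} {n} m≤n = ℚₚ.toℚᵘ-cancel-≤ (ℚᵘₚ.≤-respˡ-≃ (ℚᵘₚ.≃-sym (toℚᵘ-/ m 0)) (ℚᵘₚ.≤-respʳ-≃ (ℚᵘₚ.≃-sym (toℚᵘ-/ n 0))
  (ℚᵘ.*≤* (ℤₚ.*-monoʳ-≤-nonNeg 1ℤ (ℤ.+≤+ m≤n)))))

recip : (K : ℕ) .{{_ : NonZero K}} → ℚ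
recip K = + 1 ℚ./ K

recip-inverse : ∀ K .{{_ : NonZero K}} → recip K ℚ.* toℚ K ≡ 1ℚ
recip-inverse (suc K) = ℚₚ.toℚᵘ-injective (ℚᵘₚ.≃-trans (ℚₚ.toℚᵘ-homo-* (recip (suc K)) (toℚ (suc K)))
  (ℚᵘₚ.≃-trans (ℚᵘₚ.*-cong (toℚᵘ-/ 1 K) (toℚᵘ-/ (suc K) 0)) (ℚᵘ.*≡* (identity (+ suc K)))))
  where
  identity : ∀ k → 1ℤ ℤ.* k ℤ.* 1ℤ ≡ 1ℤ ℤ.* (k ℤ.* 1ℤ)
  identity = ℤ-solve-∀

recip-positive : ∀ K .{{_ : NonZero K}} → ℚ.Positive (recip K)
recip-positive K = ℚₚ.normalize-pos 1 K

^ℚ-distrib-* : ∀ k x y → (x ℚ.* y) ^ℚ k ≡ x ^ℚ k ℚ.* y ^ℚ k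
^ℚ-distrib-* zero    x y = refl
^ℚ-distrib-* (suc k) x y = trans (cong (x ℚ.* y ℚ.*_) (^ℚ-distrib-* k x y)) (ℚSolver.solve 4
  (λ x y a b → x ℚSolver.:* y ℚSolver.:* (a ℚSolver.:* b) ℚSolver.:= x ℚSolver.:* a ℚSolver.:* (y ℚSolver.:* b)) refl x y (x ^ℚ k) (y ^ℚ k))

1^ℚ : ∀ k → 1ℚ ^ℚ k ≡ 1ℚ
1^ℚ zero    = refl
1^ℚ (suc k) = trans (ℚₚ.*-identityˡ _) (1^ℚ k)

^ℚ-nonNeg : ∀ x k → .{{ℚ.NonNegative x}} → ℚ.NonNegative (x ^ℚ k)
^ℚ-nonNeg x zero    = _
^ℚ-nonNeg x (suc k) = ℚₚ.nonNeg*nonNeg⇒nonNeg x (x ^ℚ k) {{^ℚ-nonNeg x k}}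

recip-^-bound : ∀ K .{{_ : NonZero K}} e a b → a ≤ K ^ e * b → recip K ^ℚ e ℚ.* toℚ a ℚ.≤ toℚ b
recip-^-bound K e a b a≤ = begin
  c ^ℚ e ℚ.* toℚ a                      ≤⟨ ℚₚ.*-monoˡ-≤-nonNeg (c ^ℚ e) {{^ℚ-nonNeg c e {{ℚₚ.pos⇒nonNeg c {{recip-positive K}}}}}} (toℚ-mono a≤) ⟩
  c ^ℚ e ℚ.* toℚ (K ^ e * b)            ≡⟨ cong (c ^ℚ e ℚ.*_) (trans (toℚ-* (K ^ e) b) (cong (ℚ._* toℚ b) (toℚ-^ K e))) ⟩
  c ^ℚ e ℚ.* (toℚ K ^ℚ e ℚ.* toℚ b)     ≡⟨ ℚₚ.*-assoc (c ^ℚ e) (toℚ K ^ℚ e) (toℚ b) ⟨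
  c ^ℚ e ℚ.* toℚ K ^ℚ e ℚ.* toℚ b       ≡⟨ cong (ℚ._* toℚ b) (trans (sym (^ℚ-distrib-* e c (toℚ K))) (trans (cong (_^ℚ e) (recip-inverse K)) (1^ℚ e))) ⟩
  1ℚ ℚ.* toℚ b                          ≡⟨ ℚₚ.*-identityˡ (toℚ b) ⟩
  toℚ b                                 ∎
  where
  open ℚₚ.≤-Reasoning
  c = recip K

PowGe-pos : ∀ I K .{{_ : NonZero K}} e y k → ↥ e ≡ + k → y ^ k ≤ (K * I) ^ ↧ₙ e → PowGe I (recip K) e y
PowGe-pos I K e y k eq le with ↥ e | eq
... | .(+ k) | refl = subst₂ ℚ._≤_ (cong (recip K ^ℚ (↧ₙ e) ℚ.*_) (toℚ-^ y k)) (toℚ-^ I (↧ₙ e))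
  (recip-^-bound K (↧ₙ e) (y ^ k) (I ^ ↧ₙ e) (subst (y ^ k ≤_) (^-distrib-* (↧ₙ e) K I) le))

-- For a negative exponent a single incidence suffices, as 1/K ≤ 1.
PowGe-neg : ∀ I K .{{_ : NonZero K}} e y k → ↥ e ≡ -[1+ k ] → 0 < I → 0 < y → PowGe I (recip K) e y
PowGe-neg I K e y k eq 0<I 0<y with ↥ e | eq
... | .(-[1+ k ]) | refl = subst₂ ℚ._≤_ (ℚₚ.*-identityʳ (recip K ^ℚ (↧ₙ e)))
  (trans (toℚ-* (I ^ ↧ₙ e) (y ^ suc k)) (cong₂ ℚ._*_ (toℚ-^ I (↧ₙ e)) (toℚ-^ y (suc k))))
  (recip-^-bound K (↧ₙ e) 1 (I ^ ↧ₙ e * y ^ suc k) (ℕₚ.*-mono-≤ (ℕₚ.m^n>0 K (↧ₙ e))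
    (ℕₚ.*-mono-≤ (ℕₚ.m^n>0 I {{ℕ.>-nonZero 0<I}} (↧ₙ e)) (ℕₚ.m^n>0 y {{ℕ.>-nonZero 0<y}} (suc k)))))

-- This is e + ε + X/Y = 1 cleared of denominators and weakened by ε ≥ 1/δ with δ = `↧ₙ ε`: of the
-- numerator n + 1 of ε only 1 is kept. Thus δ can stand for ε in the construction.
exponent-numerators : ∀ e ε X Y .{{_ : NonZero Y}} k → e ≡ 1ℚ ℚ.- (X ÷ℕ Y) ℚ.- ε → 0ℚ ℚ.< ε → ↥ e ≡ + k →
  k * (Y * ↧ₙ ε) + ↧ₙ e * (X * ↧ₙ ε + Y) ≤ ↧ₙ e * (Y * ↧ₙ ε)
exponent-numerators e@(ℚ.mkℚ .(+ k) d _) ε@(ℚ.mkℚ -[1+ n ] δ _) X Y k e≡ (ℚ.*<* ()) refl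
exponent-numerators e@(ℚ.mkℚ .(+ k) d _) ε@(ℚ.mkℚ (+ zero) δ _) X Y k e≡ (ℚ.*<* (ℤ.+<+ ())) refl
exponent-numerators e@(ℚ.mkℚ .(+ k) d _) ε@(ℚ.mkℚ (+ suc n) δ _) X (suc y) k e≡ 0<ε refl =
  ℕₚ.+-cancelʳ-≤ (n * d′ * Y) _ _ (ℕₚ.≤-trans (ℕₚ.≤-reflexive (trans (regroup k δ′ n d′ Y X) (trans numerators (reassociate d′ δ′ Y)))) (ℕₚ.m≤m+n _ _))
  where
  d′ = suc d
  δ′ = suc δ
  Y = suc y
  x = X ÷ℕ Y
  undo : ∀ a b → a ℚ.- b ℚ.+ b ≡ a
  undo a b = trans (ℚₚ.+-assoc a (ℚ.- b) b) (trans (cong (λ z → a ℚ.+ z) (ℚₚ.+-inverseˡ b)) (ℚₚ.+-identityʳ a))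
  sum≡1 : e ℚ.+ ε ℚ.+ x ≡ 1ℚ
  sum≡1 = trans (cong (ℚ._+ x) (trans (cong (ℚ._+ ε) e≡) (undo (1ℚ ℚ.- x) ε))) (undo 1ℚ x)
  sum≃1 : ℚᵘ.mkℚᵘ (+ k) d ℚᵘ.+ ℚᵘ.mkℚᵘ (+ suc n) δ ℚᵘ.+ ℚᵘ.mkℚᵘ (+ X) y ℚᵘ.≃ ℚᵘ.mkℚᵘ 1ℤ 0
  sum≃1 = ℚᵘₚ.≃-trans (ℚᵘₚ.≃-sym (ℚᵘₚ.≃-trans (ℚₚ.toℚᵘ-homo-+ (e ℚ.+ ε) x)
    (ℚᵘₚ.+-cong (ℚₚ.toℚᵘ-homo-+ e ε) (toℚᵘ-/ X y)))) (ℚᵘₚ.≃-reflexive (cong ℚ.toℚᵘ sum≡1))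
  numerators : (k * δ′ + suc n * d′) * Y + X * (d′ * δ′) ≡ d′ * δ′ * Y
  numerators = ℤₚ.+-injective (trans
    (cong₂ ℤ._+_ (trans (ℤₚ.pos-* (k * δ′ + suc n * d′) Y) (cong (ℤ._* + Y) (cong₂ ℤ._+_ (ℤₚ.pos-* k δ′) (ℤₚ.pos-* (suc n) d′))))
      (ℤₚ.pos-* X (d′ * δ′)))
    (trans (sym (ℤₚ.*-identityʳ _)) (trans (ℚᵘₚ.drop-*≡* sum≃1) (ℤₚ.*-identityˡ _))))
  regroup : ∀ k δ n d Y X → k * (Y * δ) + d * (X * δ + Y) + n * d * Y ≡ (k * δ + suc n * d) * Y + X * (d * δ)
  regroup = ℕ-solve-∀
  reassociate : ∀ d δ Y → d * δ * Y ≡ d * (Y * δ)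
  reassociate = ℕ-solve-∀

-- With s₁ and s₂ again one less than at the top, X / Y = (A D + β) / (2 A (D + β)) is the deficit of the base exponent;
-- the factors c₀ and c₁ clear what cancels in this fraction.
record Splitting (d : ℕ) : Set where
  field
    s₁ s₂ X Y c₀ c₁ : ℕ
  D : ℕ
  D = suc (s₁ + s₂)
  A : ℕ
  A = suc (suc s₂)
  β : ℕ
  β = suc D * suc s₁
  field
    d≡   : d ≡ suc D
    Y≢0  : NonZero Y
    c₁≢0 : NonZero c₁
    base : baseExponent d ≡ 1ℚ ℚ.- (X ÷ℕ Y)
    Y≡   : c₀ * Y ≡ c₁ * (2 * A * (D + β))
    X≡   : c₀ * X ≡ c₁ * (A * D + β)
    β≤AD : β ≤ A * D

baseExponent-even : ∀ d → d ℕ.% 2 ≡ 0 →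
  baseExponent d ≡ 1ℚ ℚ.- ((2 * d * d + d ∸ 2) ÷ℕ ((d + 2) * (d * d + 2 * d ∸ 2)))
baseExponent-even d eq with d ℕ.% 2 | eq
... | zero | refl = refl

baseExponent-odd : ∀ d → d ℕ.% 2 ≡ 1 → baseExponent d ≡ 1ℚ ℚ.- ((2 * d + 3) ÷ℕ ((d + 2) * (d + 3)))
baseExponent-odd d eq with d ℕ.% 2 | eq
... | suc _ | _ = refl

split-even : ∀ k → Splitting (suc k * 2)
split-even k = record
  { s₁ = k ; s₂ = k ; X = X ; Y = Y ; c₀ = 1 ; c₁ = 2
  ; d≡   = double k
  ; Y≢0  = _
  ; c₁≢0 = _
  ; base = trans (baseExponent-even d (ℕ.m*n%n≡0 (suc k) 2)) (cong₂ (λ x y → 1ℚ ℚ.- (x ÷ℕ y))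
      (trans (cong (_∸ 2) (numerator k)) (ℕₚ.m+n∸n≡m X 2))
      (cong₂ _*_ (first k) (trans (cong (_∸ 2) (second k)) (ℕₚ.m+n∸n≡m (6 + (12 * k + 4 * k * k)) 2))))
  ; Y≡   = Y-identity k
  ; X≡   = X-identity k
  ; β≤AD = ℕₚ.≤-trans (ℕₚ.m≤m+n _ k) (ℕₚ.≤-reflexive (β-identity k))
  }
  where
  d X Y : ℕ
  d = suc k * 2
  -- The numerator 2d² + d - 2 and, below, the denominator (d + 2)(d² + 2d - 2) at d = 2k + 2,
  -- expanded so that no truncated subtraction remains.
  X = 8 + (18 * k + 8 * k * k)
  Y = (4 + 2 * k) * (6 + (12 * k + 4 * k * k))
  double : ∀ k → suc k * 2 ≡ suc (suc (k + k))
  double = ℕ-solve-∀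
  numerator : ∀ k → 2 * (suc k * 2) * (suc k * 2) + suc k * 2 ≡ 8 + (18 * k + 8 * k * k) + 2
  numerator = ℕ-solve-∀
  first : ∀ k → suc k * 2 + 2 ≡ 4 + 2 * k
  first = ℕ-solve-∀
  second : ∀ k → suc k * 2 * (suc k * 2) + 2 * (suc k * 2) ≡ 6 + (12 * k + 4 * k * k) + 2
  second = ℕ-solve-∀
  Y-identity : ∀ k → 1 * ((4 + 2 * k) * (6 + (12 * k + 4 * k * k))) ≡
    2 * (2 * suc (suc k) * (suc (k + k) + suc (suc (k + k)) * suc k))
  Y-identity = ℕ-solve-∀
  X-identity : ∀ k → 1 * (8 + (18 * k + 8 * k * k)) ≡ 2 * (suc (suc k) * suc (k + k) + suc (suc (k + k)) * suc k)
  X-identity = ℕ-solve-∀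
  β-identity : ∀ k → suc (suc (k + k)) * suc k + k ≡ suc (suc k) * suc (k + k)
  β-identity = ℕ-solve-∀

split-odd : ∀ k → Splitting (suc (suc k * 2))
split-odd k = record
  -- The extra dimension goes to s₂; the opposite split would violate β ≤ A D. `c₀` is the common
  -- factor k + 1 of D and β.
  { s₁ = k ; s₂ = suc k ; X = 2 * d + 3 ; Y = (d + 2) * (d + 3) ; c₀ = suc k ; c₁ = 1
  ; d≡   = double k
  ; Y≢0  = _
  ; c₁≢0 = _
  ; base = baseExponent-odd d (ℕ.[m+kn]%n≡m%n 1 (suc k) 2)
  ; Y≡   = Y-identity k
  ; X≡   = X-identity k
  ; β≤AD = ℕₚ.≤-trans (ℕₚ.m≤m+n _ (3 * k + 3)) (ℕₚ.≤-reflexive (β-identity k))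
  }
  where
  d : ℕ
  d = suc (suc k * 2)
  double : ∀ k → 1 + (1 + k) * 2 ≡ 2 + (k + (1 + k))
  double = ℕ-solve-∀
  Y-identity : ∀ k → (1 + k) * ((1 + (1 + k) * 2 + 2) * (1 + (1 + k) * 2 + 3)) ≡
    1 * (2 * (3 + k) * (1 + (k + (1 + k)) + (2 + (k + (1 + k))) * (1 + k)))
  Y-identity = ℕ-solve-∀
  X-identity : ∀ k → (1 + k) * (2 * (1 + (1 + k) * 2) + 3) ≡ 1 * ((3 + k) * (1 + (k + (1 + k))) + (2 + (k + (1 + k))) * (1 + k))
  X-identity = ℕ-solve-∀
  β-identity : ∀ k → (2 + (k + (1 + k))) * (1 + k) + (3 * k + 3) ≡ (3 + k) * (1 + (k + (1 + k)))
  β-identity = ℕ-solve-∀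

splitting : ∀ d → d ≥ 2 → Splitting d
splitting (suc zero)    (s≤s ())
splitting (suc (suc d)) _ = by d
  where
  parity : ∀ d → ∃ λ k → (d ≡ k * 2) ⊎ (d ≡ suc (k * 2))
  parity zero = 0 , inj₁ refl
  parity (suc d) with parity d
  ... | k , inj₁ refl = k , inj₂ refl
  ... | k , inj₂ refl = suc k , inj₁ refl
  by : ∀ d → Splitting (suc (suc d))
  by d with parity d
  ... | k , inj₁ refl = split-even k
  ... | k , inj₂ refl = split-odd k

module _ (ℝ : CompleteOrderedField) {d : ℕ} (split : Splitting d) (ε : ℚ) (0<ε : 0ℚ ℚ.< ε) (p : ℕ) (p-prime : Prime p)
  (large : 8 ^ suc (Splitting.s₁ split + Splitting.s₂ split) + 2 * suc (suc (Splitting.s₁ split + Splitting.s₂ split)) < p) where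

  open Splitting split using (s₁; s₂; X; Y; c₀; c₁; Y≢0; c₁≢0)

  private
    e : ℚ
    e = baseExponent d ℚ.- ε
    δ : ℕ
    δ = ↧ₙ ε
    8^D<p : 8 ^ suc (s₁ + s₂) < p
    8^D<p = ℕₚ.≤-<-trans (ℕₚ.m≤m+n _ _) large
    2d<p : 2 * suc (suc (s₁ + s₂)) < p
    2d<p = ℕₚ.≤-<-trans (ℕₚ.m≤n+m _ _) large
    module C = Construction s₁ s₂ δ p p-prime 8^D<p 2d<p
    F : ℕ
    F = C.D + C.β
    instance
      K≢0 : NonZero C.K
      K≢0 = ℕₚ.m^n≢0 p (C.E + (C.R + 1)) {{Prime.prime⇒nonZero p-prime}}

  -- Multiplication by c₀ replaces X and Y by c₁ times A D + β and 2 A F, after which c₁ cancels.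
  exponent-bound : ∀ k → ↥ e ≡ + k →
    k * (2 * C.A * F * δ) + ↧ₙ e * ((C.A * C.D + C.β) * δ + 2 * C.A * F) ≤ ↧ₙ e * (2 * C.A * F * δ)
  exponent-bound k eq = ℕₚ.*-cancelˡ-≤ c₁ {{c₁≢0}} (subst₂ _≤_
    (trans (left c₀ k Y δ (↧ₙ e) X) (trans (cong₂ (λ y x → k * (y * δ) + ↧ₙ e * (x * δ + y)) (Splitting.Y≡ split) (Splitting.X≡ split))
      (sym (left c₁ k (2 * C.A * F) δ (↧ₙ e) (C.A * C.D + C.β)))))
    (trans (right c₀ Y δ (↧ₙ e)) (trans (cong (λ y → ↧ₙ e * (y * δ)) (Splitting.Y≡ split)) (sym (right c₁ (2 * C.A * F) δ (↧ₙ e)))))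
    (ℕₚ.*-monoʳ-≤ c₀ (exponent-numerators e ε X Y {{Y≢0}} k (cong (ℚ._- ε) (Splitting.base split)) 0<ε eq)))
    where
    left : ∀ c k y δ den x → c * (k * (y * δ) + den * (x * δ + y)) ≡ k * (c * y * δ) + den * (c * x * δ + c * y)
    left = ℕ-solve-∀
    right : ∀ c y δ den → c * (den * (y * δ)) ≡ den * (c * y * δ)
    right = ℕ-solve-∀

  -- `I` only bounds the number of incidences from below, hence the claim for all J ≥ I. The sign of
  -- the numerator of `e` decides which clause of `PowGe` has to be met.
  arrangement : ∀ n m → 0 < n → 0 < m → ∃ λ I → Realisation.Arranged ℝ C.D n m C.R I × (∀ J → I ≤ J → PowGe J (recip C.K) e (m * n))
  arrangement n m 0<n 0<m = by (↥ e) refl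
    where
    by : ∀ i → ↥ e ≡ i → ∃ λ I → Realisation.Arranged ℝ C.D n m C.R I × (∀ J → I ≤ J → PowGe J (recip C.K) e (m * n))
    by (+ k) eq =
      let I , arr , 0<I , le = incidence-bound s₁ s₂ δ p p-prime 8^D<p 2d<p ℝ (Splitting.β≤AD split) k (↧ₙ e) (exponent-bound k eq) n m 0<n 0<m
      in I , arr , λ J I≤J → PowGe-pos J C.K e (m * n) k eq (ℕₚ.≤-trans le (ℕₚ.^-monoˡ-≤ (↧ₙ e) (ℕₚ.*-monoʳ-≤ C.K I≤J)))
    by -[1+ k ] eq =
      let u , v , _ , _ , arr = C.arranged ℝ n m 0<n 0<m
      in n * p ^ (C.β * C.S * v) , arr , λ J I≤J → PowGe-neg J C.K e (m * n) k eq
        (ℕₚ.<-≤-trans (ℕₚ.*-mono-≤ 0<n (ℕₚ.m^n>0 p {{Prime.prime⇒nonZero p-prime}} (C.β * C.S * v))) I≤J)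
        (ℕₚ.*-mono-≤ 0<m 0<n)

  theorem-in-dimension : ∃ λ r → r ≥ 1 × Σ ℚ λ c → 0ℚ ℚ.< c ×
    ((n m : ℕ) → n ≥ 1 → m ≥ 1 →
    Σ (Geometry.PointSet ℝ (suc C.D) n) λ P → Σ (Geometry.Arrangement ℝ (suc C.D) m) λ H →
    ¬ Geometry.ContainsK ℝ (suc C.D) r (proj₁ P) (proj₁ H) ×
    PowGe (Geometry.inc ℝ (suc C.D) (proj₁ P) (proj₁ H)) c e (m * n))
  theorem-in-dimension = C.R , ℕₚ.<⇒≤ C.1<R , recip C.K , ℚₚ.positive⁻¹ (recip C.K) {{recip-positive C.K}} , λ n m 0<n 0<m →
    let I , arr , enough = arrangement n m 0<n 0<m
        P , H , free , counted = Realisation.toGeometry ℝ C.D arr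
    in P , H , free , enough _ counted

theorem6 : (ℝ : CompleteOrderedField) → (d : ℕ) → d ≥ 2 → (ε : ℚ) → 0ℚ ℚ.< ε → ε ℚ.< 1ℚ →
    Σ ℕ λ r → r ≥ 1 × Σ ℚ λ c → 0ℚ ℚ.< c ×
    ((n m : ℕ) → n ≥ 1 → m ≥ 1 →
    Σ (Geometry.PointSet ℝ d n) λ P → Σ (Geometry.Arrangement ℝ d m) λ H →
    ¬ Geometry.ContainsK ℝ d r (proj₁ P) (proj₁ H) ×
    PowGe (Geometry.inc ℝ d (proj₁ P) (proj₁ H)) c (baseExponent d ℚ.- ε) (m * n))
theorem6 ℝ d d≥2 ε 0<ε ε<1 = subst Goal (sym (Splitting.d≡ split))
    (theorem-in-dimension ℝ split ε 0<ε (proj₁ prime) (proj₁ (proj₂ prime)) (proj₂ (proj₂ prime)))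
  where
  split : Splitting d
  split = splitting d d≥2
  prime = prime-above (8 ^ suc (Splitting.s₁ split + Splitting.s₂ split) + 2 * suc (suc (Splitting.s₁ split + Splitting.s₂ split)))
  Goal : ℕ → Set
  Goal d′ = Σ ℕ λ r → r ≥ 1 × Σ ℚ λ c → 0ℚ ℚ.< c ×
    ((n m : ℕ) → n ≥ 1 → m ≥ 1 →
    Σ (Geometry.PointSet ℝ d′ n) λ P → Σ (Geometry.Arrangement ℝ d′ m) λ H →
    ¬ Geometry.ContainsK ℝ d′ r (proj₁ P) (proj₁ H) ×
    PowGe (Geometry.inc ℝ d′ (proj₁ P) (proj₁ H)) c (baseExponent d ℚ.- ε) (m * n))
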